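{- Let $k>\ell$ be positive integers. Then \[ \mathscr{M}_{(k,\ell)}(N)=\Big(\frac{1}{k+\ell}+o(1)\Big)N\qquad (N\to\infty). \]
   Context: For positive integers $k>\ell$, a set $S$ of positive integers is $(k,\ell)$-sum-free if for all (not necessarily distinct) $x_1,\dots,x_k,y_1,\dots,y_\ell\in S$ one has $x_1+\dots+x_k\neq y_1+\dots+y_\ell$. For a finite set $A$ of positive integers, $\mathscr{M}_{(k,\ell)}(A)$ is the maximum size of a $(k,\ell)$-sum-free subset of $A$, and $\mathscr{M}_{(k,\ell)}(N)=\inf\{\mathscr{M}_{(k,\ell)}(A): A\subseteq\mathbb{Z}_{>0},\ |A|=N\}$. -}

module Defs where

open import Data.Nat using (ℕ; _+_; _*_; _≤_; _<_)
open import Data.Fin using (Fin)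
open import Data.List using (List; length; tabulate)
open import Data.Nat.ListAction using (sum)
open import Data.List.Membership.Propositional using (_∈_)
open import Data.List.Relation.Unary.All using (All)
open import Data.List.Relation.Unary.Unique.Propositional using (Unique)
open import Data.List.Relation.Binary.Subset.Propositional using (_⊆_)
open import Data.Product using (Σ; _×_)
open import Relation.Binary.PropositionalEquality using (_≡_; _≢_)

-- Finite sets of naturals are represented as duplicate-free lists;
-- the cardinality of such a set is the length of the list.

PosSet : List ℕ → Set
PosSet A = Unique A × All (λ x → 0 < x) A

sumF : ∀ {n} → (Fin n → ℕ) → ℕ
sumF {n} x = sum (tabulate x)

SumFree : ℕ → ℕ → List ℕ → Set
SumFree k l S = (x : Fin k → ℕ) (y : Fin l → ℕ) →
  (∀ i → x i ∈ S) → (∀ j → y j ∈ S) → sumF x ≢ sumF y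

SumFreeSubset : ℕ → ℕ → List ℕ → List ℕ → Set
SumFreeSubset k l A S = Unique S × S ⊆ A × SumFree k l S

-- Lower bound with ε = 1/d:  M_(k,ℓ)(N) ≥ (1/(k+ℓ) − 1/d) N, i.e. every
-- set A of N positive integers has a (k,ℓ)-sum-free subset S with
-- |S| ≥ (1/(k+ℓ) − 1/d) N   (cleared of denominators: multiply by d(k+ℓ)).
LowerBound : ℕ → ℕ → ℕ → ℕ → Set
LowerBound k l d N = (A : List ℕ) → PosSet A → length A ≡ N →
  Σ (List ℕ) λ S → SumFreeSubset k l A S ×
    d * N ≤ d * (k + l) * length S + (k + l) * N

-- Upper bound with ε = 1/d:  M_(k,ℓ)(N) ≤ (1/(k+ℓ) + 1/d) N, i.e. some
-- set A of N positive integers has all its (k,ℓ)-sum-free subsets S of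
-- size |S| ≤ (1/(k+ℓ) + 1/d) N.
UpperBound : ℕ → ℕ → ℕ → ℕ → Set
UpperBound k l d N = Σ (List ℕ) λ A → PosSet A × length A ≡ N ×
  ((S : List ℕ) → SumFreeSubset k l A S →
    d * (k + l) * length S ≤ d * N + (k + l) * N)

{-# OPTIONS --safe #-}

-- Lower bound.  For n = (k² - l²) q + 1 prime to A, a dilate of A modulo n has on average at least
-- the proportion 1/(k + l) of its elements in the sum-free interval (l q, k q].
--
-- Upper bound.  Write κ = k + l.  Let S be a sum-free subset of a multiplicative Følner set, of
-- density greater than 1/κ + ε.  Averaging over dilates produces a sum-free T ⊆ ℕ which has density
-- greater than 1/κ in M·[1, N] for many pairs (M, N), with lattices M ℕ of increasing modulus and
-- decreasing length.  A density increment argument along these pairs yields a long progression A of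
-- difference M on which T has density greater than 1/κ and meets almost all subprogressions of small
-- difference and moderate length, while R = T ∩ M·[1, N] has density greater than 1/κ.  Sum-freeness
-- says that A + (k-1) R and A + (l-1) R are disjoint, so it suffices that every addition of R
-- increases the density by that of R, up to a small error.
--
-- To see this, let X + R be disjoint from Y.  Sampling a few elements of R and the pigeonhole
-- principle give an almost period p: there are also few solutions of x + c + p = y.  So windows of
-- length p of X, R and Y become three subsets of ℤ/p with few solutions of x + c = y.  Dyson
-- transforms with substantial intersection shrink the second set until it is negligible and show that
-- the three densities add up to at most 1 + ε; they can only get stuck at a set which is periodic of
-- small period, which the regularity of A excludes.

module Submission where

open import Defs
open import Data.Bool using (Bool; true; false; _∧_; _∨_; not)
open import Data.Empty using (⊥; ⊥-elim)
open import Data.Fin using (Fin; zero; suc)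
open import Data.List using (List; []; _∷_; _++_; length; map; filter; upTo; applyUpTo; cartesianProductWith; deduplicate)
open import Data.List.Properties using (length-++; length-map; length-upTo; length-applyUpTo; length-filter)
open import Data.List.Membership.Propositional using (_∈_)
open import Data.List.Membership.Propositional.Properties
open import Data.List.Relation.Binary.Subset.Propositional using (_⊆_)
open import Data.List.Relation.Unary.All using (All; []; _∷_)
import Data.List.Relation.Unary.All as All
open import Data.List.Relation.Unary.AllPairs using ([]; _∷_)
open import Data.List.Relation.Unary.Any using (here; there)
open import Data.List.Relation.Unary.Unique.Propositional using (Unique)
import Data.List.Relation.Unary.Unique.Propositional.Properties as Uniqueₚ
open import Data.Nat
open import Data.Nat.DivMod using (m≡m%n+[m/n]*n; m%n<n; m<n⇒m%n≡m; [m+n]%n≡m%n; [m+kn]%n≡m%n; %-distribˡ-*; m%n%n≡m%n)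
open import Data.Nat.Divisibility using (_∣_; m≤n⇒m!∣n!; ∣-trans; m∣m*n; n∣m*n)
open import Data.Nat.ListAction using (product)
open import Data.Nat.ListAction.Properties using (∈⇒∣product; product≢0)
open import Data.Nat.Properties
open import Data.Nat.Tactic.RingSolver using (solve-∀)
open import Data.Product using (Σ; _,_; _×_; proj₁; proj₂)
open import Data.Sum using (_⊎_; inj₁; inj₂)
open import Data.Vec using (Vec; []; _∷_)
open import Relation.Binary.PropositionalEquality hiding (J)
open import Relation.Nullary using (¬_; Dec; yes; no; does; ¬?)
open import Relation.Nullary.Decidable using (_×-dec_; dec-true; dec-false)
open import Data.List.Membership.DecPropositional _≟_ using (_∈?_)
open import Data.List.Relation.Unary.Unique.DecPropositional.Properties _≟_ using (deduplicate-!)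

-- No bound near 1/κ holds on initial segments of ℕ: the odd numbers are (2,1)-sum-free of density
-- 1/2. Such congruence obstructions dictate the form of the lattices. In ℤ/p only sets periodic
-- under some q ≤ 2E obstruct the density inequality, so the moduli are powers of (2E)!: any such q
-- divides the ratio of two moduli, and a progression of difference q that misses the set contains a
-- missed block of a coarser lattice. This is paid for by a density increment. The increment bounds
-- the number of levels at which any sum-free T can be dense by a constant J₀ that depends neither
-- on T nor on the number I of levels. So the argument is run contrapositively: with I a large
-- multiple of J₀, a typical level is not dense for most dilates. All scales must therefore be fixed
-- before T is known. Errors are multiples of 1/E. R exceeds density 1/κ by 10/E; passing from R to
-- the progression A loses 1/E; each addition of R loses 8/E and so still gains 1/κ + 2/E. After k -
-- 1 and l - 1 additions the two disjoint sets would have total density above 1. A is much longer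
-- than R, so translations by elements of R cost only boundary terms.

-- The usual way to finish an estimate here: the hypotheses, scaled and added, form `x ≤ y`, and the
-- rest is an identity for the ring solver. Adding the surplus to both sides avoids subtraction in
-- ℕ.
≤-by : ∀ {a b} x y → x ≤ y → a + y ≡ b + x → a ≤ b
≤-by {a} {b} x y x≤y eq =
  +-cancelʳ-≤ y a b (≤-trans (≤-reflexive eq) (+-monoʳ-≤ b x≤y))

-- Finite sums, bounded search and indicators.

∑ : ℕ → (ℕ → ℕ) → ℕ
∑ zero    f = 0
∑ (suc n) f = f 0 + ∑ n (λ x → f (suc x))

∑-cong : ∀ n {f g : ℕ → ℕ} → (∀ x → x < n → f x ≡ g x) → ∑ n f ≡ ∑ n g
∑-cong zero    h = refl
∑-cong (suc n) h = cong₂ _+_ (h 0 z<s) (∑-cong n (λ x x<n → h (suc x) (s<s x<n)))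

∑-cong′ : ∀ n {f g : ℕ → ℕ} → (∀ x → f x ≡ g x) → ∑ n f ≡ ∑ n g
∑-cong′ n h = ∑-cong n (λ x _ → h x)

∑-mono : ∀ n {f g : ℕ → ℕ} → (∀ x → x < n → f x ≤ g x) → ∑ n f ≤ ∑ n g
∑-mono zero    h = z≤n
∑-mono (suc n) h = +-mono-≤ (h 0 z<s) (∑-mono n (λ x x<n → h (suc x) (s<s x<n)))

∑-mono′ : ∀ n {f g : ℕ → ℕ} → (∀ x → f x ≤ g x) → ∑ n f ≤ ∑ n g
∑-mono′ n h = ∑-mono n (λ x _ → h x)

∑-+ : ∀ n (f g : ℕ → ℕ) → ∑ n (λ x → f x + g x) ≡ ∑ n f + ∑ n g
∑-+ zero    f g = refl
∑-+ (suc n) f g = trans (cong (f 0 + g 0 +_) (∑-+ n _ _)) (eq (f 0) (g 0) _ _)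
  where
  eq : ∀ a b c d → a + b + (c + d) ≡ a + c + (b + d)
  eq = solve-∀

∑-*ˡ : ∀ n c (f : ℕ → ℕ) → ∑ n (λ x → c * f x) ≡ c * ∑ n f
∑-*ˡ zero    c f = sym (*-zeroʳ c)
∑-*ˡ (suc n) c f = trans (cong (c * f 0 +_) (∑-*ˡ n c _)) (sym (*-distribˡ-+ c (f 0) _))

∑-*ʳ : ∀ n c (f : ℕ → ℕ) → ∑ n (λ x → f x * c) ≡ ∑ n f * c
∑-*ʳ n c f = trans (∑-cong′ n (λ x → *-comm (f x) c)) (trans (∑-*ˡ n c f) (*-comm c _))

∑-const : ∀ n c → ∑ n (λ _ → c) ≡ n * c
∑-const zero    c = refl
∑-const (suc n) c = cong (c +_) (∑-const n c)

∑-zero : ∀ n → ∑ n (λ _ → 0) ≡ 0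
∑-zero n = trans (∑-const n 0) (*-zeroʳ n)

∑-split : ∀ a b (f : ℕ → ℕ) → ∑ (a + b) f ≡ ∑ a f + ∑ b (λ x → f (a + x))
∑-split zero    b f = refl
∑-split (suc a) b f = trans (cong (f 0 +_) (∑-split a b _)) (sym (+-assoc (f 0) _ _))

∑-last : ∀ n (f : ℕ → ℕ) → ∑ (suc n) f ≡ ∑ n f + f n
∑-last n f = trans (cong (λ k → ∑ k f) (+-comm 1 n))
  (trans (∑-split n 1 f) (cong (∑ n f +_) (trans (+-identityʳ _) (cong f (+-identityʳ n)))))

∑-swap : ∀ a b (f : ℕ → ℕ → ℕ) → ∑ a (λ x → ∑ b (f x)) ≡ ∑ b (λ y → ∑ a (λ x → f x y))
∑-swap zero    b f = sym (∑-zero b)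
∑-swap (suc a) b f = trans (cong (∑ b (f 0) +_) (∑-swap a b _)) (sym (∑-+ b _ _))

∑-blocks : ∀ V p (f : ℕ → ℕ) → ∑ (V * p) f ≡ ∑ V (λ v → ∑ p (λ c → f (v * p + c)))
∑-blocks zero    p f = refl
∑-blocks (suc V) p f = trans (∑-split p (V * p) f) (cong (∑ p f +_)
  (trans (∑-blocks V p _) (∑-cong′ V (λ v → ∑-cong′ p (λ c → cong f (sym (+-assoc p (v * p) c)))))))

∑-bound : ∀ n c {f : ℕ → ℕ} → (∀ x → x < n → f x ≤ c) → ∑ n f ≤ n * c
∑-bound n c h = ≤-trans (∑-mono n h) (≤-reflexive (∑-const n c))

∑-mono-range : ∀ {a b} (f : ℕ → ℕ) → a ≤ b → ∑ a f ≤ ∑ b f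
∑-mono-range {a} {b} f a≤b = subst (λ n → ∑ a f ≤ ∑ n f) (m+[n∸m]≡n a≤b)
  (≤-trans (m≤m+n _ _) (≤-reflexive (sym (∑-split a (b ∸ a) f))))

∑-term : ∀ n (f : ℕ → ℕ) x → x < n → f x ≤ ∑ n f
∑-term (suc n) f zero    _         = m≤m+n _ _
∑-term (suc n) f (suc x) (s≤s x<n) = ≤-trans (∑-term n (λ y → f (suc y)) x x<n) (m≤n+m _ (f 0))

∑-shift-≥ : ∀ G x (f : ℕ → ℕ) → (∀ w → f w ≤ 1) → ∑ G f ≤ ∑ G (λ u → f (x + u)) + x
∑-shift-≥ G x f f≤1 = begin
  ∑ G f                          ≤⟨ ∑-mono-range f (m≤n+m G x) ⟩
  ∑ (x + G) f                    ≡⟨ ∑-split x G f ⟩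
  ∑ x f + ∑ G (λ u → f (x + u))  ≤⟨ +-monoˡ-≤ _ (∑-bound x 1 (λ w _ → f≤1 w)) ⟩
  x * 1 + ∑ G (λ u → f (x + u))  ≡⟨ cong (_+ ∑ G (λ u → f (x + u))) (*-identityʳ x) ⟩
  x + ∑ G (λ u → f (x + u))      ≡⟨ +-comm x _ ⟩
  ∑ G (λ u → f (x + u)) + x      ∎
  where open ≤-Reasoning

∑-shift-≤ : ∀ G x y (f : ℕ → ℕ) → x ≤ y → ∑ G (λ u → f (x + u)) ≤ ∑ (G + y) f
∑-shift-≤ G x y f x≤y = begin
  ∑ G (λ u → f (x + u))           ≤⟨ m≤n+m _ (∑ x f) ⟩
  ∑ x f + ∑ G (λ u → f (x + u))   ≡⟨ sym (∑-split x G f) ⟩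
  ∑ (x + G) f                     ≤⟨ ∑-mono-range f (≤-trans (+-monoˡ-≤ G x≤y) (≤-reflexive (+-comm y G))) ⟩
  ∑ (G + y) f                     ∎
  where open ≤-Reasoning

∑-<-witness : ∀ n (f g : ℕ → ℕ) → ∑ n f < ∑ n g → Σ ℕ λ x → x < n × f x < g x
∑-<-witness (suc n) f g lt with f 0 <? g 0
... | yes p = 0 , z<s , p
... | no ¬p with ∑-<-witness n (λ x → f (suc x)) (λ x → g (suc x))
                  (+-cancelˡ-< (g 0) _ _ (≤-<-trans (+-monoˡ-≤ _ (≮⇒≥ ¬p)) lt))
...   | x , x<n , q = suc x , s<s x<n , q

search : ∀ {P : ℕ → Set} → (∀ x → Dec (P x)) → ∀ n →
  (Σ ℕ λ x → x < n × P x) ⊎ (∀ x → x < n → ¬ P x)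
search P? zero = inj₂ (λ x ())
search P? (suc n) with P? n
... | yes p = inj₁ (n , n<1+n n , p)
... | no ¬p with search P? n
...   | inj₁ (x , x<n , p) = inj₁ (x , m<n⇒m<1+n x<n , p)
...   | inj₂ none = inj₂ λ x x<1+n p → case x (m≤n⇒m<n∨m≡n (s≤s⁻¹ x<1+n)) p
  where
  case : ∀ x → x < n ⊎ x ≡ n → ¬ _
  case x (inj₁ x<n)  p = none x x<n p
  case x (inj₂ refl) p = ¬p p

χ : Bool → ℕ
χ true  = 1
χ false = 0

χ≤1 : ∀ b → χ b ≤ 1
χ≤1 true  = ≤-refl
χ≤1 false = z≤n

χ-not : ∀ b → χ b + χ (not b) ≡ 1
χ-not true  = refl
χ-not false = refl

χ-true : ∀ {b} → b ≡ true → χ b ≡ 1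
χ-true refl = refl

χ-pos : ∀ {b} → 0 < χ b → b ≡ true
χ-pos {true} _ = refl

χ₀ : ℕ → ℕ
χ₀ zero    = 1
χ₀ (suc _) = 0

χ₀≤1 : ∀ n → χ₀ n ≤ 1
χ₀≤1 zero    = ≤-refl
χ₀≤1 (suc n) = z≤n

χ₀-cover : ∀ n → 1 ≤ n + χ₀ n
χ₀-cover zero    = ≤-refl
χ₀-cover (suc n) = s≤s z≤n

χ₀-anti : ∀ {m n} → (0 < m → 0 < n) → χ₀ n ≤ χ₀ m
χ₀-anti {zero}  {n}     h = χ₀≤1 n
χ₀-anti {suc m} {zero}  h with () ← h z<s
χ₀-anti {suc m} {suc n} h = z≤n

♯ : ℕ → (ℕ → Bool) → ℕ
♯ n A = ∑ n (λ x → χ (A x))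

♯≤ : ∀ n A → ♯ n A ≤ n
♯≤ n A = ≤-trans (∑-bound n 1 (λ x _ → χ≤1 (A x))) (≤-reflexive (*-identityʳ n))

♯-not : ∀ n A → ♯ n A + ♯ n (λ x → not (A x)) ≡ n
♯-not n A = trans (sym (∑-+ n _ _)) (trans (∑-cong′ n (λ x → χ-not (A x)))
  (trans (∑-const n 1) (*-identityʳ n)))

hits : ℕ → ℕ → (ℕ → Bool) → ℕ → ℕ
hits m q A x = ∑ m (λ j → χ (A (x + j * q)))

∑-pos-witness : ∀ n (f : ℕ → ℕ) → 0 < ∑ n f → Σ ℕ λ x → x < n × 0 < f x
∑-pos-witness n f pos = ∑-<-witness n (λ _ → 0) f (subst (_< ∑ n f) (sym (∑-zero n)) pos)

two-witnesses : ∀ n (P : ℕ → Bool) → 1 < ∑ n (λ i → χ (P i)) →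
  Σ ℕ λ i → Σ ℕ λ j → i < j × j < n × P i ≡ true × P j ≡ true
two-witnesses (suc n) P gt with P 0 in eq
... | true with ∑-pos-witness n (λ i → χ (P (suc i))) (s≤s⁻¹ gt)
...   | j , j<n , pos = 0 , suc j , z<s , s<s j<n , eq , χ-pos pos
two-witnesses (suc n) P gt | false with two-witnesses n (λ i → P (suc i)) gt
...   | i , j , i<j , j<n , p , q = suc i , suc j , s<s i<j , s<s j<n , p , q

-- The counting form of "a finite set contained in one of no larger size is equal to it"; it turns
-- inclusion under a translation of ℤ/p into invariance.
∑-≤-tight : ∀ n (f g : ℕ → ℕ) → (∀ x → x < n → f x ≤ g x) → ∑ n g ≤ ∑ n f →
  ∀ x → x < n → g x ≤ f x
∑-≤-tight (suc n) f g f≤g le zero _ = ≤-by (∑ n f′ + _) (∑ n g′ + _)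
  (+-mono-≤ (∑-mono n (λ x x<n → f≤g (suc x) (s<s x<n))) le) (eq (g 0) (f 0) (∑ n f′) (∑ n g′))
  where
  f′ = λ x → f (suc x)
  g′ = λ x → g (suc x)
  eq : ∀ a b c d → a + (d + (b + c)) ≡ b + (c + (a + d))
  eq = solve-∀
∑-≤-tight (suc n) f g f≤g le (suc x) (s≤s x<n) = ∑-≤-tight n _ _
  (λ y y<n → f≤g (suc y) (s<s y<n))
  (+-cancelˡ-≤ (g 0) _ _ (≤-trans le (+-monoˡ-≤ _ (f≤g 0 z<s)))) x x<n

does-true : ∀ {P : Set} (d : Dec P) → does d ≡ true → P
does-true (yes p) _ = p

does-false : ∀ {P : Set} (d : Dec P) → does d ≡ false → ¬ P
does-false (no ¬p) _ = ¬p

∧-dec-elim : ∀ {P : Set} (d : Dec P) {b} → does d ∧ b ≡ true → P × b ≡ true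
∧-dec-elim (yes p) eq = p , eq

∧-dec-intro : ∀ {P : Set} (d : Dec P) {b} → P → b ≡ true → does d ∧ b ≡ true
∧-dec-intro d p refl = cong (_∧ true) (dec-true d p)

bool-case : ∀ (b : Bool) → b ≡ true ⊎ b ≡ false
bool-case true  = inj₁ refl
bool-case false = inj₂ refl

-- Counting in ℤ/p: rotations, solutions of b + y = z, missed progressions.

-- A subset of ℤ/p is encoded as a p-periodic predicate on ℕ.

Periodic : {X : Set} → ℕ → (ℕ → X) → Set
Periodic p f = ∀ x → f (p + x) ≡ f x

∑-rotate : ∀ p (f : ℕ → ℕ) → Periodic p f → ∀ e → ∑ p (λ x → f (e + x)) ≡ ∑ p f
∑-rotate p f per zero = refl
∑-rotate p f per (suc e) = trans
  (∑-rotate p (λ x → f (suc x)) (λ x → trans (cong f (sym (+-suc p x))) (per (suc x))) e)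
  (+-cancelˡ-≡ (f 0) _ _ (begin
    f 0 + ∑ p (λ x → f (suc x)) ≡⟨ ∑-last p f ⟩
    ∑ p f + f p                 ≡⟨ cong (λ z → ∑ p f + f z) (sym (+-identityʳ p)) ⟩
    ∑ p f + f (p + 0)           ≡⟨ cong (∑ p f +_) (per 0) ⟩
    ∑ p f + f 0                 ≡⟨ +-comm (∑ p f) (f 0) ⟩
    f 0 + ∑ p f                 ∎))
  where open ≡-Reasoning

∑-rotateʳ : ∀ p (f : ℕ → ℕ) → Periodic p f → ∀ e → ∑ p (λ x → f (x + e)) ≡ ∑ p f
∑-rotateʳ p f per e = trans (∑-cong′ p (λ x → cong f (+-comm x e))) (∑-rotate p f per e)

periodic-ext : ∀ p → 0 < p → (P : ℕ → Set) → (∀ x → P x → P (p + x)) →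
  (∀ x → x < p → P x) → ∀ x → P x
periodic-ext p p>0 P step base x = go x x ≤-refl
  where
  go : ∀ n x → x ≤ n → P x
  go n x x≤n with x <? p
  ... | yes x<p = base x x<p
  go zero x z≤n | no x≮p = ⊥-elim (x≮p p>0)
  go (suc n) x x≤n | no x≮p = subst P (m+[n∸m]≡n (≮⇒≥ x≮p))
    (step (x ∸ p) (go n (x ∸ p) (≤-trans (∸-monoʳ-≤ x p>0) (∸-monoˡ-≤ 1 x≤n))))

shift-index : ∀ {X : Set} p (A : ℕ → X) → Periodic p A → ∀ y → Periodic p (λ x → A (y + x))
shift-index p A per y x = trans (cong A (eq y p x)) (per (y + x))
  where
  eq : ∀ a b c → a + (b + c) ≡ b + (a + c)
  eq = solve-∀

triples : ℕ → (A B Z : ℕ → Bool) → ℕ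
triples p A B Z = ∑ p (λ b → ∑ p (λ y → χ (B b) * (χ (A y) * χ (Z (b + y)))))

-- Counts the starting points whose progression of difference `q` and length `m` misses `A`. A small
-- value is the regularity that rules out sets of period `q`.
bad : ℕ → ℕ → ℕ → (ℕ → Bool) → ℕ
bad p m q A = ∑ p (λ x → χ₀ (hits m q A x))

bad-anti : ∀ p m q {A A′ : ℕ → Bool} → (∀ x → A x ≡ true → A′ x ≡ true) →
  bad p m q A′ ≤ bad p m q A
bad-anti p m q {A} {A′} sub = ∑-mono′ p λ x → χ₀-anti λ pos →
  let j , j<m , pos′ = ∑-pos-witness m _ pos in
  <-≤-trans (subst (λ b → 0 < χ b) (sym (sub _ (χ-pos pos′))) z<s)
    (∑-term m (λ i → χ (A′ (x + i * q))) j j<m)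

∑-hits : ∀ p m q (A : ℕ → Bool) → Periodic p A → ∑ p (hits m q A) ≡ m * ♯ p A
∑-hits p m q A per = trans (∑-swap p m _) (trans
  (∑-cong′ m (λ j → ∑-rotateʳ p (λ x → χ (A x)) (λ x → cong χ (per x)) (j * q)))
  (∑-const m (♯ p A)))

-- Every start that is not bad accounts for one of the `m * ♯ p A` incidences, so regularity alone
-- forces density almost 1/m.
hits-cover : ∀ p m q (A : ℕ → Bool) → Periodic p A → p ≤ m * ♯ p A + bad p m q A
hits-cover p m q A per = begin
  p                                            ≡⟨ sym (trans (∑-const p 1) (*-identityʳ p)) ⟩
  ∑ p (λ _ → 1)                                ≤⟨ ∑-mono′ p (λ x → χ₀-cover (hits m q A x)) ⟩
  ∑ p (λ x → hits m q A x + χ₀ (hits m q A x)) ≡⟨ ∑-+ p _ _ ⟩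
  ∑ p (hits m q A) + bad p m q A               ≡⟨ cong (_+ bad p m q A) (∑-hits p m q A per) ⟩
  m * ♯ p A + bad p m q A                      ∎
  where open ≤-Reasoning

-- Every b ∈ B contributes |A ∩ (Z - b)| ≥ |A| + |Z| - p triples.
triples-lower : ∀ p (A B Z : ℕ → Bool) → Periodic p Z →
  ♯ p B * (♯ p A + ♯ p Z) ≤ triples p A B Z + ♯ p B * p
triples-lower p A B Z perZ = begin
  ♯ p B * (♯ p A + ♯ p Z)
    ≡⟨ sym (∑-*ʳ p (♯ p A + ♯ p Z) _) ⟩
  ∑ p (λ b → χ (B b) * (♯ p A + ♯ p Z))
    ≤⟨ ∑-mono′ p (λ b → *-monoʳ-≤ (χ (B b)) (row b)) ⟩
  ∑ p (λ b → χ (B b) * (∑ p (λ y → χ (A y) * χ (Z (b + y))) + p))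
    ≡⟨ ∑-cong′ p (λ b → trans (*-distribˡ-+ (χ (B b)) _ p)
         (cong (_+ χ (B b) * p) (sym (∑-*ˡ p (χ (B b)) _)))) ⟩
  ∑ p (λ b → ∑ p (λ y → χ (B b) * (χ (A y) * χ (Z (b + y)))) + χ (B b) * p)
    ≡⟨ ∑-+ p _ _ ⟩
  triples p A B Z + ∑ p (λ b → χ (B b) * p)
    ≡⟨ cong (triples p A B Z +_) (∑-*ʳ p p _) ⟩
  triples p A B Z + ♯ p B * p ∎
  where
  open ≤-Reasoning
  χχ : ∀ a z → χ a + χ z ≤ χ a * χ z + 1
  χχ true  true  = ≤-refl
  χχ true  false = ≤-refl
  χχ false true  = ≤-refl
  χχ false false = z≤n
  row : ∀ b → ♯ p A + ♯ p Z ≤ ∑ p (λ y → χ (A y) * χ (Z (b + y))) + p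
  row b = begin
    ♯ p A + ♯ p Z
      ≡⟨ cong (♯ p A +_) (sym (∑-rotate p (λ x → χ (Z x)) (λ x → cong χ (perZ x)) b)) ⟩
    ♯ p A + ∑ p (λ y → χ (Z (b + y)))
      ≡⟨ sym (∑-+ p _ _) ⟩
    ∑ p (λ y → χ (A y) + χ (Z (b + y)))
      ≤⟨ ∑-mono′ p (λ y → χχ (A y) (Z (b + y))) ⟩
    ∑ p (λ y → χ (A y) * χ (Z (b + y)) + 1)
      ≡⟨ trans (∑-+ p _ _) (cong (∑ p (λ y → χ (A y) * χ (Z (b + y))) +_)
           (trans (∑-const p 1) (*-identityʳ p))) ⟩
    ∑ p (λ y → χ (A y) * χ (Z (b + y))) + p ∎

-- The Dyson transform in ℤ/p.

meet gap : ℕ → (A B : ℕ → Bool) → ℕ → ℕ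
meet p A B e = ♯ p (λ x → B x ∧ A (e + x))
gap  p A B e = ♯ p (λ x → B x ∧ not (A (e + x)))

meet+gap : ∀ p A B e → meet p A B e + gap p A B e ≡ ♯ p B
meet+gap p A B e = trans (sym (∑-+ p _ _)) (∑-cong′ p (λ x → split (B x) (A (e + x))))
  where
  split : ∀ b a → χ (b ∧ a) + χ (b ∧ not a) ≡ χ b
  split true  true  = refl
  split true  false = refl
  split false _     = refl

∑-meet : ∀ p A B → Periodic p A → ∑ p (meet p A B) ≡ ♯ p B * ♯ p A
∑-meet p A B perA = begin
  ∑ p (λ e → ∑ p (λ x → χ (B x ∧ A (e + x))))
    ≡⟨ ∑-cong′ p (λ e → ∑-cong′ p (λ x → χ∧ (B x) (A (e + x)))) ⟩
  ∑ p (λ e → ∑ p (λ x → χ (B x) * χ (A (e + x))))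
    ≡⟨ ∑-swap p p _ ⟩
  ∑ p (λ x → ∑ p (λ e → χ (B x) * χ (A (e + x))))
    ≡⟨ ∑-cong′ p (λ x → trans (∑-*ˡ p (χ (B x)) _)
         (cong (χ (B x) *_) (∑-rotateʳ p (λ y → χ (A y)) (λ y → cong χ (perA y)) x))) ⟩
  ∑ p (λ x → χ (B x) * ♯ p A)
    ≡⟨ ∑-*ʳ p (♯ p A) _ ⟩
  ♯ p B * ♯ p A ∎
  where
  open ≡-Reasoning
  χ∧ : ∀ b a → χ (b ∧ a) ≡ χ b * χ a
  χ∧ true  a = sym (+-identityʳ (χ a))
  χ∧ false a = refl

-- In ℤ/p, A⁺ = A ∪ (B + e) and B⁻ = B ∩ (A - e); e⁻ stands for - e.

module Dyson (p : ℕ) (A B : ℕ → Bool) (perA : Periodic p A) (perB : Periodic p B)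
  (e e⁻ : ℕ) (e⁻+e : e⁻ + e ≡ p) where

  A⁺ B⁻ C : ℕ → Bool
  A⁺ x = A x ∨ B (e⁻ + x)
  B⁻ x = B x ∧ A (e + x)
  C x = B x ∧ not (A (e + x))

  e⁻+[e+x] : ∀ x → e⁻ + (e + x) ≡ p + x
  e⁻+[e+x] x = trans (sym (+-assoc e⁻ e x)) (cong (_+ x) e⁻+e)

  perC : Periodic p C
  perC x = cong₂ (λ a b → a ∧ not b) (perB x) (shift-index p A perA e x)

  perA⁺ : Periodic p A⁺
  perA⁺ x = cong₂ _∨_ (perA x) (shift-index p B perB e⁻ x)

  perB⁻ : Periodic p B⁻
  perB⁻ x = cong₂ _∧_ (perB x) (shift-index p A perA e x)

  A⁺⊇A : ∀ x → A x ≡ true → A⁺ x ≡ true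
  A⁺⊇A x eq rewrite eq = refl

  -- `C` is the part of `B` whose translate by `e` is new to `A`, so `A⁺` is the disjoint union of
  -- `A` and `C + e`. Both the size count and the triple count rest on this.
  C[e⁻+x] : ∀ x → χ (A⁺ x) ≡ χ (A x) + χ (C (e⁻ + x))
  C[e⁻+x] x rewrite trans (cong A (trans (sym (+-assoc e e⁻ x))
      (cong (_+ x) (trans (+-comm e e⁻) e⁻+e)))) (perA x) = go (A x) (B (e⁻ + x))
    where
    go : ∀ a b → χ (a ∨ b) ≡ χ a + χ (b ∧ not a)
    go true  true  = refl
    go true  false = refl
    go false true  = refl
    go false false = refl

  ∑C : ∀ (w : ℕ → ℕ) → Periodic p w →
    ∑ p (λ x → χ (C (e⁻ + x)) * w x) ≡ ∑ p (λ x → χ (C x) * w (e + x))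
  ∑C w perw = trans
    (sym (∑-rotate p (λ x → χ (C (e⁻ + x)) * w x)
      (λ x → cong₂ _*_ (cong χ (shift-index p C perC e⁻ x)) (perw x)) e))
    (∑-cong′ p (λ x → cong (λ z → χ z * w (e + x)) (trans (cong C (e⁻+[e+x] x)) (perC x))))

  size : ♯ p A⁺ + ♯ p B⁻ ≡ ♯ p A + ♯ p B
  size = begin
    ♯ p A⁺ + ♯ p B⁻
      ≡⟨ cong (_+ ♯ p B⁻) (trans (∑-cong′ p C[e⁻+x]) (∑-+ p _ _)) ⟩
    ♯ p A + ∑ p (λ x → χ (C (e⁻ + x))) + ♯ p B⁻
      ≡⟨ cong (λ z → ♯ p A + z + ♯ p B⁻) shiftC ⟩
    ♯ p A + gap p A B e + ♯ p B⁻
      ≡⟨ eq (♯ p A) (gap p A B e) (♯ p B⁻) ⟩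
    ♯ p A + (meet p A B e + gap p A B e)
      ≡⟨ cong (♯ p A +_) (meet+gap p A B e) ⟩
    ♯ p A + ♯ p B ∎
    where
    open ≡-Reasoning
    eq : ∀ a b c → a + b + c ≡ a + (c + b)
    eq = solve-∀
    shiftC : ∑ p (λ x → χ (C (e⁻ + x))) ≡ gap p A B e
    shiftC = trans (∑-cong′ p (λ x → sym (*-identityʳ _)))
      (trans (∑C (λ _ → 1) (λ _ → refl)) (∑-cong′ p (λ x → *-identityʳ _)))

  module _ (Z : ℕ → Bool) (perZ : Periodic p Z) where

    S₁ S₂ S₃ : ℕ
    S₁ = ∑ p (λ b → ∑ p (λ y → χ (B⁻ b) * (χ (A y) * χ (Z (b + y)))))
    S₂ = ∑ p (λ b → ∑ p (λ y → χ (B⁻ b) * (χ (C (e⁻ + y)) * χ (Z (b + y)))))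
    S₃ = ∑ p (λ b → ∑ p (λ y → χ (C b) * (χ (A y) * χ (Z (b + y)))))

    T⁺ : triples p A⁺ B⁻ Z ≡ S₁ + S₂
    T⁺ = trans (∑-cong′ p (λ b → trans
      (∑-cong′ p (λ y → trans (cong (λ z → χ (B⁻ b) * (z * χ (Z (b + y)))) (C[e⁻+x] y))
        (eq (χ (B⁻ b)) (χ (A y)) (χ (C (e⁻ + y))) (χ (Z (b + y)))))) (∑-+ p _ _))) (∑-+ p _ _)
      where
      eq : ∀ b a c z → b * ((a + c) * z) ≡ b * (a * z) + b * (c * z)
      eq = solve-∀

    T⁰ : triples p A B Z ≡ S₁ + S₃
    T⁰ = trans (∑-cong′ p (λ b → trans
      (∑-cong′ p (λ y → trans (cong (_* (χ (A y) * χ (Z (b + y)))) (sym (split (B b) (A (e + b)))))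
        (*-distribʳ-+ _ (χ (B⁻ b)) (χ (C b))))) (∑-+ p _ _))) (∑-+ p _ _)
      where
      split : ∀ b a → χ (b ∧ a) + χ (b ∧ not a) ≡ χ b
      split true  true  = refl
      split true  false = refl
      split false _     = refl

    -- Since b + y = (y - e) + (b + e), a triple with b in `B⁻` and y in `C + e` becomes one with y
    -- - e in `C` and b + e in `A` and the same sum: the new triples are at most the lost ones.
    S₂≤S₃ : S₂ ≤ S₃
    S₂≤S₃ = begin
      S₂
        ≡⟨ ∑-cong′ p (λ b → trans (∑-*ˡ p (χ (B⁻ b)) _) (trans
             (cong (χ (B⁻ b) *_) (∑C (λ y → χ (Z (b + y))) (λ y → cong χ (shift-index p Z perZ b y))))
             (sym (∑-*ˡ p (χ (B⁻ b)) _)))) ⟩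
      ∑ p (λ b → ∑ p (λ y → χ (B⁻ b) * (χ (C y) * χ (Z (b + (e + y))))))
        ≤⟨ ∑-mono′ p (λ b → ∑-mono′ p (λ y → *-monoˡ-≤ _ (B⁻≤ (B b) (A (e + b))))) ⟩
      ∑ p (λ b → ∑ p (λ y → χ (A (e + b)) * (χ (C y) * χ (Z (b + (e + y))))))
        ≡⟨ ∑-swap p p _ ⟩
      ∑ p (λ y → ∑ p (λ b → χ (A (e + b)) * (χ (C y) * χ (Z (b + (e + y))))))
        ≡⟨ ∑-cong′ p (λ y → trans
             (∑-cong′ p (λ b → trans (cong (λ z → χ (A (e + b)) * (χ (C y) * χ (Z z))) (ix b e y))
               (eq (χ (A (e + b))) (χ (C y)) _)))
             (∑-rotate p (λ b → χ (C y) * (χ (A b) * χ (Z (y + b))))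
               (λ b → cong₂ (λ s t → χ (C y) * (χ s * χ t)) (perA b) (shift-index p Z perZ y b)) e)) ⟩
      S₃ ∎
      where
      open ≤-Reasoning
      B⁻≤ : ∀ b a → χ (b ∧ a) ≤ χ a
      B⁻≤ true  a = ≤-refl
      B⁻≤ false a = z≤n
      ix : ∀ b e y → b + (e + y) ≡ y + (e + b)
      ix = solve-∀
      eq : ∀ a c z → a * (c * z) ≡ c * (a * z)
      eq = solve-∀

    triples-≤ : triples p A⁺ B⁻ Z ≤ triples p A B Z
    triples-≤ = subst₂ _≤_ (sym T⁺) (sym T⁰) (+-monoʳ-≤ S₁ S₂≤S₃)

-- Stuck transforms, and the three-set density bound in ℤ/p.

-- When no shift e makes the Dyson transform both substantial and proper, B ∩ (A - e) is for every e
-- either negligible or almost all of B.  The set of e of the second kind is invariant under every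
-- popular difference of B, hence under some 1 ≤ q ≤ 2E.

module Stuck (E m t₀ p : ℕ) (A B Z : ℕ → Bool)
  (E>0 : 0 < E) (m>0 : 0 < m) (t₀>0 : 0 < t₀)
  -- These factors make both `Δ * t₀` (with `Δ = 4 * m * E`) and `m * t₀` small compared with p/E,
  -- the lower bound for the size of `B`.
  (p≡ : p ≡ 2 * E * m * (4 * m * E) * t₀)
  (perA : Periodic p A) (perB : Periodic p B) (perZ : Periodic p Z)
  (badA : ∀ q → 0 < q → q ≤ 2 * E → 2 * E * bad p m q A ≤ p)
  (badZ : 2 * bad p m 1 Z ≤ p)
  (few : E * triples p A B Z ≤ t₀ * p)
  (B-large : p < E * ♯ p B)
  (stuck : ∀ e → e < p → ¬ (t₀ ≤ meet p A B e × ♯ p B ≤ 4 * m * E * gap p A B e))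
  where

  Δ b : ℕ
  Δ = 4 * m * E
  b = ♯ p B

  p>0 : 0 < p
  p>0 = subst (0 <_) (sym p≡) (*-mono-≤ {1} (*-mono-≤ {1} (*-mono-≤ {1} (*-mono-≤ {1} {2} (s≤s z≤n) E>0) m>0)
    (*-mono-≤ {1} (*-mono-≤ {1} {4} (s≤s z≤n) m>0) E>0)) t₀>0)

  Δt₀≤b : Δ * t₀ ≤ b
  Δt₀≤b = <⇒≤ (*-cancelˡ-< E (Δ * t₀) b (≤-<-trans le B-large))
    where
    le : E * (Δ * t₀) ≤ p
    le = subst (E * (Δ * t₀) ≤_) (sym p≡) (≤-trans (*-monoˡ-≤ (Δ * t₀) {E} {2 * E * m}
      (≤-trans (≤-trans (m≤m*n E m {{>-nonZero m>0}}) (*-monoˡ-≤ m (m≤m+n E (E + 0)))) ≤-refl))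
      (≤-reflexive (sym (*-assoc (2 * E * m) Δ t₀))))

  meet-per : ∀ e → meet p A B (p + e) ≡ meet p A B e
  meet-per e = ∑-cong′ p (λ x → cong (λ z → χ (B x ∧ z))
    (trans (cong A (+-assoc p e x)) (perA (e + x))))

  gap-per : ∀ e → gap p A B (p + e) ≡ gap p A B e
  gap-per e = ∑-cong′ p (λ x → cong (λ z → χ (B x ∧ not z))
    (trans (cong A (+-assoc p e x)) (perA (e + x))))

  full : ℕ → Bool
  full e = does (Δ * gap p A B e <? b)

  full-per : Periodic p full
  full-per e = cong (λ z → does (Δ * z <? b)) (gap-per e)

  not-full : ∀ e → full e ≡ false → meet p A B e < t₀
  not-full = periodic-ext p p>0 _
    (λ e h eq → subst (_< t₀) (sym (meet-per e)) (h (trans (sym (full-per e)) eq)))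
    (λ e e<p eq → ≰⇒> λ t₀≤ → stuck e e<p
      (t₀≤ , ≮⇒≥ (does-false (Δ * gap p A B e <? b) eq)))

  diff : ℕ → ℕ
  diff h = ♯ p (λ x → B x ∧ B (h + x))

  popular : ℕ → Bool
  popular h = does (2 * b <? Δ * diff h)

  -- A triangle inequality. For x and h + x in `B`, either h + e + x lies in `A` and x is counted by
  -- `meet` at h + e, or it does not and h + x is counted by `gap` at e.
  diff≤ : ∀ e h → diff h ≤ meet p A B (h + e) + gap p A B e
  diff≤ e h = begin
    diff h
      ≤⟨ ∑-mono′ p (λ x → subst (λ y → χ (B x ∧ B (h + x)) ≤ χ (B x ∧ A (h + e + x)) + χ (B (h + x) ∧ not (A y)))
           (ix h e x) (go (B x) (B (h + x)) (A (h + e + x)))) ⟩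
    ∑ p (λ x → χ (B x ∧ A (h + e + x)) + χ (B (h + x) ∧ not (A (e + (h + x)))))
      ≡⟨ ∑-+ p _ _ ⟩
    meet p A B (h + e) + ∑ p (λ x → χ (B (h + x) ∧ not (A (e + (h + x)))))
      ≡⟨ cong (meet p A B (h + e) +_) (∑-rotate p (λ x → χ (B x ∧ not (A (e + x))))
           (λ x → cong₂ (λ s t → χ (s ∧ not t)) (perB x) (shift-index p A perA e x)) h) ⟩
    meet p A B (h + e) + gap p A B e ∎
    where
    open ≤-Reasoning
    ix : ∀ h e x → h + e + x ≡ e + (h + x)
    ix = solve-∀
    go : ∀ x y z → χ (x ∧ y) ≤ χ (x ∧ z) + χ (y ∧ not z)
    go true  true  true  = ≤-refl
    go true  true  false = ≤-refl
    go true  false _     = z≤n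
    go false _     _     = z≤n

  full-closed : ∀ h → popular h ≡ true → ∀ e → full e ≡ true → full (h + e) ≡ true
  full-closed h pop e fe with bool-case (full (h + e))
  ... | inj₁ eq = eq
  ... | inj₂ eq = ⊥-elim (<⇒≱ (does-true (2 * b <? Δ * diff h) pop) (begin
      Δ * diff h                                  ≤⟨ *-monoʳ-≤ Δ (diff≤ e h) ⟩
      Δ * (meet p A B (h + e) + gap p A B e)      ≡⟨ *-distribˡ-+ Δ _ _ ⟩
      Δ * meet p A B (h + e) + Δ * gap p A B e    ≤⟨ +-mono-≤ (*-monoʳ-≤ Δ (<⇒≤ (not-full (h + e) eq)))
                                                      (<⇒≤ (does-true (Δ * gap p A B e <? b) fe)) ⟩
      Δ * t₀ + b                                  ≤⟨ +-monoˡ-≤ b Δt₀≤b ⟩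
      b + b                                       ≡⟨ cong (b +_) (sym (+-identityʳ b)) ⟩
      2 * b                                       ∎))
    where open ≤-Reasoning

  -- Translation by `h` is injective on ℤ/p and maps the finite set `full` into itself, hence onto
  -- itself.
  full-closed⁻ : ∀ h → popular h ≡ true → ∀ e → full (h + e) ≡ true → full e ≡ true
  full-closed⁻ h pop = periodic-ext p p>0 _
    (λ e ih fe → trans (full-per e) (ih (trans (sym (shift-index p full full-per h e)) fe)))
    (λ e e<p fe → χ-pos (<-≤-trans (subst (λ z → 0 < χ z) (sym fe) z<s)
      (∑-≤-tight p (λ x → χ (full x)) (λ x → χ (full (h + x))) (λ x _ → mono x)
        (≤-reflexive (∑-rotate p (λ x → χ (full x)) (λ x → cong χ (full-per x)) h)) e e<p)))
    where
    mono : ∀ x → χ (full x) ≤ χ (full (h + x))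
    mono x with bool-case (full x)
    ... | inj₁ eq = ≤-reflexive (trans (χ-true eq) (sym (χ-true (full-closed h pop x eq))))
    ... | inj₂ eq = ≤-trans (≤-reflexive (cong χ eq)) z≤n

  -- The mean of `diff` is b²/p, above b/E. Unpopular differences contribute at most 2b/Δ ≤ b/(2E)
  -- to it, which leaves popular ones of density above 1/(2E).
  many-popular : p < 2 * E * ♯ p popular
  many-popular = *-cancelˡ-< Δ p (2 * E * ♯ p popular) (*-cancelˡ-< b _ _ goal)
    where
    b>0 : 0 < b
    b>0 = n≢0⇒n>0 λ eq → n≮0 (subst (p <_) (trans (cong (E *_) eq) (*-zeroʳ E)) B-large)
    sumdiff : Δ * (b * b) ≤ ♯ p popular * (Δ * b) + p * (2 * b)
    sumdiff = begin
      Δ * (b * b)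
        ≡⟨ cong (Δ *_) (sym (∑-meet p B B perB)) ⟩
      Δ * ∑ p diff
        ≡⟨ sym (∑-*ˡ p Δ diff) ⟩
      ∑ p (λ h → Δ * diff h)
        ≤⟨ ∑-mono′ p bound ⟩
      ∑ p (λ h → χ (popular h) * (Δ * b) + 2 * b)
        ≡⟨ trans (∑-+ p _ _) (cong₂ _+_ (∑-*ʳ p (Δ * b) _) (∑-const p (2 * b))) ⟩
      ♯ p popular * (Δ * b) + p * (2 * b) ∎
      where
      open ≤-Reasoning
      diff≤b : ∀ h → diff h ≤ b
      diff≤b h = ∑-mono′ p (λ x → go (B x) (B (h + x)))
        where
        go : ∀ x y → χ (x ∧ y) ≤ χ x
        go true  y = χ≤1 y
        go false y = z≤n
      bound : ∀ h → Δ * diff h ≤ χ (popular h) * (Δ * b) + 2 * b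
      bound h with bool-case (popular h)
      ... | inj₁ eq rewrite eq = ≤-trans (*-monoʳ-≤ Δ (diff≤b h))
        (≤-trans (≤-reflexive (sym (+-identityʳ _))) (m≤m+n _ _))
      ... | inj₂ eq = ≤-trans (≮⇒≥ (does-false (2 * b <? Δ * diff h) eq)) (m≤n+m (2 * b) (χ (popular h) * (Δ * b)))
    goal : b * (Δ * p) < b * (Δ * (2 * E * ♯ p popular))
    goal = +-cancelʳ-< (2 * E * (p * (2 * b))) _ _ (begin-strict
      b * (Δ * p) + 2 * E * (p * (2 * b))
        ≤⟨ +-monoʳ-≤ (b * (Δ * p)) small ⟩
      b * (Δ * p) + b * (Δ * p)
        ≡⟨ e₁ b Δ p ⟩
      2 * (b * Δ) * p
        <⟨ *-monoʳ-< (2 * (b * Δ)) {{>-nonZero 2bΔ>0}} B-large ⟩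
      2 * (b * Δ) * (E * b)
        ≡⟨ e₂ b Δ E ⟩
      2 * E * (Δ * (b * b))
        ≤⟨ *-monoʳ-≤ (2 * E) sumdiff ⟩
      2 * E * (♯ p popular * (Δ * b) + p * (2 * b))
        ≡⟨ e₃ E (♯ p popular) Δ b (p * (2 * b)) ⟩
      b * (Δ * (2 * E * ♯ p popular)) + 2 * E * (p * (2 * b)) ∎)
      where
      open ≤-Reasoning
      2bΔ>0 : 0 < 2 * (b * Δ)
      2bΔ>0 = *-mono-≤ {1} {2} (s≤s z≤n) (*-mono-≤ {1} b>0 (*-mono-≤ {1} (*-mono-≤ {1} {4} (s≤s z≤n) m>0) E>0))
      e₁ : ∀ b Δ p → b * (Δ * p) + b * (Δ * p) ≡ 2 * (b * Δ) * p
      e₁ = solve-∀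
      e₂ : ∀ b Δ E → 2 * (b * Δ) * (E * b) ≡ 2 * E * (Δ * (b * b))
      e₂ = solve-∀
      e₃ : ∀ E s Δ b r → 2 * E * (s * (Δ * b) + r) ≡ b * (Δ * (2 * E * s)) + 2 * E * r
      e₃ = solve-∀
      small : 2 * E * (p * (2 * b)) ≤ b * (Δ * p)
      small = subst₂ _≤_ (e₄ E p b) (e₅ E p b m) (*-monoʳ-≤ (4 * E * p * b) m>0)
        where
        e₄ : ∀ E p b → 4 * E * p * b * 1 ≡ 2 * E * (p * (2 * b))
        e₄ = solve-∀
        e₅ : ∀ E p b m → 4 * E * p * b * m ≡ b * (4 * m * E * p)
        e₅ = solve-∀

  -- By averaging, some window of 2E + 1 consecutive residues contains two popular differences.
  -- `full` is then invariant under their distance.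
  popular-pair : Σ ℕ λ x → Σ ℕ λ i → Σ ℕ λ j → i < j × j ≤ 2 * E ×
    popular (x + i) ≡ true × popular (x + j) ≡ true
  popular-pair =
    let x , _ , gt = ∑-<-witness p (λ _ → 1) (λ x → ∑ (suc (2 * E)) (λ i → χ (popular (x + i)))) lt
        i , j , i<j , j< , pi , pj = two-witnesses (suc (2 * E)) (λ i → popular (x + i)) gt
    in x , i , j , i<j , s≤s⁻¹ j< , pi , pj
    where
    pop-per : Periodic p popular
    pop-per h = cong (λ z → does (2 * b <? Δ * z))
      (∑-cong′ p (λ x → cong (λ z → χ (B x ∧ z)) (trans (cong B (+-assoc p h x)) (perB (h + x)))))
    lt : ∑ p (λ _ → 1) < ∑ p (λ x → ∑ (suc (2 * E)) (λ i → χ (popular (x + i))))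
    lt = begin-strict
      ∑ p (λ _ → 1)
        ≡⟨ trans (∑-const p 1) (*-identityʳ p) ⟩
      p <⟨ many-popular ⟩
      2 * E * ♯ p popular
        ≤⟨ m≤n+m _ (♯ p popular) ⟩
      suc (2 * E) * ♯ p popular
        ≡⟨ sym (∑-const (suc (2 * E)) (♯ p popular)) ⟩
      ∑ (suc (2 * E)) (λ i → ♯ p popular)
        ≡⟨ ∑-cong′ (suc (2 * E)) (λ i → sym (∑-rotateʳ p (λ x → χ (popular x)) (λ x → cong χ (pop-per x)) i)) ⟩
      ∑ (suc (2 * E)) (λ i → ∑ p (λ x → χ (popular (x + i))))
        ≡⟨ ∑-swap (suc (2 * E)) p (λ i x → χ (popular (x + i))) ⟩
      ∑ p (λ x → ∑ (suc (2 * E)) (λ i → χ (popular (x + i)))) ∎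
      where open ≤-Reasoning

  period : Σ ℕ λ q → 0 < q × q ≤ 2 * E × (∀ e → full e ≡ false → full (q + e) ≡ false)
  period =
    let x , i , j , i<j , j≤ , pi , pj = popular-pair
    in j ∸ i , m<n⇒0<n∸m i<j , ≤-trans (m∸n≤m j i) j≤ , inv x i j i<j pi pj
    where
    ix : ∀ x i j → i < j → ∀ e → x + i + (j ∸ i + e) ≡ x + j + e
    ix x i j i<j e = trans (eq x i (j ∸ i) e) (cong (λ z → x + z + e) (m+[n∸m]≡n (<⇒≤ i<j)))
      where
      eq : ∀ x i d e → x + i + (d + e) ≡ x + (i + d) + e
      eq = solve-∀
    inv : ∀ x i j → i < j → popular (x + i) ≡ true → popular (x + j) ≡ true →
      ∀ e → full e ≡ false → full (j ∸ i + e) ≡ false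
    inv x i j i<j pi pj e fe with bool-case (full (j ∸ i + e))
    ... | inj₂ eq = eq
    ... | inj₁ eq with () ← trans (sym fe) (full-closed⁻ (x + j) pj e
            (trans (cong full (sym (ix x i j i<j e))) (full-closed (x + i) pi (j ∸ i + e) eq)))

  -- No e₀ + jq lies in `full`, so B ∩ (A - e₀ - jq) has fewer than `t₀` elements for each j < m.
  -- Together these sets cover `B` except for points whose progression of difference `q` misses the
  -- shifted `A`; this makes `B` too small.
  not-full⇒⊥ : ∀ q → 0 < q → q ≤ 2 * E → (∀ e → full e ≡ false → full (q + e) ≡ false) →
    ∀ e₀ → full e₀ ≡ false → ⊥
  not-full⇒⊥ q q>0 q≤ inv e₀ f₀ = <⇒≱ B-large (*-cancelˡ-≤ 2 (begin
      2 * (E * b)                               ≤⟨ *-monoʳ-≤ 2 (*-monoʳ-≤ E b≤) ⟩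
      2 * (E * (m * t₀ + bad p m q A))          ≡⟨ e₁ E m t₀ (bad p m q A) ⟩
      2 * E * m * t₀ + 2 * E * bad p m q A      ≤⟨ +-mono-≤ small (badA q q>0 q≤) ⟩
      p + p                                     ≡⟨ cong (p +_) (sym (+-identityʳ p)) ⟩
      2 * p                                     ∎))
    where
    open ≤-Reasoning
    e₁ : ∀ E m t s → 2 * (E * (m * t + s)) ≡ 2 * E * m * t + 2 * E * s
    e₁ = solve-∀
    small : 2 * E * m * t₀ ≤ p
    small = subst (2 * E * m * t₀ ≤_) (sym p≡) (*-monoˡ-≤ t₀ (m≤m*n (2 * E * m) Δ
      {{>-nonZero (*-mono-≤ {1} (*-mono-≤ {1} {4} (s≤s z≤n) m>0) E>0)}}))
    off : ∀ j → full (j * q + e₀) ≡ false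
    off zero    = f₀
    off (suc j) = trans (cong full (+-assoc q (j * q) e₀)) (inv (j * q + e₀) (off j))
    A′ : ℕ → Bool
    A′ x = A (e₀ + x)
    bad-eq : bad p m q A′ ≡ bad p m q A
    bad-eq = trans (∑-cong′ p (λ x → cong χ₀ (∑-cong′ m (λ j → cong (λ z → χ (A z)) (sym (+-assoc e₀ x (j * q)))))))
      (∑-rotate p (λ x → χ₀ (hits m q A x))
        (λ x → cong χ₀ (∑-cong′ m (λ j → cong χ (trans (cong A (+-assoc p x (j * q))) (perA _))))) e₀)
    pt : ∀ x → χ (B x) ≤ ∑ m (λ j → χ (B x ∧ A (j * q + e₀ + x))) + χ₀ (hits m q A′ x)
    pt x with B x
    ... | false = z≤n
    ... | true  = ≤-trans (χ₀-cover (hits m q A′ x)) (+-monoˡ-≤ _ (≤-reflexive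
      (∑-cong′ m (λ j → cong (λ z → χ (A z)) (ix e₀ x (j * q))))))
      where
      ix : ∀ e x y → e + (x + y) ≡ y + e + x
      ix = solve-∀
    b≤ : b ≤ m * t₀ + bad p m q A
    b≤ = begin
      b ≤⟨ ∑-mono′ p pt ⟩
      ∑ p (λ x → ∑ m (λ j → χ (B x ∧ A (j * q + e₀ + x))) + χ₀ (hits m q A′ x))
        ≡⟨ trans (∑-+ p _ _) (cong₂ _+_ (∑-swap p m _) bad-eq) ⟩
      ∑ m (λ j → meet p A B (j * q + e₀)) + bad p m q A
        ≤⟨ +-monoˡ-≤ _ (∑-bound m t₀ (λ j _ → <⇒≤ (not-full _ (off j)))) ⟩
      m * t₀ + bad p m q A ∎

  -- Averaging the gaps gives |A| ≥ (1 - 1/Δ) p, while regularity gives `Z` density at least 1/(2m)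
  -- = 2E/Δ. So |A| + |Z| - p is at least p/Δ, and there are too many triples.
  full⇒⊥ : (∀ e → e < p → full e ≡ true) → ⊥
  full⇒⊥ all-full = <⇒≱ few< few
    where
    open ≤-Reasoning
    T a z : ℕ
    T = triples p A B Z
    a = ♯ p A
    z = ♯ p Z
    gaps : Δ * (p * b) ≤ p * b + Δ * (b * a)
    gaps = begin
      Δ * (p * b)
        ≡⟨ cong (Δ *_) (sym (trans (∑-cong′ p (meet+gap p A B)) (∑-const p b))) ⟩
      Δ * ∑ p (λ e → meet p A B e + gap p A B e)
        ≡⟨ trans (cong (Δ *_) (∑-+ p _ _)) (trans (*-distribˡ-+ Δ _ _) (+-comm (Δ * ∑ p (meet p A B)) _)) ⟩
      Δ * ∑ p (gap p A B) + Δ * ∑ p (meet p A B)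
        ≡⟨ cong₂ (λ s t → s + Δ * t) (sym (∑-*ˡ p Δ _)) (∑-meet p A B perA) ⟩
      ∑ p (λ e → Δ * gap p A B e) + Δ * (b * a)
        ≤⟨ +-monoˡ-≤ _ (∑-bound p b (λ e e<p → <⇒≤ (does-true (Δ * gap p A B e <? b) (all-full e e<p)))) ⟩
      p * b + Δ * (b * a) ∎
    z-large : p ≤ 2 * (m * z)
    z-large = ≤-by (2 * p + 2 * bad p m 1 Z) (2 * (m * z + bad p m 1 Z) + p)
      (+-mono-≤ (*-monoʳ-≤ 2 (hits-cover p m 1 Z perZ)) badZ) (eq p (m * z) (bad p m 1 Z))
      where
      eq : ∀ p mz s → p + (2 * (mz + s) + p) ≡ 2 * mz + (2 * p + 2 * s)
      eq = solve-∀
    -- Δ T + b p ≥ b Δ z ≥ 2 E p b.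
    T-lower : 2 * E * p * b ≤ Δ * T + b * p
    T-lower = ≤-by (Δ * (p * b) + (Δ * (b * (a + z)) + 2 * E * b * p))
        (p * b + Δ * (b * a) + (Δ * (T + b * p) + 2 * E * b * (2 * (m * z))))
        (+-mono-≤ gaps (+-mono-≤ (*-monoʳ-≤ Δ (triples-lower p A B Z perZ)) (*-monoʳ-≤ (2 * E * b) z-large)))
        (eq E p b a z m T)
      where
      eq : ∀ E p b a z m T → 2 * E * p * b + (p * b + 4 * m * E * (b * a) + (4 * m * E * (T + b * p) + 2 * E * b * (2 * (m * z))))
        ≡ 4 * m * E * T + b * p + (4 * m * E * (p * b) + (4 * m * E * (b * (a + z)) + 2 * E * b * p))
      eq = solve-∀
    bp≤ : b * p ≤ Δ * T
    bp≤ = +-cancelʳ-≤ (b * p) _ _ (≤-trans (begin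
      b * p + b * p  ≡⟨ e b p ⟩
      2 * 1 * p * b  ≤⟨ *-monoˡ-≤ b (*-monoˡ-≤ p (*-monoʳ-≤ 2 E>0)) ⟩
      2 * E * p * b  ∎) T-lower)
      where
      e : ∀ b p → b * p + b * p ≡ 2 * 1 * p * b
      e = solve-∀
    few< : t₀ * p < E * T
    few< = *-cancelˡ-< Δ _ _ (begin-strict
      Δ * (t₀ * p)  ≡⟨ sym (*-assoc Δ t₀ p) ⟩
      Δ * t₀ * p    ≤⟨ *-monoˡ-≤ p Δt₀≤p ⟩
      p * p         <⟨ *-monoˡ-< p {{>-nonZero p>0}} B-large ⟩
      E * b * p     ≡⟨ *-assoc E b p ⟩
      E * (b * p)   ≤⟨ *-monoʳ-≤ E bp≤ ⟩
      E * (Δ * T)   ≡⟨ e E Δ T ⟩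
      Δ * (E * T)   ∎)
      where
      e : ∀ E Δ T → E * (Δ * T) ≡ Δ * (E * T)
      e = solve-∀
      Δt₀≤p : Δ * t₀ ≤ p
      Δt₀≤p = ≤-trans Δt₀≤b (♯≤ p B)

  contradiction : ⊥
  contradiction with search (λ e → full e Data.Bool.≟ false) p
  ... | inj₁ (e , _ , f) = let q , q>0 , q≤ , inv = period in not-full⇒⊥ q q>0 q≤ inv e f
  ... | inj₂ none = full⇒⊥ λ e e<p → case (bool-case (full e)) (none e e<p)
    where
    case : ∀ {b : Bool} → b ≡ true ⊎ b ≡ false → ¬ b ≡ false → b ≡ true
    case (inj₁ t) _ = t
    case (inj₂ f) n = ⊥-elim (n f)

-- A substantial transform keeps |A| + |B|, creates no triples, only enlarges `A` and leaves at
-- least `t₀` elements in `B`, so every hypothesis survives. Once |B| ≤ p/E, each of these at least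
-- `t₀` elements yields |A| + |Z| - p triples, and `few` forces |A| + |Z| ≤ (1 + 1/E) p.
cyclic-bound : ∀ E m t₀ p (Z : ℕ → Bool) → 0 < E → 0 < m → 0 < t₀ →
  p ≡ 2 * E * m * (4 * m * E) * t₀ → Periodic p Z → 2 * bad p m 1 Z ≤ p →
  ∀ A B → Periodic p A → Periodic p B →
  (∀ q → 0 < q → q ≤ 2 * E → 2 * E * bad p m q A ≤ p) →
  t₀ ≤ ♯ p B → E * triples p A B Z ≤ t₀ * p →
  E * (♯ p A + ♯ p B + ♯ p Z) ≤ (E + 2) * p
cyclic-bound E m t₀ p Z E>0 m>0 t₀>0 p≡ perZ badZ A B = go p A B (♯≤ p B)
  where
  go : ∀ n A B → ♯ p B ≤ n → Periodic p A → Periodic p B →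
    (∀ q → 0 < q → q ≤ 2 * E → 2 * E * bad p m q A ≤ p) →
    t₀ ≤ ♯ p B → E * triples p A B Z ≤ t₀ * p →
    E * (♯ p A + ♯ p B + ♯ p Z) ≤ (E + 2) * p
  go n A B B≤n perA perB badA t₀≤ few with E * ♯ p B ≤? p
  ... | yes small = ≤-trans (≤-reflexive (e₁ E (♯ p A) (♯ p B) (♯ p Z)))
          (≤-trans (+-mono-≤ AZ small) (≤-reflexive (e₂ E p)))
    where
    a b z T : ℕ
    a = ♯ p A
    b = ♯ p B
    z = ♯ p Z
    T = triples p A B Z
    e₁ : ∀ E a b z → E * (a + b + z) ≡ E * (a + z) + E * b
    e₁ = solve-∀
    e₂ : ∀ E p → suc E * p + p ≡ (E + 2) * p
    e₂ = solve-∀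
    AZ : E * (a + z) ≤ suc E * p
    AZ = ≮⇒≥ λ gt → <⇒≱ (few< gt) few
      where
      few< : suc E * p < E * (a + z) → t₀ * p < E * T
      few< gt = ≤-trans (+-monoˡ-≤ (t₀ * p) t₀>0) (≤-trans (≤-reflexive (sym (*-suc t₀ p)))
        (≤-trans (*-monoˡ-≤ (suc p) t₀≤)
          (≤-by (b * suc (suc E * p) + E * (b * (a + z))) (b * (E * (a + z)) + E * (T + b * p))
            (+-mono-≤ (*-monoʳ-≤ b gt) (*-monoʳ-≤ E (triples-lower p A B Z perZ))) (eq b p E (a + z) T))))
        where
        eq : ∀ b p E s T → b * (1 + p) + (b * (E * s) + E * (T + b * p)) ≡ E * T + (b * (1 + (1 + E) * p) + E * (b * s))
        eq = solve-∀
  ... | no large with search (λ e → (t₀ ≤? meet p A B e) ×-dec (♯ p B ≤? 4 * m * E * gap p A B e)) p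
  ...   | inj₂ stuck = ⊥-elim (Stuck.contradiction E m t₀ p A B Z E>0 m>0 t₀>0 p≡ perA perB perZ
                         badA badZ few (≰⇒> large) stuck)
  ...   | inj₁ (e , e<p , t₀≤c , b≤) = step n B≤n
    where
    module D = Dyson p A B perA perB e (p ∸ e) (m∸n+n≡m (<⇒≤ e<p))
    gap>0 : 0 < gap p A B e
    gap>0 with gap p A B e
    ... | suc _ = z<s
    ... | zero  = ⊥-elim (<⇒≱ t₀>0 (≤-trans t₀≤ (≤-trans b≤ (≤-reflexive (*-zeroʳ (4 * m * E))))))
    smaller : ♯ p D.B⁻ < ♯ p B
    smaller = <-≤-trans (≤-trans (≤-reflexive (+-comm 1 _)) (+-monoʳ-≤ (meet p A B e) gap>0))
      (≤-reflexive (meet+gap p A B e))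
    step : ∀ n → ♯ p B ≤ n → E * (♯ p A + ♯ p B + ♯ p Z) ≤ (E + 2) * p
    step zero    B≤n = ⊥-elim (n≮0 (<-≤-trans smaller B≤n))
    step (suc n) B≤n = subst (λ s → E * (s + ♯ p Z) ≤ (E + 2) * p) D.size
      (go n D.A⁺ D.B⁻ (s≤s⁻¹ (<-≤-trans smaller B≤n)) D.perA⁺ D.perB⁻
        (λ q q>0 q≤ → ≤-trans (*-monoʳ-≤ (2 * E) (bad-anti p m q D.A⁺⊇A)) (badA q q>0 q≤))
        t₀≤c (≤-trans (*-monoʳ-≤ E (D.triples-≤ Z perZ)) few))

-- Random tuples and almost periods.

-- Sums over [0, U)^h, standing for expectations over random tuples; `∑ᵛ-∏` is the independence of
-- the coordinates.
∑ᵛ : ∀ h → ℕ → (Vec ℕ h → ℕ) → ℕ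
∑ᵛ zero    U f = f []
∑ᵛ (suc h) U f = ∑ U (λ d → ∑ᵛ h U (λ ds → f (d ∷ ds)))

∏ᵛ : ∀ {h} → (ℕ → ℕ) → Vec ℕ h → ℕ
∏ᵛ r []       = 1
∏ᵛ r (d ∷ ds) = r d * ∏ᵛ r ds

∑ᵛ-cong : ∀ h U {f g : Vec ℕ h → ℕ} → (∀ ds → f ds ≡ g ds) → ∑ᵛ h U f ≡ ∑ᵛ h U g
∑ᵛ-cong zero    U e = e []
∑ᵛ-cong (suc h) U e = ∑-cong′ U (λ d → ∑ᵛ-cong h U (λ ds → e (d ∷ ds)))

∑ᵛ-mono : ∀ h U {f g : Vec ℕ h → ℕ} → (∀ ds → f ds ≤ g ds) → ∑ᵛ h U f ≤ ∑ᵛ h U g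
∑ᵛ-mono zero    U e = e []
∑ᵛ-mono (suc h) U e = ∑-mono′ U (λ d → ∑ᵛ-mono h U (λ ds → e (d ∷ ds)))

∑ᵛ-+ : ∀ h U (f g : Vec ℕ h → ℕ) → ∑ᵛ h U (λ ds → f ds + g ds) ≡ ∑ᵛ h U f + ∑ᵛ h U g
∑ᵛ-+ zero    U f g = refl
∑ᵛ-+ (suc h) U f g = trans (∑-cong′ U (λ d → ∑ᵛ-+ h U _ _)) (∑-+ U _ _)

∑ᵛ-*ˡ : ∀ h U c (f : Vec ℕ h → ℕ) → ∑ᵛ h U (λ ds → c * f ds) ≡ c * ∑ᵛ h U f
∑ᵛ-*ˡ zero    U c f = refl
∑ᵛ-*ˡ (suc h) U c f = trans (∑-cong′ U (λ d → ∑ᵛ-*ˡ h U c _)) (∑-*ˡ U c _)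

∑ᵛ-const : ∀ h U c → ∑ᵛ h U (λ _ → c) ≡ U ^ h * c
∑ᵛ-const zero    U c = sym (+-identityʳ c)
∑ᵛ-const (suc h) U c = trans (∑-cong′ U (λ d → ∑ᵛ-const h U c))
  (trans (∑-const U _) (sym (*-assoc U (U ^ h) c)))

∑ᵛ-swap : ∀ h U n (f : Vec ℕ h → ℕ → ℕ) →
  ∑ᵛ h U (λ ds → ∑ n (f ds)) ≡ ∑ n (λ x → ∑ᵛ h U (λ ds → f ds x))
∑ᵛ-swap zero    U n f = refl
∑ᵛ-swap (suc h) U n f = trans (∑-cong′ U (λ d → ∑ᵛ-swap h U n _)) (∑-swap U n _)

∑ᵛ-∏ : ∀ h U r → ∑ᵛ h U (∏ᵛ r) ≡ ∑ U r ^ h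
∑ᵛ-∏ zero    U r = refl
∑ᵛ-∏ (suc h) U r = trans (∑-cong′ U (λ d → trans (∑ᵛ-*ˡ h U (r d) (∏ᵛ r)) (cong (r d *_) (∑ᵛ-∏ h U r))))
  (∑-*ʳ U (∑ U r ^ h) r)

∏ᵛ-≤1 : ∀ {h} r → (∀ x → r x ≤ 1) → (ds : Vec ℕ h) → ∏ᵛ r ds ≤ 1
∏ᵛ-≤1 r r≤1 []       = ≤-refl
∏ᵛ-≤1 r r≤1 (d ∷ ds) = *-mono-≤ (r≤1 d) (∏ᵛ-≤1 r r≤1 ds)

∏ᵛ-* : ∀ {h} r s (ds : Vec ℕ h) → ∏ᵛ (λ d → r d * s d) ds ≡ ∏ᵛ r ds * ∏ᵛ s ds
∏ᵛ-* r s []       = refl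
∏ᵛ-* r s (d ∷ ds) = trans (cong (r d * s d *_) (∏ᵛ-* r s ds)) (eq (r d) (s d) _ _)
  where
  eq : ∀ a b c d → a * b * (c * d) ≡ a * c * (b * d)
  eq = solve-∀

pow-* : ∀ a b n → (a * b) ^ n ≡ a ^ n * b ^ n
pow-* a b zero    = refl
pow-* a b (suc n) = trans (cong (a * b *_) (pow-* a b n)) (e a b (a ^ n) (b ^ n))
  where
  e : ∀ a b c d → a * b * (c * d) ≡ a * c * (b * d)
  e = solve-∀

-- Among the indices with `F j` nonzero only the first may have `M j ≤ B`; each of the others pays
-- for itself with at least `suc B`.
sparse-sum : ∀ K B (F M : ℕ → ℕ) → (∀ j → F j ≤ 1) →
  (∀ i j → i < j → j < K → 0 < F i → 0 < F j → B < M j) →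
  suc B * ∑ K F ≤ suc B + ∑ K (λ j → F j * M j)
sparse-sum zero B F M F≤1 h = ≤-trans (≤-reflexive (*-zeroʳ (suc B))) z≤n
sparse-sum (suc K) B F M F≤1 h = subst₂ (λ s t → suc B * s ≤ suc B + t)
  (sym (∑-last K F)) (sym (∑-last K (λ j → F j * M j)))
  (last (F K) refl (F≤1 K) (∑ K F) refl)
  where
  open ≤-Reasoning
  rest : ℕ
  rest = ∑ K (λ j → F j * M j)
  ih : suc B * ∑ K F ≤ suc B + rest
  ih = sparse-sum K B F M F≤1 (λ i j i<j j<K → h i j i<j (m<n⇒m<1+n j<K))
  last : ∀ a → F K ≡ a → a ≤ 1 → ∀ s → ∑ K F ≡ s → suc B * (∑ K F + F K) ≤ suc B + (rest + F K * M K)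
  last zero eq _ s _ rewrite eq =
    subst₂ (λ u v → suc B * u ≤ suc B + v) (sym (+-identityʳ _)) (sym (+-identityʳ _)) ih
  last (suc zero) eq _ zero seq rewrite eq | seq = ≤-trans (≤-reflexive (*-identityʳ (suc B))) (m≤m+n _ _)
  last (suc zero) eq _ (suc s) seq = begin
    suc B * (∑ K F + F K)           ≡⟨ cong (λ z → suc B * (∑ K F + z)) eq ⟩
    suc B * (∑ K F + 1)             ≡⟨ e (suc B) (∑ K F) ⟩
    suc B * ∑ K F + suc B           ≤⟨ +-mono-≤ ih M-large ⟩
    suc B + rest + M K              ≡⟨ +-assoc (suc B) rest (M K) ⟩
    suc B + (rest + M K)            ≡⟨ cong (λ z → suc B + (rest + z)) (sym (trans (cong (_* M K) eq) (*-identityˡ (M K)))) ⟩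
    suc B + (rest + F K * M K)      ∎
    where
    e : ∀ b s → b * (s + 1) ≡ b * s + b
    e = solve-∀
    M-large : suc B ≤ M K
    M-large = let i , i<K , pos = ∑-pos-witness K F (subst (0 <_) (sym seq) z<s)
              in h i K i<K (n<1+n K) pos (subst (0 <_) (sym eq) z<s)
  last (suc (suc a)) _ (s≤s ()) _ _

near : ℕ → (R Y : ℕ → Bool) → ℕ → ℕ
near N R Y x = ∑ N (λ c → χ (R c) * χ (Y (x + c)))

near≤ : ∀ N R Y x → near N R Y x ≤ ♯ N R
near≤ N R Y x = ∑-mono′ N (λ c → ≤-trans (*-monoʳ-≤ (χ (R c)) (χ≤1 (Y (x + c)))) (≤-reflexive (*-identityʳ _)))

collisions : ℕ → ℕ → (X R Y : ℕ → Bool) → ℕ → ℕ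
collisions W N X R Y p = ∑ W (λ w → χ (X w) * near N R Y (p + w))

-- If a random tuple c⃗ ∈ Rʰ meets (Y - x) for most x with many representations, and c⃗ + p ∈ Rʰ as
-- well, then p is an almost period.  Such a pair of tuples comes from the pigeonhole principle.

module AlmostPeriod (κ δ h P N W B₀ : ℕ) (X R Y : ℕ → Bool)
  (N>0 : 0 < N)
  (R-supp : ∀ c → R c ≡ true → c < N)
  (R-dense : N ≤ κ * ♯ N R)
  (disj : ∀ x c → X x ≡ true → R c ≡ true → Y (x + c) ≡ false)
  (h-large : 4 * suc δ * δ ^ h ≤ suc δ ^ h)
  (KP≤N : suc (2 * (2 * κ) ^ h) * P ≤ N)
  (W-small : W + N ≤ 2 * (suc δ * B₀))
  where

  -- `[0, U)` contains all the translates R + jP with j < K. As `U ^ h` is at most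
  -- `(2 * κ) ^ h * r ^ h`, the h-th powers of these translates cover tuples more than twice on
  -- average.
  Δ K U r : ℕ
  Δ = suc δ
  K = suc (2 * (2 * κ) ^ h)
  U = N + N
  r = ♯ N R

  g : ℕ → ℕ
  g = near N R Y

  big : ℕ → Bool
  big x = does (r ≤? Δ * g x)

  -- The translate R + jP. Below, `F j` indicates its h-th power, `avoid j x` says that the tuple
  -- moved back by jP contains no element of Y - x, and `M j` counts the points x with many
  -- representations which the tuple nevertheless fails to detect.
  Rⱼ : ℕ → ℕ → Bool
  Rⱼ j d = does (j * P ≤? d) ∧ R (d ∸ j * P)

  F : ∀ {h} → ℕ → Vec ℕ h → ℕ
  F j = ∏ᵛ (λ d → χ (Rⱼ j d))

  avoid : ∀ {h} → ℕ → ℕ → Vec ℕ h → ℕ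
  avoid j x = ∏ᵛ (λ d → χ (not (Y (x + (d ∸ j * P)))))

  M : ∀ {h} → ℕ → Vec ℕ h → ℕ
  M j ds = ∑ (W + N) (λ x → χ (big x) * avoid j x ds)

  iP≤N : ∀ i → i < K → i * P ≤ N
  iP≤N i i<K = ≤-trans (*-monoˡ-≤ P (<⇒≤ i<K)) KP≤N

  head-pos : ∀ a b → 0 < χ a * b → a ≡ true × 0 < b
  head-pos true b pos = refl , subst (0 <_) (+-identityʳ b) pos

  -- The point (j - i)P + w together with d - jP has the sum w + (d - iP), which is in X + R and
  -- hence not in `Y`. So one tuple shared by two translates is undetected at all these points.
  avoids : ∀ {h} i j → i < j → ∀ w → X w ≡ true → (ds : Vec ℕ h) →
    0 < F i ds → 0 < F j ds → avoid j ((j ∸ i) * P + w) ds ≡ 1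
  avoids i j i<j w Xw [] _ _ = refl
  avoids i j i<j w Xw (d ∷ ds) pi pj =
    let Ri , pi′ = head-pos (Rⱼ i d) _ pi
        Rj , pj′ = head-pos (Rⱼ j d) _ pj
        iP≤d , Rd = ∧-dec-elim (i * P ≤? d) Ri
        jP≤d , _ = ∧-dec-elim (j * P ≤? d) Rj
        ix : (j ∸ i) * P + w + (d ∸ j * P) ≡ w + (d ∸ i * P)
        ix = trans (e₁ ((j ∸ i) * P) w (d ∸ j * P)) (cong (w +_) (+-cancelˡ-≡ (i * P) _ _ (begin
          i * P + ((j ∸ i) * P + (d ∸ j * P))  ≡⟨ e₂ i (j ∸ i) P (d ∸ j * P) ⟩
          (i + (j ∸ i)) * P + (d ∸ j * P)      ≡⟨ cong (λ z → z * P + (d ∸ j * P)) (m+[n∸m]≡n (<⇒≤ i<j)) ⟩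
          j * P + (d ∸ j * P)                  ≡⟨ m+[n∸m]≡n jP≤d ⟩
          d                                    ≡⟨ sym (m+[n∸m]≡n iP≤d) ⟩
          i * P + (d ∸ i * P)                  ∎)))
    in cong₂ _*_ (trans (cong (λ z → χ (not (Y z))) ix) (cong (λ z → χ (not z)) (disj w (d ∸ i * P) Xw Rd)))
         (avoids i j i<j w Xw ds pi′ pj′)
    where
    open ≡-Reasoning
    e₁ : ∀ a b c → a + b + c ≡ b + (a + c)
    e₁ = solve-∀
    e₂ : ∀ i j P d → i * P + (j * P + d) ≡ (i + j) * P + d
    e₂ = solve-∀

  -- By `avoids`, a point (j - i)P + w with w in `X` is counted by `M j` if it is big; otherwise it
  -- has fewer than r/Δ representations.
  collisions-≤ : ∀ i j → i < j → j < K → (ds : Vec ℕ h) → 0 < F i ds → 0 < F j ds →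
    Δ * collisions W N X R Y ((j ∸ i) * P) ≤ W * r + Δ * r * M j ds
  collisions-≤ i j i<j j<K ds pi pj = begin
    Δ * collisions W N X R Y p
      ≡⟨ sym (∑-*ˡ W Δ _) ⟩
    ∑ W (λ w → Δ * (χ (X w) * g (p + w)))
      ≤⟨ ∑-mono′ W pt ⟩
    ∑ W (λ w → r + Δ * r * (χ (big (p + w)) * avoid j (p + w) ds))
      ≡⟨ trans (∑-+ W _ _) (cong₂ _+_ (∑-const W r) (∑-*ˡ W (Δ * r) _)) ⟩
    W * r + Δ * r * ∑ W (λ w → χ (big (p + w)) * avoid j (p + w) ds)
      ≤⟨ +-monoʳ-≤ (W * r) (*-monoʳ-≤ (Δ * r) (∑-shift-≤ W p N (λ x → χ (big x) * avoid j x ds)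
           (iP≤N (j ∸ i) (≤-<-trans (m∸n≤m j i) j<K)))) ⟩
    W * r + Δ * r * M j ds ∎
    where
    open ≤-Reasoning
    p : ℕ
    p = (j ∸ i) * P
    pt : ∀ w → Δ * (χ (X w) * g (p + w)) ≤ r + Δ * r * (χ (big (p + w)) * avoid j (p + w) ds)
    pt w with bool-case (X w)
    ... | inj₂ Xw rewrite Xw = ≤-trans (≤-reflexive (*-zeroʳ Δ)) z≤n
    ... | inj₁ Xw with bool-case (big (p + w))
    ...   | inj₁ bg rewrite Xw | bg | avoids i j i<j w Xw ds pi pj =
      ≤-trans (≤-reflexive (cong (Δ *_) (+-identityʳ _))) (≤-trans (*-monoʳ-≤ Δ (near≤ N R Y (p + w)))
        (≤-trans (≤-reflexive (sym (*-identityʳ _))) (m≤n+m _ r)))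
    ...   | inj₂ bg rewrite Xw = ≤-trans (≤-reflexive (cong (Δ *_) (+-identityʳ _)))
        (≤-trans (<⇒≤ (≰⇒> (does-false (r ≤? Δ * g (p + w)) bg))) (m≤m+n r _))

  ∑-support : ∀ n (w : ℕ → ℕ) → N ≤ n → ∑ n (λ c → χ (R c) * w c) ≡ ∑ N (λ c → χ (R c) * w c)
  ∑-support n w N≤n = begin
    ∑ n f                                ≡⟨ cong (λ k → ∑ k f) (sym (m+[n∸m]≡n N≤n)) ⟩
    ∑ (N + (n ∸ N)) f                    ≡⟨ ∑-split N (n ∸ N) f ⟩
    ∑ N f + ∑ (n ∸ N) (λ x → f (N + x))  ≡⟨ cong (∑ N f +_) (trans (∑-cong′ (n ∸ N) (λ x → vanish x)) (∑-zero (n ∸ N))) ⟩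
    ∑ N f + 0                            ≡⟨ +-identityʳ _ ⟩
    ∑ N f                                ∎
    where
    open ≡-Reasoning
    f : ℕ → ℕ
    f c = χ (R c) * w c
    vanish : ∀ x → f (N + x) ≡ 0
    vanish x with bool-case (R (N + x))
    ... | inj₁ Rc = ⊥-elim (<⇒≱ (R-supp (N + x) Rc) (m≤m+n N x))
    ... | inj₂ Rc = cong (λ z → χ z * w (N + x)) Rc

  ∑-Rⱼ : ∀ j → j < K → (w : ℕ → ℕ) →
    ∑ U (λ d → χ (Rⱼ j d) * w (d ∸ j * P)) ≡ ∑ N (λ c → χ (R c) * w c)
  ∑-Rⱼ j j<K w = begin
    ∑ U f                                      ≡⟨ cong (λ k → ∑ k f) (sym (m+[n∸m]≡n jP≤U)) ⟩
    ∑ (s + (U ∸ s)) f                          ≡⟨ ∑-split s (U ∸ s) f ⟩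
    ∑ s f + ∑ (U ∸ s) (λ c → f (s + c))        ≡⟨ cong₂ _+_ (trans (∑-cong s low) (∑-zero s)) (∑-cong′ (U ∸ s) high) ⟩
    ∑ (U ∸ s) (λ c → χ (R c) * w c)            ≡⟨ ∑-support (U ∸ s) w N≤ ⟩
    ∑ N (λ c → χ (R c) * w c)                  ∎
    where
    open ≡-Reasoning
    s : ℕ
    s = j * P
    jP≤U : s ≤ U
    jP≤U = ≤-trans (iP≤N j j<K) (m≤m+n N N)
    N≤ : N ≤ U ∸ s
    N≤ = ≤-trans (≤-reflexive (sym (m+n∸n≡m N N))) (∸-monoʳ-≤ U (iP≤N j j<K))
    f : ℕ → ℕ
    f d = χ (Rⱼ j d) * w (d ∸ s)
    low : ∀ d → d < s → f d ≡ 0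
    low d d<s rewrite dec-false (s ≤? d) (<⇒≱ d<s) = refl
    high : ∀ c → f (s + c) ≡ χ (R c) * w c
    high c rewrite dec-true (s ≤? s + c) (m≤m+n s c) | m+n∸m≡n s c = refl

  ∑F : ∀ j → j < K → ∑ᵛ h U (F j) ≡ r ^ h
  ∑F j j<K = trans (∑ᵛ-∏ h U _) (cong (_^ h) (trans
    (∑-cong′ U (λ d → sym (*-identityʳ _))) (trans (∑-Rⱼ j j<K (λ _ → 1)) (∑-cong′ N (λ c → *-identityʳ _)))))

  miss : ℕ → ℕ
  miss x = ∑ N (λ c → χ (R c) * χ (not (Y (x + c))))

  ∑FM : ∀ j → j < K → ∑ᵛ h U (λ ds → F j ds * M j ds) ≡ ∑ (W + N) (λ x → χ (big x) * miss x ^ h)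
  ∑FM j j<K = begin
    ∑ᵛ h U (λ ds → F j ds * M j ds)
      ≡⟨ ∑ᵛ-cong h U (λ ds → trans (sym (∑-*ˡ (W + N) (F j ds) _)) (∑-cong′ (W + N) (λ x →
           trans (e (F j ds) (χ (big x)) _) (cong (χ (big x) *_) (sym (∏ᵛ-* _ _ ds)))))) ⟩
    ∑ᵛ h U (λ ds → ∑ (W + N) (λ x → χ (big x) * ∏ᵛ (w x) ds))
      ≡⟨ ∑ᵛ-swap h U (W + N) _ ⟩
    ∑ (W + N) (λ x → ∑ᵛ h U (λ ds → χ (big x) * ∏ᵛ (w x) ds))
      ≡⟨ ∑-cong′ (W + N) (λ x → trans (∑ᵛ-*ˡ h U (χ (big x)) _) (cong (χ (big x) *_)
           (trans (∑ᵛ-∏ h U (w x)) (cong (_^ h) (∑-Rⱼ j j<K (λ c → χ (not (Y (x + c))))))))) ⟩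
    ∑ (W + N) (λ x → χ (big x) * miss x ^ h) ∎
    where
    open ≡-Reasoning
    w : ℕ → ℕ → ℕ
    w x d = χ (Rⱼ j d) * χ (not (Y (x + (d ∸ j * P))))
    e : ∀ a b c → a * (b * c) ≡ b * (a * c)
    e = solve-∀

  -- From a big x, a random element of `R` avoids Y - x with probability at most δ/Δ, hence a random
  -- tuple with probability at most (δ/Δ)^h ≤ 1/(4Δ) by the choice of `h`.
  miss-sum : 2 * ∑ (W + N) (λ x → χ (big x) * miss x ^ h) ≤ B₀ * r ^ h
  miss-sum = *-cancelˡ-≤ (Δ ^ h) {{m^n≢0 Δ h}} (begin
    Δ ^ h * (2 * ∑ (W + N) (λ x → χ (big x) * miss x ^ h))
      ≡⟨ e₁ (Δ ^ h) _ ⟩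
    2 * (Δ ^ h * ∑ (W + N) (λ x → χ (big x) * miss x ^ h))
      ≡⟨ cong (2 *_) (sym (∑-*ˡ (W + N) (Δ ^ h) _)) ⟩
    2 * ∑ (W + N) (λ x → Δ ^ h * (χ (big x) * miss x ^ h))
      ≤⟨ *-monoʳ-≤ 2 (∑-bound (W + N) ((δ * r) ^ h) (λ x _ → pt x)) ⟩
    2 * ((W + N) * (δ * r) ^ h)
      ≤⟨ *-monoʳ-≤ 2 (*-monoˡ-≤ _ W-small) ⟩
    2 * (2 * (Δ * B₀) * (δ * r) ^ h)
      ≡⟨ cong (λ z → 2 * (2 * (Δ * B₀) * z)) (pow-* δ r h) ⟩
    2 * (2 * (Δ * B₀) * (δ ^ h * r ^ h))
      ≡⟨ e₂ Δ B₀ (δ ^ h) (r ^ h) ⟩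
    4 * Δ * δ ^ h * (B₀ * r ^ h)
      ≤⟨ *-monoˡ-≤ (B₀ * r ^ h) h-large ⟩
    Δ ^ h * (B₀ * r ^ h) ∎)
    where
    open ≤-Reasoning
    e₁ : ∀ a b → a * (2 * b) ≡ 2 * (a * b)
    e₁ = solve-∀
    e₂ : ∀ D B a b → 2 * (2 * (D * B) * (a * b)) ≡ 4 * D * a * (B * b)
    e₂ = solve-∀
    g+miss : ∀ x → g x + miss x ≡ r
    g+miss x = trans (sym (∑-+ N _ _)) (∑-cong′ N (λ c → trans (sym (*-distribˡ-+ (χ (R c)) _ _))
      (trans (cong (χ (R c) *_) (χ-not (Y (x + c)))) (*-identityʳ _))))
    pt : ∀ x → Δ ^ h * (χ (big x) * miss x ^ h) ≤ (δ * r) ^ h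
    pt x with bool-case (big x)
    ... | inj₂ bg rewrite bg = ≤-trans (≤-reflexive (*-zeroʳ (Δ ^ h))) z≤n
    ... | inj₁ bg = begin
      Δ ^ h * (χ (big x) * miss x ^ h) ≡⟨ cong (λ z → Δ ^ h * (χ z * miss x ^ h)) bg ⟩
      Δ ^ h * (1 * miss x ^ h)         ≡⟨ cong (Δ ^ h *_) (*-identityˡ _) ⟩
      Δ ^ h * miss x ^ h               ≡⟨ sym (pow-* Δ (miss x) h) ⟩
      (Δ * miss x) ^ h                 ≤⟨ ^-monoˡ-≤ h le ⟩
      (δ * r) ^ h                      ∎
      where
      le : Δ * miss x ≤ δ * r
      le = +-cancelˡ-≤ r _ _ (≤-trans (+-monoˡ-≤ _ (does-true (r ≤? Δ * g x) bg))
        (≤-reflexive (trans (sym (*-distribˡ-+ Δ (g x) (miss x))) (cong (Δ *_) (g+miss x)))))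

  r>0 : 0 < r
  r>0 = n≢0⇒n>0 λ eq → <⇒≱ N>0 (≤-trans R-dense (≤-reflexive (trans (cong (κ *_) eq) (*-zeroʳ κ))))

  Result : ℕ → Set
  Result i = Δ * collisions W N X R Y (suc i * P) ≤ W * r + Δ * r * B₀

  -- If no multiple of `P` works, `collisions-≤` gives `B₀ < M j` at every translate containing a
  -- given tuple except the first. By `miss-sum` this accounts for at most half of the `K * r ^ h`
  -- incidences, so `K * r ^ h ≤ 2 * U ^ h`, against the choice of `K`.
  no-result : (∀ i → i < 2 * (2 * κ) ^ h → ¬ Result i) → ⊥
  no-result none = <⇒≱ (n<1+n _) (*-cancelʳ-≤ K _ (r ^ h) {{m^n≢0 r h {{>-nonZero r>0}}}} K-small)
    where
    open ≤-Reasoning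
    M-large : ∀ (ds : Vec ℕ h) i j → i < j → j < K → 0 < F i ds → 0 < F j ds → B₀ < M j ds
    M-large ds i j i<j j<K pi pj = *-cancelˡ-< (Δ * r) _ _ (+-cancelˡ-< (W * r) _ _
      (<-≤-trans (≰⇒> (none (pred (j ∸ i)) lt)) (subst (λ z → Δ * collisions W N X R Y (z * P) ≤ W * r + Δ * r * M j ds) (sym j∸i)
        (collisions-≤ i j i<j j<K ds pi pj))))
      where
      j∸i : suc (pred (j ∸ i)) ≡ j ∸ i
      j∸i = suc-pred (j ∸ i) {{>-nonZero (m<n⇒0<n∸m i<j)}}
      lt : pred (j ∸ i) < 2 * (2 * κ) ^ h
      lt = ≤-trans (≤-reflexive j∸i) (≤-trans (m∸n≤m j i) (s≤s⁻¹ j<K))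
    total : suc B₀ * (K * r ^ h) ≤ suc B₀ * U ^ h + K * ∑ (W + N) (λ x → χ (big x) * miss x ^ h)
    total = begin
      suc B₀ * (K * r ^ h)
        ≡⟨ cong (suc B₀ *_) (trans (sym (∑-const K _)) (∑-cong K (λ j j<K → sym (∑F j j<K)))) ⟩
      suc B₀ * ∑ K (λ j → ∑ᵛ h U (F j))
        ≡⟨ trans (cong (suc B₀ *_) (sym (∑ᵛ-swap h U K (λ ds j → F j ds)))) (sym (∑ᵛ-*ˡ h U (suc B₀) _)) ⟩
      ∑ᵛ h U (λ ds → suc B₀ * ∑ K (λ j → F j ds))
        ≤⟨ ∑ᵛ-mono h U (λ ds → sparse-sum K B₀ (λ j → F j ds) (λ j → M j ds)
             (λ j → ∏ᵛ-≤1 _ (λ d → χ≤1 (Rⱼ j d)) ds) (M-large ds)) ⟩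
      ∑ᵛ h U (λ ds → suc B₀ + ∑ K (λ j → F j ds * M j ds))
        ≡⟨ trans (∑ᵛ-+ h U _ _) (cong₂ _+_ (trans (∑ᵛ-const h U (suc B₀)) (*-comm (U ^ h) _))
             (∑ᵛ-swap h U K (λ ds j → F j ds * M j ds))) ⟩
      suc B₀ * U ^ h + ∑ K (λ j → ∑ᵛ h U (λ ds → F j ds * M j ds))
        ≡⟨ cong (suc B₀ * U ^ h +_) (trans (∑-cong K (λ j j<K → ∑FM j j<K)) (∑-const K _)) ⟩
      suc B₀ * U ^ h + K * ∑ (W + N) (λ x → χ (big x) * miss x ^ h) ∎
    U≤ : U ≤ 2 * κ * r
    U≤ = ≤-trans (≤-reflexive (cong (N +_) (sym (+-identityʳ N)))) (≤-trans (*-monoʳ-≤ 2 R-dense)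
      (≤-reflexive (sym (*-assoc 2 κ r))))
    K-small : K * r ^ h ≤ 2 * (2 * κ) ^ h * r ^ h
    K-small = *-cancelˡ-≤ (suc B₀) (begin
      suc B₀ * (K * r ^ h)
        ≤⟨ ≤-by (2 * (suc B₀ * (K * r ^ h)) + K * (2 * S))
             (2 * (suc B₀ * U ^ h + K * S) + K * (suc B₀ * r ^ h))
             (+-mono-≤ (*-monoʳ-≤ 2 total) (*-monoʳ-≤ K (≤-trans miss-sum (*-monoˡ-≤ (r ^ h) (n≤1+n B₀)))))
             (e₁ (suc B₀) K (r ^ h) (U ^ h) S) ⟩
      2 * (suc B₀ * U ^ h)
        ≤⟨ *-monoʳ-≤ 2 (*-monoʳ-≤ (suc B₀) (≤-trans (^-monoˡ-≤ h U≤) (≤-reflexive (pow-* (2 * κ) r h)))) ⟩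
      2 * (suc B₀ * ((2 * κ) ^ h * r ^ h))
        ≡⟨ e₂ (suc B₀) ((2 * κ) ^ h) (r ^ h) ⟩
      suc B₀ * (2 * (2 * κ) ^ h * r ^ h) ∎)
      where
      S : ℕ
      S = ∑ (W + N) (λ x → χ (big x) * miss x ^ h)
      e₁ : ∀ b K r u S → b * (K * r) + (2 * (b * u + K * S) + K * (b * r)) ≡ 2 * (b * u) + (2 * (b * (K * r)) + K * (2 * S))
      e₁ = solve-∀
      e₂ : ∀ b c r → 2 * (b * (c * r)) ≡ b * (2 * c * r)
      e₂ = solve-∀

  almost-period : Σ ℕ λ i → i < 2 * (2 * κ) ^ h × Result i
  almost-period with search (λ i → Δ * collisions W N X R Y (suc i * P) ≤? W * r + Δ * r * B₀) (2 * (2 * κ) ^ h)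
  ... | inj₁ res  = res
  ... | inj₂ none = ⊥-elim (no-result none)

-- From ℤ/p to windows of integers.

-- In some windows the hypotheses of `cyclic-bound` fail. Each failure makes its error term at least
-- `2 * E * (t₀ * p)`, which already covers the trivial bound 3p for the three sizes. Being linear
-- in the counts, the estimate can be summed over windows.
cyclic-bound-linear : ∀ E m t₀ p (A B Z : ℕ → Bool) → 0 < E → 0 < m → 0 < t₀ →
  p ≡ 2 * E * m * (4 * m * E) * t₀ → Periodic p A → Periodic p B → Periodic p Z → t₀ ≤ ♯ p B →
  t₀ * (E * (♯ p A + ♯ p B + ♯ p Z)) ≤ t₀ * ((E + 2) * p)
    + 4 * E * E * t₀ * (∑ (2 * E) (λ i → bad p m (suc i) A) + bad p m 1 Z)
    + 2 * E * E * triples p A B Z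
cyclic-bound-linear E m t₀ p A B Z E>0 m>0 t₀>0 p≡ perA perB perZ t₀≤ =
  decide (search (λ i → p <? 2 * E * bad p m (suc i) A) (2 * E))
    (p <? 2 * bad p m 1 Z) (t₀ * p <? E * T)
  where
  open ≤-Reasoning
  T b S : ℕ
  T = triples p A B Z
  S = ♯ p A + ♯ p B + ♯ p Z
  b = ∑ (2 * E) (λ i → bad p m (suc i) A) + bad p m 1 Z
  Goal : Set
  Goal = t₀ * (E * S) ≤ t₀ * ((E + 2) * p) + 4 * E * E * t₀ * b + 2 * E * E * T
  trivial : t₀ * (E * S) ≤ t₀ * ((E + 2) * p) + 2 * E * (t₀ * p)
  trivial = begin
    t₀ * (E * S)                                ≤⟨ *-monoʳ-≤ t₀ (*-monoʳ-≤ E (+-mono-≤ (+-mono-≤ (♯≤ p A) (♯≤ p B)) (♯≤ p Z))) ⟩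
    t₀ * (E * (p + p + p))                      ≤⟨ m≤m+n _ (2 * t₀ * p) ⟩
    t₀ * (E * (p + p + p)) + 2 * t₀ * p         ≡⟨ eq t₀ E p ⟩
    t₀ * ((E + 2) * p) + 2 * E * (t₀ * p)       ∎
    where
    eq : ∀ t E p → t * (E * (p + p + p)) + 2 * t * p ≡ t * ((E + 2) * p) + 2 * E * (t * p)
    eq = solve-∀
  if-bad : p ≤ 2 * E * b → Goal
  if-bad le = ≤-trans trivial (≤-trans (+-monoʳ-≤ _ (begin
    2 * E * (t₀ * p)              ≤⟨ *-monoʳ-≤ (2 * E) (*-monoʳ-≤ t₀ le) ⟩
    2 * E * (t₀ * (2 * E * b))    ≡⟨ eq E t₀ b ⟩
    4 * E * E * t₀ * b            ∎)) (m≤m+n _ (2 * E * E * T)))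
    where
    eq : ∀ E t b → 2 * E * (t * (2 * E * b)) ≡ 4 * E * E * t * b
    eq = solve-∀
  decide : (Σ ℕ λ i → i < 2 * E × p < 2 * E * bad p m (suc i) A)
             ⊎ (∀ i → i < 2 * E → ¬ p < 2 * E * bad p m (suc i) A) →
           Dec (p < 2 * bad p m 1 Z) → Dec (t₀ * p < E * T) → Goal
  decide (inj₁ (i , i< , lt)) _ _ = if-bad (≤-trans (<⇒≤ lt) (*-monoʳ-≤ (2 * E)
    (≤-trans (∑-term (2 * E) (λ i → bad p m (suc i) A) i i<) (m≤m+n _ _))))
  decide (inj₂ _) (yes lt) _ = if-bad (≤-trans (<⇒≤ lt) (*-mono-≤ (m≤m*n 2 E {{>-nonZero E>0}})
    (m≤n+m (bad p m 1 Z) _)))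
  decide (inj₂ _) (no _) (yes lt) = ≤-trans trivial (begin
    t₀ * ((E + 2) * p) + 2 * E * (t₀ * p)                         ≤⟨ +-mono-≤ (m≤m+n _ (4 * E * E * t₀ * b)) (*-monoʳ-≤ (2 * E) (<⇒≤ lt)) ⟩
    t₀ * ((E + 2) * p) + 4 * E * E * t₀ * b + 2 * E * (E * T)     ≡⟨ cong (t₀ * ((E + 2) * p) + 4 * E * E * t₀ * b +_) (sym (*-assoc (2 * E) E T)) ⟩
    t₀ * ((E + 2) * p) + 4 * E * E * t₀ * b + 2 * E * E * T       ∎)
  decide (inj₂ ok) (no okZ) (no okT) = ≤-trans
    (*-monoʳ-≤ t₀ (cyclic-bound E m t₀ p Z E>0 m>0 t₀>0 p≡ perZ (≮⇒≥ okZ) A B perA perB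
      (λ { (suc i) _ q≤ → ≮⇒≥ (ok i q≤) }) t₀≤ (≮⇒≥ okT)))
    (≤-trans (m≤m+n _ (4 * E * E * t₀ * b)) (m≤m+n _ (2 * E * E * T)))

-- Folding the windows [u, u + p), [s, s + p) and [u + s + p, u + s + 2p) into ℤ/p.

module Fold (p : ℕ) {{_ : NonZero p}} where

  fold : ℕ → (ℕ → Bool) → ℕ → Bool
  fold u A x = A (u + x % p)

  fold-per : ∀ u A → Periodic p (fold u A)
  fold-per u A x = cong (λ z → A (u + z)) (trans (cong (_% p) (+-comm p x)) ([m+n]%n≡m%n x p))

  fold-< : ∀ u A {x} → x < p → fold u A x ≡ A (u + x)
  fold-< u A x<p = cong (λ z → A (u + z)) (m<n⇒m%n≡m x<p)

  ♯-fold : ∀ u A → ♯ p (fold u A) ≡ ∑ p (λ x → χ (A (u + x)))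
  ♯-fold u A = ∑-cong p (λ x x<p → cong χ (fold-< u A x<p))

  -- Only the last `m * q` starting points see the seam of the folded window.
  bad-fold : ∀ u A m q → bad p m q (fold u A) ≤ ∑ p (λ x → χ₀ (hits m q A (u + x))) + m * q
  bad-fold u A m q with m * q ≤? p
  ... | no gt = ≤-trans (∑-bound p 1 (λ x _ → χ₀≤1 _)) (≤-trans (≤-reflexive (*-identityʳ p))
          (≤-trans (<⇒≤ (≰⇒> gt)) (m≤n+m _ _)))
  ... | yes le = begin
    ∑ p f                                      ≡⟨ cong (λ z → ∑ z f) (sym p′+) ⟩
    ∑ (p′ + m * q) f                           ≡⟨ ∑-split p′ (m * q) f ⟩
    ∑ p′ f + ∑ (m * q) (λ x → f (p′ + x))      ≤⟨ +-mono-≤ (≤-reflexive (∑-cong p′ inner))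
                                                   (≤-trans (∑-bound (m * q) 1 (λ x _ → χ₀≤1 _)) (≤-reflexive (*-identityʳ (m * q)))) ⟩
    ∑ p′ g + m * q                             ≤⟨ +-monoˡ-≤ (m * q) (∑-mono-range g (m∸n≤m p (m * q))) ⟩
    ∑ p g + m * q                              ∎
    where
    open ≤-Reasoning
    p′ : ℕ
    p′ = p ∸ m * q
    p′+ : p′ + m * q ≡ p
    p′+ = m∸n+n≡m le
    f g : ℕ → ℕ
    f x = χ₀ (hits m q (fold u A) x)
    g x = χ₀ (hits m q A (u + x))
    inner : ∀ x → x < p′ → f x ≡ g x
    inner x x<p′ = cong χ₀ (∑-cong m (λ j j<m → cong χ (trans
      (fold-< u A (<-≤-trans (+-mono-<-≤ x<p′ (*-monoˡ-≤ q (<⇒≤ j<m))) (≤-reflexive p′+)))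
      (cong A (sym (+-assoc u x (j * q)))))))

  layer : (R Y : ℕ → Bool) → ℕ → ℕ → ℕ
  layer R Y s w = ∑ p (λ c → χ (R (s + c)) * χ (Y (p + w + (s + c))))

  -- A sum that wraps around would be a genuine element of X + R in Y.
  triples-fold : ∀ (X R Y : ℕ → Bool) → (∀ x c → X x ≡ true → R c ≡ true → Y (x + c) ≡ false) →
    ∀ u s → triples p (fold u X) (fold s R) (fold (u + (s + p)) Y)
      ≤ ∑ p (λ x → χ (X (u + x)) * layer R Y s (u + x))
  triples-fold X R Y disj u s = begin
    triples p (fold u X) (fold s R) (fold (u + (s + p)) Y)
      ≤⟨ ∑-mono p (λ c c<p → ∑-mono p (λ x x<p → pt c x c<p x<p)) ⟩
    ∑ p (λ c → ∑ p (λ x → χ (X (u + x)) * (χ (R (s + c)) * χ (Y (p + (u + x) + (s + c))))))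
      ≡⟨ ∑-swap p p _ ⟩
    ∑ p (λ x → ∑ p (λ c → χ (X (u + x)) * (χ (R (s + c)) * χ (Y (p + (u + x) + (s + c))))))
      ≡⟨ ∑-cong′ p (λ x → ∑-*ˡ p (χ (X (u + x))) _) ⟩
    ∑ p (λ x → χ (X (u + x)) * layer R Y s (u + x)) ∎
    where
    open ≤-Reasoning
    pt : ∀ c x → c < p → x < p → χ (fold s R c) * (χ (fold u X x) * χ (fold (u + (s + p)) Y (c + x)))
      ≤ χ (X (u + x)) * (χ (R (s + c)) * χ (Y (p + (u + x) + (s + c))))
    pt c x c<p x<p rewrite fold-< s R c<p | fold-< u X x<p with c + x <? p
    ... | yes lt = ≤-reflexive (trans
      (cong (λ z → χ (R (s + c)) * (χ (X (u + x)) * χ z)) (trans (fold-< (u + (s + p)) Y lt) (cong Y (ix u s p c x))))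
      (eq (χ (R (s + c))) (χ (X (u + x))) _))
      where
      ix : ∀ u s p c x → u + (s + p) + (c + x) ≡ p + (u + x) + (s + c)
      ix = solve-∀
      eq : ∀ a b c → a * (b * c) ≡ b * (a * c)
      eq = solve-∀
    ... | no ge with bool-case (X (u + x)) | bool-case (R (s + c))
    ...   | inj₂ Xf | _ rewrite Xf = ≤-reflexive (*-zeroʳ (χ (R (s + c))))
    ...   | inj₁ _  | inj₂ Rf rewrite Rf = z≤n
    ...   | inj₁ Xt | inj₁ Rt = ≤-trans (≤-reflexive (trans
            (cong (λ z → χ (R (s + c)) * (χ (X (u + x)) * χ z)) Yf)
            (trans (cong (χ (R (s + c)) *_) (*-zeroʳ (χ (X (u + x))))) (*-zeroʳ (χ (R (s + c))))))) z≤n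
      where
      d : ℕ
      d = c + x ∸ p
      p+d : p + d ≡ c + x
      p+d = m+[n∸m]≡n (≮⇒≥ ge)
      d<p : d < p
      d<p = +-cancelˡ-< p d p (subst (_< p + p) (sym p+d) (+-mono-< c<p x<p))
      Yf : fold (u + (s + p)) Y (c + x) ≡ false
      Yf = trans (cong (fold (u + (s + p)) Y) (sym p+d)) (trans (fold-per (u + (s + p)) Y d)
        (trans (fold-< (u + (s + p)) Y d<p) (trans (cong Y (trans (ix₁ u s p d)
          (trans (cong (λ z → u + s + z) p+d) (ix₂ u s c x)))) (disj (u + x) (s + c) Xt Rt))))
        where
        ix₁ : ∀ u s p d → u + (s + p) + d ≡ u + s + (p + d)
        ix₁ = solve-∀
        ix₂ : ∀ u s c x → u + s + (c + x) ≡ u + x + (s + c)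
        ix₂ = solve-∀

  ∑∑-≤ : ∀ G y (f : ℕ → ℕ) → p ≤ y → ∑ G (λ u → ∑ p (λ x → f (u + x))) ≤ p * ∑ (G + y) f
  ∑∑-≤ G y f p≤y = ≤-trans (≤-reflexive (∑-swap G p _)) (∑-bound p (∑ (G + y) f) (λ x x<p →
    ≤-trans (≤-reflexive (∑-cong′ G (λ u → cong f (+-comm u x)))) (∑-shift-≤ G x y f (≤-trans (<⇒≤ x<p) p≤y))))

  ∑∑-≥ : ∀ G y (f : ℕ → ℕ) → (∀ w → f w ≤ 1) →
    p * ∑ G f ≤ ∑ G (λ u → ∑ p (λ x → f (u + y + x))) + p * (y + p)
  ∑∑-≥ G y f f≤1 = begin
    p * ∑ G f                                                    ≡⟨ sym (∑-const p _) ⟩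
    ∑ p (λ _ → ∑ G f)                                            ≤⟨ ∑-mono p (λ x x<p → ≤-trans (∑-shift-≥ G (y + x) f f≤1)
                                                                     (+-mono-≤ (≤-reflexive (∑-cong′ G (λ u → cong f (ix y x u)))) (+-monoʳ-≤ y (<⇒≤ x<p)))) ⟩
    ∑ p (λ x → ∑ G (λ u → f (u + y + x)) + (y + p))              ≡⟨ trans (∑-+ p _ _) (cong₂ _+_ (∑-swap p G _) (∑-const p _)) ⟩
    ∑ G (λ u → ∑ p (λ x → f (u + y + x))) + p * (y + p)          ∎
    where
    open ≤-Reasoning
    ix : ∀ y x u → y + x + u ≡ u + y + x
    ix = solve-∀

wrap : ℕ → ℕ → ℕ
wrap E m = ∑ (2 * E) (λ i → m * suc i) + m * 1

badTotal : ℕ → ℕ → ℕ → (X Y : ℕ → Bool) → ℕ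
badTotal E m W X Y = ∑ (2 * E) (λ i → bad W m (suc i) X) + bad W m 1 Y

-- The window of `R` stays at `s` while those of `X` and `Y` slide with u. Over all u < G each
-- integer is covered p times, apart from ends whose length `D` bounds.
module Windows (E m t₀ p : ℕ) {{_ : NonZero p}} (E>0 : 0 < E) (m>0 : 0 < m) (t₀>0 : 0 < t₀)
  (p≡ : p ≡ 2 * E * m * (4 * m * E) * t₀) (X R Y : ℕ → Bool)
  (disj : ∀ x c → X x ≡ true → R c ≡ true → Y (x + c) ≡ false)
  (s G D : ℕ) (p≤D : p ≤ D) (s+2p≤D : s + p + p ≤ D)
  (t₀≤ : t₀ ≤ ∑ p (λ c → χ (R (s + c)))) where

  open Fold p

  ρ : ℕ
  ρ = ∑ p (λ c → χ (R (s + c)))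

  x̂ ŷ b̂ T̂ : ℕ → ℕ
  x̂ u = ∑ p (λ x → χ (X (u + x)))
  ŷ u = ∑ p (λ x → χ (Y (u + (s + p) + x)))
  b̂ u = ∑ (2 * E) (λ i → ∑ p (λ x → χ₀ (hits m (suc i) X (u + x)))) + ∑ p (λ x → χ₀ (hits m 1 Y (u + (s + p) + x)))
  T̂ u = ∑ p (λ x → χ (X (u + x)) * layer R Y s (u + x))

  total : ℕ
  total = ∑ (G + D) (λ w → χ (X w) * layer R Y s w)

  one-window : ∀ u → t₀ * (E * (x̂ u + ρ + ŷ u)) ≤ t₀ * ((E + 2) * p)
    + 4 * E * E * t₀ * (b̂ u + wrap E m) + 2 * E * E * T̂ u
  one-window u = begin
    t₀ * (E * (x̂ u + ρ + ŷ u))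
      ≡⟨ cong (λ z → t₀ * (E * z)) (sym (cong₂ _+_ (cong₂ _+_ (♯-fold u X) (♯-fold s R)) (♯-fold (u + (s + p)) Y))) ⟩
    t₀ * (E * (♯ p A + ♯ p B + ♯ p Z))
      ≤⟨ cyclic-bound-linear E m t₀ p A B Z E>0 m>0 t₀>0 p≡ (fold-per u X) (fold-per s R) (fold-per (u + (s + p)) Y)
           (≤-trans t₀≤ (≤-reflexive (sym (♯-fold s R)))) ⟩
    t₀ * ((E + 2) * p) + 4 * E * E * t₀ * (∑ (2 * E) (λ i → bad p m (suc i) A) + bad p m 1 Z) + 2 * E * E * triples p A B Z
      ≤⟨ +-mono-≤ (+-monoʳ-≤ _ (*-monoʳ-≤ (4 * E * E * t₀) bads)) (*-monoʳ-≤ (2 * E * E) (triples-fold X R Y disj u s)) ⟩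
    t₀ * ((E + 2) * p) + 4 * E * E * t₀ * (b̂ u + wrap E m) + 2 * E * E * T̂ u ∎
    where
    open ≤-Reasoning
    A B Z : ℕ → Bool
    A = fold u X
    B = fold s R
    Z = fold (u + (s + p)) Y
    bads : ∑ (2 * E) (λ i → bad p m (suc i) A) + bad p m 1 Z ≤ b̂ u + wrap E m
    bads = ≤-trans (+-mono-≤ (≤-trans (∑-mono′ (2 * E) (λ i → bad-fold u X m (suc i))) (≤-reflexive (∑-+ (2 * E) f (λ i → m * suc i))))
        (bad-fold (u + (s + p)) Y m 1))
      (≤-reflexive (eq (∑ (2 * E) f) (∑ (2 * E) (λ i → m * suc i)) (∑ p (λ x → χ₀ (hits m 1 Y (u + (s + p) + x)))) (m * 1)))
      where
      f : ℕ → ℕ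
      f i = ∑ p (λ x → χ₀ (hits m (suc i) X (u + x)))
      eq : ∀ a b c d → a + b + (c + d) ≡ a + c + (b + d)
      eq = solve-∀

  ∑x̂ : p * ♯ G X ≤ ∑ G x̂ + p * p
  ∑x̂ = ≤-trans (∑∑-≥ G 0 (λ x → χ (X x)) (λ w → χ≤1 (X w)))
    (≤-reflexive (cong (_+ p * p) (∑-cong′ G (λ u → ∑-cong′ p (λ x → cong (λ z → χ (X (z + x))) (+-identityʳ u))))))

  ∑ŷ : p * ♯ G Y ≤ ∑ G ŷ + p * (s + p + p)
  ∑ŷ = ∑∑-≥ G (s + p) (λ x → χ (Y x)) (λ w → χ≤1 (Y w))

  ∑b̂ : ∑ G b̂ ≤ p * badTotal E m (G + D) X Y
  ∑b̂ = begin
    ∑ G b̂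
      ≡⟨ trans (∑-+ G _ _) (cong (_+ ∑ G (λ u → ∑ p (λ x → χ₀ (hits m 1 Y (u + (s + p) + x))))) (∑-swap G (2 * E) _)) ⟩
    ∑ (2 * E) (λ i → ∑ G (λ u → ∑ p (λ x → χ₀ (hits m (suc i) X (u + x)))))
      + ∑ G (λ u → ∑ p (λ x → χ₀ (hits m 1 Y (u + (s + p) + x))))
      ≤⟨ +-mono-≤ (∑-mono′ (2 * E) (λ i → ∑∑-≤ G D (λ w → χ₀ (hits m (suc i) X w)) p≤D)) Ypart ⟩
    ∑ (2 * E) (λ i → p * bad (G + D) m (suc i) X) + p * bad (G + D) m 1 Y
      ≡⟨ trans (cong (_+ p * bad (G + D) m 1 Y) (∑-*ˡ (2 * E) p _)) (sym (*-distribˡ-+ p _ _)) ⟩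
    p * badTotal E m (G + D) X Y ∎
    where
    open ≤-Reasoning
    f : ℕ → ℕ
    f w = χ₀ (hits m 1 Y w)
    Ypart : ∑ G (λ u → ∑ p (λ x → f (u + (s + p) + x))) ≤ p * ∑ (G + D) f
    Ypart = begin
      ∑ G (λ u → ∑ p (λ x → f (u + (s + p) + x)))  ≡⟨ ∑-cong′ G (λ u → ∑-cong′ p (λ x → cong f (ix u (s + p) x))) ⟩
      ∑ G (λ u → ∑ p (λ x → f (s + p + (u + x))))  ≤⟨ ∑∑-≤ G p (λ w → f (s + p + w)) ≤-refl ⟩
      p * ∑ (G + p) (λ w → f (s + p + w))          ≤⟨ *-monoʳ-≤ p (∑-shift-≤ (G + p) (s + p) (s + p) f ≤-refl) ⟩
      p * ∑ (G + p + (s + p)) f                    ≤⟨ *-monoʳ-≤ p (∑-mono-range f (≤-trans (≤-reflexive (ix₂ G p s)) (+-monoʳ-≤ G s+2p≤D))) ⟩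
      p * ∑ (G + D) f                              ∎
      where
      ix : ∀ u a x → u + a + x ≡ a + (u + x)
      ix = solve-∀
      ix₂ : ∀ G p s → G + p + (s + p) ≡ G + (s + p + p)
      ix₂ = solve-∀

  all-windows : t₀ * (E * (p * ♯ G X + G * ρ + p * ♯ G Y)) ≤ t₀ * ((E + 2) * p) * G
    + 4 * E * E * t₀ * (p * badTotal E m (G + D) X Y + G * wrap E m) + 2 * E * E * (p * total)
    + t₀ * (E * (p * p + p * (s + p + p)))
  all-windows = begin
    t₀ * (E * (p * ♯ G X + G * ρ + p * ♯ G Y))
      ≤⟨ *-monoʳ-≤ t₀ (*-monoʳ-≤ E (+-mono-≤ (+-monoˡ-≤ (G * ρ) ∑x̂) ∑ŷ)) ⟩
    t₀ * (E * (∑ G x̂ + p * p + G * ρ + (∑ G ŷ + p * (s + p + p))))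
      ≡⟨ e₁ t₀ E (∑ G x̂) (p * p) (G * ρ) (∑ G ŷ) (p * (s + p + p)) ⟩
    t₀ * (E * (∑ G x̂ + G * ρ + ∑ G ŷ)) + t₀ * (E * (p * p + p * (s + p + p)))
      ≤⟨ +-monoˡ-≤ _ main ⟩
    t₀ * ((E + 2) * p) * G + 4 * E * E * t₀ * (p * badTotal E m (G + D) X Y + G * wrap E m) + 2 * E * E * (p * total)
      + t₀ * (E * (p * p + p * (s + p + p))) ∎
    where
    open ≤-Reasoning
    e₁ : ∀ t E a b c d e → t * (E * (a + b + c + (d + e))) ≡ t * (E * (a + c + d)) + t * (E * (b + e))
    e₁ = solve-∀
    lhs : ∑ G (λ u → t₀ * (E * (x̂ u + ρ + ŷ u))) ≡ t₀ * (E * (∑ G x̂ + G * ρ + ∑ G ŷ))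
    lhs = trans (∑-*ˡ G t₀ _) (cong (t₀ *_) (trans (∑-*ˡ G E _) (cong (E *_)
      (trans (∑-+ G _ _) (cong (_+ ∑ G ŷ) (trans (∑-+ G _ _) (cong (∑ G x̂ +_) (∑-const G ρ))))))))
    rhs : ∑ G (λ u → t₀ * ((E + 2) * p) + 4 * E * E * t₀ * (b̂ u + wrap E m) + 2 * E * E * T̂ u)
      ≡ t₀ * ((E + 2) * p) * G + 4 * E * E * t₀ * (∑ G b̂ + G * wrap E m) + 2 * E * E * ∑ G T̂
    rhs = trans (∑-+ G _ _) (cong₂ _+_ (trans (∑-+ G _ _) (cong₂ _+_ (trans (∑-const G _) (*-comm G _))
        (trans (∑-*ˡ G (4 * E * E * t₀) _) (cong (4 * E * E * t₀ *_) (trans (∑-+ G _ _) (cong (∑ G b̂ +_) (∑-const G _)))))))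
      (∑-*ˡ G (2 * E * E) _))
    main : t₀ * (E * (∑ G x̂ + G * ρ + ∑ G ŷ)) ≤ t₀ * ((E + 2) * p) * G
      + 4 * E * E * t₀ * (p * badTotal E m (G + D) X Y + G * wrap E m) + 2 * E * E * (p * total)
    main = begin
      t₀ * (E * (∑ G x̂ + G * ρ + ∑ G ŷ))
        ≡⟨ sym lhs ⟩
      ∑ G (λ u → t₀ * (E * (x̂ u + ρ + ŷ u)))
        ≤⟨ ∑-mono′ G one-window ⟩
      ∑ G (λ u → t₀ * ((E + 2) * p) + 4 * E * E * t₀ * (b̂ u + wrap E m) + 2 * E * E * T̂ u)
        ≡⟨ rhs ⟩
      t₀ * ((E + 2) * p) * G + 4 * E * E * t₀ * (∑ G b̂ + G * wrap E m) + 2 * E * E * ∑ G T̂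
        ≤⟨ +-mono-≤ (+-monoʳ-≤ _ (*-monoʳ-≤ (4 * E * E * t₀) (+-monoˡ-≤ _ ∑b̂)))
             (*-monoʳ-≤ (2 * E * E) (∑∑-≤ G D (λ w → χ (X w) * layer R Y s w) p≤D)) ⟩
      t₀ * ((E + 2) * p) * G + 4 * E * E * t₀ * (p * badTotal E m (G + D) X Y + G * wrap E m) + 2 * E * E * (p * total) ∎

-- Choice of block and scales; the additive step.

-- Two averages at once. A block failing the first condition is sparser than the mean by 1/E; one
-- failing the second has more than pG/Θ triples. `pt` charges for either failure, and failure
-- everywhere would need twice the triples that `few` allows.
pick-block : ∀ E V p Θ G r n (ρ T : ℕ → ℕ) → 0 < E → 0 < V → 0 < p → 0 < G →
  (∀ v → ρ v ≤ p) → ∑ V ρ ≡ r → ∑ V T ≡ n → 4 * (E * (Θ * n)) ≤ V * p * G →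
  Σ ℕ λ v → v < V × E * r ≤ E * (V * ρ v) + V * p × Θ * T v ≤ p * G
pick-block E V p Θ G r n ρ T E>0 V>0 p>0 G>0 ρ≤p ∑ρ ∑T few
  with search (λ v → (E * r ≤? E * (V * ρ v) + V * p) ×-dec (Θ * T v ≤? p * G)) V
... | inj₁ (v , v<V , ok) = v , v<V , ok
... | inj₂ none = ⊥-elim (<⇒≱ (*-mono-≤ {1} (*-mono-≤ {1} V>0 p>0) G>0) NG≤0)
  where
  open ≤-Reasoning
  pt : ∀ v → v < V → (E * (V * ρ v) + V * p) * (p * G) ≤ E * r * (p * G) + 2 * (E * (V * p)) * (Θ * T v)
  pt v v<V with E * r ≤? E * (V * ρ v) + V * p
  ... | no gt = ≤-trans (*-monoˡ-≤ (p * G) (<⇒≤ (≰⇒> gt))) (m≤m+n _ _)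
  ... | yes le = ≤-trans (*-mono-≤ (begin
      E * (V * ρ v) + V * p     ≤⟨ +-mono-≤ (*-monoʳ-≤ E (*-monoʳ-≤ V (ρ≤p v))) (m≤n*m (V * p) E {{>-nonZero E>0}}) ⟩
      E * (V * p) + E * (V * p) ≡⟨ cong (E * (V * p) +_) (sym (+-identityʳ _)) ⟩
      2 * (E * (V * p))         ∎) (<⇒≤ (≰⇒> (λ le′ → none v v<V (le , le′))))) (m≤n+m _ _)
  summed : (E * (V * r) + V * (V * p)) * (p * G) ≤ V * (E * r * (p * G)) + 2 * (E * (V * p)) * (Θ * n)
  summed = begin
    (E * (V * r) + V * (V * p)) * (p * G)
      ≡⟨ cong (_* (p * G)) (sym (trans (∑-+ V _ _) (cong₂ _+_ (trans (∑-*ˡ V E _) (cong (E *_) (trans (∑-*ˡ V V ρ) (cong (V *_) ∑ρ))))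
           (∑-const V (V * p))))) ⟩
    ∑ V (λ v → E * (V * ρ v) + V * p) * (p * G)
      ≡⟨ sym (∑-*ʳ V (p * G) _) ⟩
    ∑ V (λ v → (E * (V * ρ v) + V * p) * (p * G))
      ≤⟨ ∑-mono V pt ⟩
    ∑ V (λ v → E * r * (p * G) + 2 * (E * (V * p)) * (Θ * T v))
      ≡⟨ trans (∑-+ V _ _) (cong₂ _+_ (∑-const V _) (trans (∑-*ˡ V (2 * (E * (V * p))) (λ v → Θ * T v))
           (cong (2 * (E * (V * p)) *_) (trans (∑-*ˡ V Θ T) (cong (Θ *_) ∑T))))) ⟩
    V * (E * r * (p * G)) + 2 * (E * (V * p)) * (Θ * n) ∎
  NG≤ : V * p * G ≤ 2 * (E * (Θ * n))
  NG≤ = *-cancelˡ-≤ (V * p) {{>-nonZero (*-mono-≤ {1} V>0 p>0)}}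
    (≤-by _ _ summed (eq V p G E r (Θ * n)))
    where
    eq : ∀ V p G E r n → V * p * (V * p * G) + (V * (E * r * (p * G)) + 2 * (E * (V * p)) * n)
      ≡ V * p * (2 * (E * n)) + (E * (V * r) + V * (V * p)) * (p * G)
    eq = solve-∀
  NG≤0 : V * p * G ≤ 0
  NG≤0 = ≤-by (4 * (E * (Θ * n)) + 2 * (V * p * G)) (V * p * G + 2 * (2 * (E * (Θ * n))))
    (+-mono-≤ few (*-monoʳ-≤ 2 NG≤)) (eq (V * p * G) (E * (Θ * n)))
    where
    eq : ∀ a b → a + (a + 2 * (2 * b)) ≡ 0 + (4 * b + 2 * a)
    eq = solve-∀

bernoulli : ∀ δ h → δ ^ h * (δ + h) ≤ suc δ ^ h * δ
bernoulli δ zero    = ≤-reflexive (eq δ)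
  where
  eq : ∀ d → 1 * (d + 0) ≡ 1 * d
  eq = solve-∀
bernoulli δ (suc h) = begin
  δ * δ ^ h * (δ + suc h)                ≡⟨ e₁ δ (δ ^ h) h ⟩
  δ ^ h * (δ * (δ + suc h))              ≤⟨ *-monoʳ-≤ (δ ^ h) (≤-trans (m≤m+n _ h) (≤-reflexive (e₂ δ h))) ⟩
  δ ^ h * (suc δ * (δ + h))              ≡⟨ e₃ (δ ^ h) (suc δ) (δ + h) ⟩
  suc δ * (δ ^ h * (δ + h))              ≤⟨ *-monoʳ-≤ (suc δ) (bernoulli δ h) ⟩
  suc δ * (suc δ ^ h * δ)                ≡⟨ sym (*-assoc (suc δ) (suc δ ^ h) δ) ⟩
  suc δ * suc δ ^ h * δ                  ∎
  where
  open ≤-Reasoning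
  e₁ : ∀ d a h → d * a * (d + (1 + h)) ≡ a * (d * (d + (1 + h)))
  e₁ = solve-∀
  e₂ : ∀ d h → d * (d + (1 + h)) + h ≡ (1 + d) * (d + h)
  e₂ = solve-∀
  e₃ : ∀ a b c → a * (b * c) ≡ b * (a * c)
  e₃ = solve-∀

large-power : ∀ C δ → Σ ℕ λ h → C * δ ^ h ≤ suc δ ^ h
large-power C zero    = 1 , ≤-trans (≤-reflexive (*-zeroʳ C)) z≤n
large-power C (suc d) = C * δ , *-cancelʳ-≤ _ _ δ (begin
  C * δ ^ (C * δ) * δ          ≡⟨ e C (δ ^ (C * δ)) δ ⟩
  δ ^ (C * δ) * (C * δ)        ≤⟨ *-monoʳ-≤ (δ ^ (C * δ)) (m≤n+m (C * δ) δ) ⟩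
  δ ^ (C * δ) * (δ + C * δ)    ≤⟨ bernoulli δ (C * δ) ⟩
  suc δ ^ (C * δ) * δ          ∎)
  where
  open ≤-Reasoning
  δ : ℕ
  δ = suc d
  e : ∀ C a d → C * a * d ≡ a * (C * d)
  e = solve-∀

-- Used with Y the complement of X + R: then X gains almost the density of R.

AdditiveStep : (κ E m N G : ℕ) → Set
AdditiveStep κ E m N G = ∀ (X R Y : ℕ → Bool) →
  (∀ c → R c ≡ true → c < N) → N ≤ κ * ♯ N R →
  (∀ x c → X x ≡ true → R c ≡ true → Y (x + c) ≡ false) →
  (∀ q → 0 < q → q ≤ 2 * E → 4 * E * E * suc (2 * E) * bad (G + (N + N)) m q X ≤ 2 * G) →
  4 * E * E * suc (2 * E) * bad (G + (N + N)) m 1 Y ≤ 2 * G →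
  N * (E * (♯ G X + ♯ G Y)) + E * (G * ♯ N R) ≤ (E + 8) * (G * N)

-- The error budget in units of 1/E: 2 from ℤ/p, 2 from missed progressions, 1 each from seams,
-- triples, boundary and the choice of block, in total 8.
combine : ∀ E t₀ p x y ρ b w T G s V r → 0 < t₀ →
  t₀ * (E * (p * x + G * ρ + p * y)) ≤ t₀ * ((E + 2) * p) * G + 4 * E * E * t₀ * (p * b + G * w)
    + 2 * E * E * (p * T) + t₀ * (E * (p * p + p * (s + p + p))) →
  4 * E * E * b ≤ 2 * G → 4 * E * E * w ≤ p → 2 * E * E * (p * T) ≤ t₀ * (p * G) →
  E * (p + (s + p + p)) ≤ G → E * r ≤ E * (V * ρ) + V * p →
  V * p * (E * (x + y)) + E * (G * r) ≤ (E + 8) * (G * (V * p))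
combine E t₀ p x y ρ b w T G s V r t₀>0 hyp hb hw hT hs hr =
  ≤-by (V * (E * (p * x + G * ρ + p * y)) + G * (E * r)) (V * ((E + 7) * (p * G)) + G * (E * (V * ρ) + V * p))
    (+-mono-≤ (*-monoʳ-≤ V cancelled) (*-monoʳ-≤ G hr)) (e₃ E p x y ρ G V r)
  where
  open ≤-Reasoning
  e₁ : ∀ E t p G b w S → t * ((E + 2) * p) * G + 4 * E * E * t * (p * b + G * w) + t * (p * G) + t * (E * (p * p + p * S))
    ≡ t * ((E + 2) * p * G + p * (4 * E * E * b) + G * (4 * E * E * w) + p * G + p * (E * (p + S)))
  e₁ = solve-∀
  e₂ : ∀ E p G → (E + 2) * p * G + p * (2 * G) + G * p + p * G + p * G ≡ (E + 7) * (p * G)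
  e₂ = solve-∀
  e₃ : ∀ E p x y ρ G V r → V * p * (E * (x + y)) + E * (G * r) + (V * ((E + 7) * (p * G)) + G * (E * (V * ρ) + V * p))
    ≡ (E + 8) * (G * (V * p)) + (V * (E * (p * x + G * ρ + p * y)) + G * (E * r))
  e₃ = solve-∀
  cancelled : E * (p * x + G * ρ + p * y) ≤ (E + 7) * (p * G)
  cancelled = *-cancelˡ-≤ t₀ {{>-nonZero t₀>0}} (begin
    t₀ * (E * (p * x + G * ρ + p * y))
      ≤⟨ hyp ⟩
    t₀ * ((E + 2) * p) * G + 4 * E * E * t₀ * (p * b + G * w) + 2 * E * E * (p * T) + t₀ * (E * (p * p + p * (s + p + p)))
      ≤⟨ +-monoˡ-≤ (t₀ * (E * (p * p + p * (s + p + p)))) (+-monoʳ-≤ (t₀ * ((E + 2) * p) * G + 4 * E * E * t₀ * (p * b + G * w)) hT) ⟩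
    t₀ * ((E + 2) * p) * G + 4 * E * E * t₀ * (p * b + G * w) + t₀ * (p * G) + t₀ * (E * (p * p + p * (s + p + p)))
      ≡⟨ e₁ E t₀ p G b w (s + p + p) ⟩
    t₀ * ((E + 2) * p * G + p * (4 * E * E * b) + G * (4 * E * E * w) + p * G + p * (E * (p + (s + p + p))))
      ≤⟨ *-monoʳ-≤ t₀ (+-mono-≤ (+-monoˡ-≤ (p * G) (+-mono-≤ (+-monoʳ-≤ _ (*-monoʳ-≤ p hb)) (*-monoʳ-≤ G hw))) (*-monoʳ-≤ p hs)) ⟩
    t₀ * ((E + 2) * p * G + p * (2 * G) + G * p + p * G + p * G)
      ≡⟨ cong (t₀ *_) (e₂ E p G) ⟩
    t₀ * ((E + 7) * (p * G)) ∎)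

module Scales (κ E m : ℕ) (2κ≤E : 2 * κ ≤ E) (E>0 : 0 < E) (m>0 : 0 < m) where

  -- `P₀` is the factor that `cyclic-bound` demands of the period, `P₁` makes the period outweigh
  -- the seams, and `Θ` is how rare triples have to be. The factor `K !` makes every candidate
  -- period `suc i * P` divide `N`, so `[0, N)` splits into whole blocks.
  P₀ P₁ P Θ δ Δ h K N : ℕ
  P₀ = 2 * E * m * (4 * m * E)
  P₁ = suc (4 * E * E * wrap E m)
  P = P₀ * P₁
  Θ = 2 * E * E * P₀
  δ = 16 * E * Θ
  Δ = suc δ
  h = proj₁ (large-power (4 * Δ) δ)
  K = suc (2 * (2 * κ) ^ h)
  N = P * K !

  Em>0 : 0 < 2 * E * m
  Em>0 = *-mono-≤ {1} (*-mono-≤ {1} {2} (s≤s z≤n) E>0) m>0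

  mE>0 : 0 < 4 * m * E
  mE>0 = *-mono-≤ {1} (*-mono-≤ {1} {4} (s≤s z≤n) m>0) E>0

  P₀>0 : 0 < P₀
  P₀>0 = *-mono-≤ {1} Em>0 mE>0

  P>0 : 0 < P
  P>0 = *-mono-≤ {1} P₀>0 (s≤s z≤n)

  K!>0 : 0 < K !
  K!>0 = >-nonZero⁻¹ (K !) {{K !≢0}}

  N>0 : 0 < N
  N>0 = *-mono-≤ {1} P>0 K!>0

  K≤K! : K ≤ K !
  K≤K! = m≤m*n K ((2 * (2 * κ) ^ h) !) {{(2 * (2 * κ) ^ h) !≢0}}

  E≤P₀ : E ≤ P₀
  E≤P₀ = begin
    E              ≤⟨ m≤m+n E (E + 0) ⟩
    2 * E          ≤⟨ m≤m*n (2 * E) m {{>-nonZero m>0}} ⟩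
    2 * E * m      ≤⟨ m≤m*n (2 * E * m) (4 * m * E) {{>-nonZero mE>0}} ⟩
    P₀             ∎
    where open ≤-Reasoning

  Em<N : E * m < N
  Em<N = begin-strict
    E * m                     <⟨ m<m+n (E * m) (*-mono-≤ {1} E>0 m>0) ⟩
    E * m + E * m             ≡⟨ e E m ⟩
    2 * E * m                 ≤⟨ m≤m*n (2 * E * m) (4 * m * E) {{>-nonZero mE>0}} ⟩
    P₀                        ≤⟨ m≤m*n P₀ P₁ ⟩
    P                         ≤⟨ m≤m*n P (K !) {{K !≢0}} ⟩
    N                         ∎
    where
    open ≤-Reasoning
    e : ∀ E m → E * m + E * m ≡ 2 * E * m
    e = solve-∀

  module _ (B₀ : ℕ) (large : 4 * E * N ≤ Δ * B₀) where

    G D : ℕ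
    G = Δ * B₀
    D = N + N

    4N≤G : 4 * N ≤ G
    4N≤G = ≤-trans (*-monoˡ-≤ N (m≤m*n 4 E {{>-nonZero E>0}})) large

    G>0 : 0 < G
    G>0 = <-≤-trans (*-mono-≤ {1} {4} (s≤s z≤n) N>0) 4N≤G

    W≤2G : G + D ≤ 2 * G
    W≤2G = ≤-trans (m≤m+n _ (N + N)) (≤-by (4 * N) G 4N≤G (e G N))
      where
      e : ∀ G N → G + (N + N) + (N + N) + G ≡ 2 * G + 4 * N
      e = solve-∀

    W+N≤2G : G + D + N ≤ 2 * G
    W+N≤2G = ≤-trans (m≤m+n _ N) (≤-by (4 * N) G 4N≤G (e G N))
      where
      e : ∀ G N → G + (N + N) + N + N + G ≡ 2 * G + 4 * N
      e = solve-∀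

    module _ (X R Y : ℕ → Bool) (R-supp : ∀ c → R c ≡ true → c < N) (R-dense : N ≤ κ * ♯ N R)
      (disj : ∀ x c → X x ≡ true → R c ≡ true → Y (x + c) ≡ false)
      (badX : ∀ q → 0 < q → q ≤ 2 * E → 4 * E * E * suc (2 * E) * bad (G + D) m q X ≤ 2 * G)
      (badY : 4 * E * E * suc (2 * E) * bad (G + D) m 1 Y ≤ 2 * G) where

      r : ℕ
      r = ♯ N R

      few-bad : 4 * E * E * badTotal E m (G + D) X Y ≤ 2 * G
      few-bad = *-cancelˡ-≤ (suc (2 * E)) (begin
        suc (2 * E) * (4 * E * E * badTotal E m (G + D) X Y)
          ≡⟨ e₁ (suc (2 * E)) (4 * E * E) _ _ ⟩
        4 * E * E * suc (2 * E) * ∑ (2 * E) (λ i → bad (G + D) m (suc i) X) + 4 * E * E * suc (2 * E) * bad (G + D) m 1 Y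
          ≡⟨ cong (_+ 4 * E * E * suc (2 * E) * bad (G + D) m 1 Y) (sym (∑-*ˡ (2 * E) (4 * E * E * suc (2 * E)) _)) ⟩
        ∑ (2 * E) (λ i → 4 * E * E * suc (2 * E) * bad (G + D) m (suc i) X) + 4 * E * E * suc (2 * E) * bad (G + D) m 1 Y
          ≤⟨ +-mono-≤ (∑-bound (2 * E) (2 * G) (λ i i< → badX (suc i) z<s i<)) badY ⟩
        2 * E * (2 * G) + 2 * G
          ≡⟨ +-comm (2 * E * (2 * G)) (2 * G) ⟩
        suc (2 * E) * (2 * G) ∎)
        where
        open ≤-Reasoning
        e₁ : ∀ a b c d → a * (b * (c + d)) ≡ b * a * c + b * a * d
        e₁ = solve-∀

      module Period (i : ℕ) (i<K : suc i ≤ K)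
        (few : Δ * collisions (G + D) N X R Y (suc i * P) ≤ (G + D) * r + Δ * r * B₀) where

        p t₀ V : ℕ
        p = suc i * P
        t₀ = suc i * P₁

        divisor : suc i ∣ K !
        divisor = ∣-trans (m∣m*n (i !)) (m≤n⇒m!∣n! i<K)

        V = _∣_.quotient divisor

        N≡Vp : N ≡ V * p
        N≡Vp = trans (cong (P *_) (_∣_.equality divisor)) (e P V (suc i))
          where
          e : ∀ P V i → P * (V * i) ≡ V * (i * P)
          e = solve-∀

        p>0 : 0 < p
        p>0 = *-mono-≤ {1} {suc i} (s≤s z≤n) P>0

        V>0 : 0 < V
        V>0 = n≢0⇒n>0 λ eq → <⇒≢ N>0 (sym (trans N≡Vp (cong (_* p) eq)))

        p≤N : p ≤ N
        p≤N = ≤-trans (m≤n*m p V {{>-nonZero V>0}}) (≤-reflexive (sym N≡Vp))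

        p≡ : p ≡ P₀ * t₀
        p≡ = e (suc i) P₀ P₁
          where
          e : ∀ i a b → i * (a * b) ≡ a * (i * b)
          e = solve-∀

        instance
          p≢0 : NonZero p
          p≢0 = >-nonZero p>0

        open Fold p using (layer)

        ρ T : ℕ → ℕ
        ρ v = ∑ p (λ c → χ (R (v * p + c)))
        T v = ∑ (G + D) (λ w → χ (X w) * layer R Y (v * p) w)

        n : ℕ
        n = collisions (G + D) N X R Y p

        ∑ρ : ∑ V ρ ≡ r
        ∑ρ = trans (sym (∑-blocks V p (λ c → χ (R c)))) (cong (λ z → ∑ z (λ c → χ (R c))) (sym N≡Vp))

        ∑T : ∑ V T ≡ n
        ∑T = trans (∑-swap V (G + D) _) (∑-cong′ (G + D) (λ w → trans (∑-*ˡ V (χ (X w)) _)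
          (cong (χ (X w) *_) (trans (sym (∑-blocks V p (λ c → χ (R c) * χ (Y (p + w + c)))))
            (cong (λ z → ∑ z (λ c → χ (R c) * χ (Y (p + w + c)))) (sym N≡Vp))))))

        n-small : 4 * (E * (Θ * n)) ≤ V * p * G
        n-small = *-cancelˡ-≤ 4 (begin
          4 * (4 * (E * (Θ * n)))      ≡⟨ e₁ E Θ n ⟩
          16 * E * Θ * n               ≤⟨ *-monoˡ-≤ n (n≤1+n δ) ⟩
          Δ * n                        ≤⟨ few ⟩
          (G + D) * r + Δ * r * B₀     ≤⟨ +-monoˡ-≤ _ (*-monoˡ-≤ r W≤2G) ⟩
          2 * G * r + Δ * r * B₀       ≡⟨ e₂ Δ B₀ r ⟩
          3 * (r * G)                  ≤⟨ *-mono-≤ (n≤1+n 3) (*-monoˡ-≤ G (♯≤ N R)) ⟩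
          4 * (N * G)                  ≡⟨ cong (λ z → 4 * (z * G)) N≡Vp ⟩
          4 * (V * p * G)              ∎)
          where
          open ≤-Reasoning
          e₁ : ∀ E a n → 4 * (4 * (E * (a * n))) ≡ 16 * E * a * n
          e₁ = solve-∀
          e₂ : ∀ D B r → 2 * (D * B) * r + D * r * B ≡ 3 * (r * (D * B))
          e₂ = solve-∀

        block : Σ ℕ λ v → v < V × E * r ≤ E * (V * ρ v) + V * p × Θ * T v ≤ p * G
        block = pick-block E V p Θ G r n ρ T E>0 V>0 p>0 G>0 (λ v → ♯≤ p (λ c → R (v * p + c))) ∑ρ ∑T n-small

        conclude : ∀ v → v < V → E * r ≤ E * (V * ρ v) + V * p → Θ * T v ≤ p * G →
          N * (E * (♯ G X + ♯ G Y)) + E * (G * r) ≤ (E + 8) * (G * N)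
        conclude v v<V dense fewT = subst (λ z → z * (E * (♯ G X + ♯ G Y)) + E * (G * r) ≤ (E + 8) * (G * z)) (sym N≡Vp)
          (combine E t₀ p (♯ G X) (♯ G Y) (ρ v) (badTotal E m (G + D) X Y) (wrap E m) (T v) G s V r t₀>0
            (Windows.all-windows E m t₀ p E>0 m>0 t₀>0 p≡ X R Y disj s G D p≤D s+2p≤D t₀≤ρ)
            few-bad wrap≤p few-triples boundary dense)
          where
          open ≤-Reasoning
          s : ℕ
          s = v * p
          t₀>0 : 0 < t₀
          t₀>0 = s≤s z≤n
          p≤D : p ≤ D
          p≤D = ≤-trans p≤N (m≤m+n N N)
          s+p≤N : s + p ≤ N
          s+p≤N = ≤-trans (≤-reflexive (+-comm s p)) (≤-trans (*-monoˡ-≤ p v<V) (≤-reflexive (sym N≡Vp)))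
          s+2p≤D : s + p + p ≤ D
          s+2p≤D = +-mono-≤ s+p≤N p≤N
          wrap≤p : 4 * E * E * wrap E m ≤ p
          wrap≤p = ≤-trans (n≤1+n _) (≤-trans (m≤n*m P₁ P₀ {{>-nonZero P₀>0}}) (m≤n*m P (suc i)))
          boundary : E * (p + (s + p + p)) ≤ G
          boundary = begin
            E * (p + (s + p + p))   ≤⟨ *-monoʳ-≤ E (+-mono-≤ p≤N s+2p≤D) ⟩
            E * (N + (N + N))       ≤⟨ *-monoʳ-≤ E (m≤m+n _ N) ⟩
            E * (N + (N + N) + N)   ≡⟨ e E N ⟩
            4 * E * N               ≤⟨ large ⟩
            G                       ∎
            where
            e : ∀ E N → E * (N + (N + N) + N) ≡ 4 * E * N
            e = solve-∀
          few-triples : 2 * E * E * (p * T v) ≤ t₀ * (p * G)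
          few-triples = *-cancelˡ-≤ P₀ {{>-nonZero P₀>0}} (begin
            P₀ * (2 * E * E * (p * T v))   ≡⟨ e₁ P₀ (2 * E * E) p (T v) ⟩
            p * (Θ * T v)                  ≤⟨ *-monoʳ-≤ p fewT ⟩
            p * (p * G)                    ≡⟨ cong (_* (p * G)) p≡ ⟩
            P₀ * t₀ * (p * G)              ≡⟨ *-assoc P₀ t₀ (p * G) ⟩
            P₀ * (t₀ * (p * G))            ∎)
            where
            e₁ : ∀ a b p t → a * (b * (p * t)) ≡ p * (b * a * t)
            e₁ = solve-∀
          -- `R` has density at least 1/κ ≥ 2/E and the block at most 1/E less, so `ρ v` is at least
          -- p/E, while `p = P₀ * t₀` with `E ≤ P₀`.
          t₀≤ρ : t₀ ≤ ρ v
          t₀≤ρ = *-cancelˡ-≤ E {{>-nonZero E>0}} (≤-trans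
            (≤-trans (*-monoˡ-≤ t₀ E≤P₀) (≤-reflexive (sym p≡)))
            (*-cancelˡ-≤ V {{>-nonZero V>0}} (+-cancelʳ-≤ (V * p) _ _ (begin
              V * p + V * p              ≡⟨ cong₂ _+_ (sym N≡Vp) (sym N≡Vp) ⟩
              N + N                      ≤⟨ +-mono-≤ R-dense R-dense ⟩
              κ * r + κ * r              ≡⟨ e κ r ⟩
              2 * κ * r                  ≤⟨ *-monoˡ-≤ r 2κ≤E ⟩
              E * r                      ≤⟨ dense ⟩
              E * (V * ρ v) + V * p      ≡⟨ cong (_+ V * p) (e′ E V (ρ v)) ⟩
              V * (E * ρ v) + V * p      ∎))))
            where
            e : ∀ a r → a * r + a * r ≡ 2 * a * r
            e = solve-∀
            e′ : ∀ a b c → a * (b * c) ≡ b * (a * c)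
            e′ = solve-∀

      step : N * (E * (♯ G X + ♯ G Y)) + E * (G * r) ≤ (E + 8) * (G * N)
      step =
        let i , i< , few = AlmostPeriod.almost-period κ δ h P N (G + D) B₀ X R Y N>0 R-supp R-dense disj
              (proj₂ (large-power (4 * Δ) δ)) KP≤N W+N≤2G
            v , v<V , dense , fewT = Period.block i (m≤n⇒m≤1+n i<) few
        in Period.conclude i (m≤n⇒m≤1+n i<) few v v<V dense fewT
        where
        KP≤N : K * P ≤ N
        KP≤N = ≤-trans (*-monoˡ-≤ P K≤K!) (≤-reflexive (*-comm (K !) P))

additive-step : ∀ κ E m → 2 * κ ≤ E → 0 < E → 0 < m → Σ ℕ λ N → Σ ℕ λ Δ →
  E * m < N × 0 < Δ × (∀ B₀ → 4 * E * N ≤ Δ * B₀ → AdditiveStep κ E m N (Δ * B₀))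
additive-step κ E m 2κ≤E E>0 m>0 = Scales.N κ E m 2κ≤E E>0 m>0 , Scales.Δ κ E m 2κ≤E E>0 m>0 ,
  Scales.Em<N κ E m 2κ≤E E>0 m>0 , s≤s z≤n ,
  λ B₀ large X R Y supp dense disj badX badY →
    Scales.step κ E m 2κ≤E E>0 m>0 B₀ large X R Y supp dense disj badX badY

-- Iterated sumsets of a sum-free set.

SumFreeᵇ : ℕ → ℕ → (ℕ → Bool) → Set
SumFreeᵇ k l T = (x : Fin k → ℕ) (y : Fin l → ℕ) →
  (∀ i → T (x i) ≡ true) → (∀ j → T (y j) ≡ true) → sumF x ≢ sumF y

∧-elim : ∀ {a b} → a ∧ b ≡ true → a ≡ true × b ≡ true
∧-elim {true} {true} _ = refl , refl

sumset : ℕ → (R X : ℕ → Bool) → ℕ → Bool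
sumset N R X z = does (0 <? ∑ N (λ c → χ (does (c ≤? z) ∧ (R c ∧ X (z ∸ c)))))

sumset-intro : ∀ N R X x c → c < N → X x ≡ true → R c ≡ true → sumset N R X (x + c) ≡ true
sumset-intro N R X x c c<N Xx Rc = dec-true (0 <? _) (<-≤-trans (subst (λ b → 0 < χ b) (sym hit) z<s)
  (∑-term N (λ c′ → χ (does (c′ ≤? x + c) ∧ (R c′ ∧ X (x + c ∸ c′)))) c c<N))
  where
  hit : does (c ≤? x + c) ∧ (R c ∧ X (x + c ∸ c)) ≡ true
  hit = ∧-dec-intro (c ≤? x + c) (m≤n+m c x) (cong₂ _∧_ Rc (trans (cong X (m+n∸n≡m x c)) Xx))

sumset-elim : ∀ N R X z → sumset N R X z ≡ true →
  Σ ℕ λ x → Σ ℕ λ c → X x ≡ true × R c ≡ true × z ≡ x + c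
sumset-elim N R X z eq =
  let c , _ , pos = ∑-pos-witness N _ (does-true (0 <? ∑ N (λ c → χ (does (c ≤? z) ∧ (R c ∧ X (z ∸ c))))) eq)
      c≤z , rest = ∧-dec-elim (c ≤? z) (χ-pos pos)
      Rc , Xx = ∧-elim rest
  in z ∸ c , c , Xx , Rc , sym (m∸n+n≡m c≤z)

bad-shift : ∀ W m q s (A X : ℕ → Bool) → (∀ x → A x ≡ true → X (s + x) ≡ true) →
  bad W m q X ≤ bad W m q A + s
bad-shift W m q s A X sub = ≤-trans (∑-shift-≥ W s _ (λ w → χ₀≤1 _))
  (+-monoˡ-≤ s (bad-anti W m q {A} {λ x → X (s + x)} sub ⟨≤⟩ λ u →
    cong χ₀ (∑-cong′ m (λ j → cong (λ z → χ (X z)) (sym (+-assoc s u (j * q)))))))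
  where
  _⟨≤⟩_ : ∀ {b f g} → ∑ W f ≤ b → (∀ u → f u ≡ g u) → ∑ W g ≤ b
  le ⟨≤⟩ eq = ≤-trans (≤-reflexive (sym (∑-cong′ W eq))) le

bad-range : ∀ G D m q (A : ℕ → Bool) → bad (G + D) m q A ≤ bad G m q A + D
bad-range G D m q A = ≤-trans (≤-reflexive (∑-split G D _)) (+-monoʳ-≤ _
  (≤-trans (∑-bound D 1 (λ x _ → χ₀≤1 _)) (≤-reflexive (*-identityʳ D))))

module Sumsets (k l N G c₀ M : ℕ) (l≤k : l ≤ k) (T : ℕ → Bool)
  (free : SumFreeᵇ (suc k) (suc l) T) where

  -- Index c in `R` stands for the element `M * suc c`, so that the lattice starts at M and not at
  -- 0. This offset is the source of `z + j` in `S-rep` and of the shift `k ∸ l` in `disjoint`.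
  A R : ℕ → Bool
  A x = does (x <? G) ∧ T (c₀ + M * x)
  R c = does (c <? N) ∧ T (M * suc c)

  S : ℕ → ℕ → Bool
  S zero    = A
  S (suc j) = sumset N R (S j)

  R-supp : ∀ c → R c ≡ true → c < N
  R-supp c Rc = proj₁ (∧-dec-elim (c <? N) Rc)

  S-rep : ∀ j z → S j z ≡ true → Σ (Fin (suc j) → ℕ) λ x → (∀ i → T (x i) ≡ true) × sumF x ≡ c₀ + M * (z + j)
  S-rep zero z eq = (λ _ → c₀ + M * z) , (λ _ → proj₂ (∧-dec-elim (z <? G) eq)) ,
    trans (+-identityʳ _) (cong (λ y → c₀ + M * y) (sym (+-identityʳ z)))
  S-rep (suc j) z eq =
    let y , c , Sy , Rc , z≡ = sumset-elim N R (S j) z eq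
        x , Tx , ∑x = S-rep j y Sy
    in (λ { zero → M * suc c ; (suc i) → x i }) ,
       (λ { zero → proj₂ (∧-dec-elim (c <? N) Rc) ; (suc i) → Tx i }) ,
       trans (cong (M * suc c +_) ∑x) (trans (e M c c₀ y j) (cong (λ w → c₀ + M * (w + suc j)) (sym z≡)))
    where
    e : ∀ M c c₀ y j → M * (1 + c) + (c₀ + M * (y + j)) ≡ c₀ + M * (y + c + (1 + j))
    e = solve-∀

  disjoint : ∀ z → S k z ≡ true → S l (k ∸ l + z) ≡ true → ⊥
  disjoint z p q =
    let x , Tx , ∑x = S-rep k z p
        y , Ty , ∑y = S-rep l (k ∸ l + z) q
    in free x y Tx Ty (trans ∑x (trans (cong (λ w → c₀ + M * w) ix) (sym ∑y)))
    where
    ix : z + k ≡ k ∸ l + z + l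
    ix = trans (cong (z +_) (sym (m∸n+n≡m l≤k))) (e z (k ∸ l) l)
      where
      e : ∀ a b c → a + (b + c) ≡ b + a + c
      e = solve-∀

  module _ (c : ℕ) (Rc : R c ≡ true) where

    S-up : ∀ i j z → S j z ≡ true → S (i + j) (i * c + z) ≡ true
    S-up zero    j z p = p
    S-up (suc i) j z p = subst (λ w → S (suc (i + j)) w ≡ true) (e i c z)
      (sumset-intro N R (S (i + j)) (i * c + z) c (R-supp c Rc) (S-up i j z p) Rc)
      where
      e : ∀ i c z → i * c + z + c ≡ (1 + i) * c + z
      e = solve-∀

    S-from-A : ∀ j x → A x ≡ true → S j (j * c + x) ≡ true
    S-from-A j x Ax = subst (λ i → S i (j * c + x) ≡ true) (+-identityʳ j) (S-up j 0 x Ax)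

    -- The additive step also needs a regular complement. It contains a translate of `A`: a point of
    -- `S (suc j)` in that translate would, after adding copies of one fixed element of `R`,
    -- contradict `disjoint`.
    complement-from-A : ∀ j → j < k → ∀ x w → w + ((k ∸ suc j) * c + (k ∸ l)) ≡ x + l * c →
      A x ≡ true → not (S (suc j) w) ≡ true
    complement-from-A j j<k x w eq Ax with bool-case (S (suc j) w)
    ... | inj₂ f = cong not f
    ... | inj₁ t = ⊥-elim (disjoint ((k ∸ suc j) * c + w)
      (subst (λ i → S i ((k ∸ suc j) * c + w) ≡ true) (m∸n+n≡m j<k) (S-up (k ∸ suc j) (suc j) w t))
      (subst (λ y → S l y ≡ true) ix (S-from-A l x Ax)))
      where
      ix : l * c + x ≡ k ∸ l + ((k ∸ suc j) * c + w)
      ix = trans (+-comm (l * c) x) (trans (sym eq) (e w ((k ∸ suc j) * c) (k ∸ l)))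
        where
        e : ∀ w a b → w + (a + b) ≡ b + (a + w)
        e = solve-∀

module Chain (k l E m N G c₀ M : ℕ) (l≤k : l ≤ k) (T : ℕ → Bool)
  (free : SumFreeᵇ (suc k) (suc l) T)
  (E>0 : 0 < E) (N>0 : 0 < N)
  (additive : AdditiveStep (suc k + suc l) E m N G)
  -- `5 * κ * N` bounds the translations and range extensions incurred when regularity passes from
  -- `A` to the sumsets and their complements.
  (G-large : 4 * E * E * suc (2 * E) * (5 * (suc k + suc l) * N) ≤ G) where

  open Sumsets k l N G c₀ M l≤k T free

  κ : ℕ
  κ = suc k + suc l

  module _
    (R-dense : (E + 10 * κ) * N ≤ κ * E * ♯ N R)
    (A-dense : (E + 9 * κ) * G ≤ κ * E * ♯ G A)
    (A-bad : ∀ q → 0 < q → q ≤ 2 * E → 4 * E * E * suc (2 * E) * bad G m q A ≤ G) where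

    y : ℕ → ℕ
    y j = ♯ G (S j)

    N≤κr : N ≤ κ * ♯ N R
    N≤κr = *-cancelˡ-≤ E {{>-nonZero E>0}} (≤-trans (*-monoˡ-≤ N (m≤m+n E (10 * κ)))
      (≤-trans R-dense (≤-reflexive (e κ E (♯ N R)))))
      where
      e : ∀ a b c → a * b * c ≡ b * (a * c)
      e = solve-∀

    R-elem : Σ ℕ λ c → c < N × R c ≡ true
    R-elem =
      let c , c<N , pos = ∑-pos-witness N (λ c → χ (R c)) (n≢0⇒n>0 λ eq →
            <⇒≱ N>0 (≤-trans N≤κr (≤-reflexive (trans (cong (κ *_) eq) (*-zeroʳ κ)))))
      in c , c<N , χ-pos pos

    few-bad : ∀ b b₀ q → b ≤ bad G m q A + b₀ → b₀ ≤ 5 * κ * N → 0 < q → q ≤ 2 * E →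
      4 * E * E * suc (2 * E) * b ≤ 2 * G
    few-bad b b₀ q b≤ b₀≤ q>0 q≤ = begin
      C * b                          ≤⟨ *-monoʳ-≤ C b≤ ⟩
      C * (bad G m q A + b₀)         ≡⟨ *-distribˡ-+ C (bad G m q A) b₀ ⟩
      C * bad G m q A + C * b₀       ≤⟨ +-mono-≤ (A-bad q q>0 q≤) (≤-trans (*-monoʳ-≤ C b₀≤) G-large) ⟩
      G + G                          ≡⟨ cong (G +_) (sym (+-identityʳ G)) ⟩
      2 * G                          ∎
      where
      open ≤-Reasoning
      C : ℕ
      C = 4 * E * E * suc (2 * E)

    -- The additive step is applied to the complement of `S (suc j)`. `R` has density 1/κ + 10/E, of
    -- which the step loses 8/E.
    gain : ∀ j → j < k → κ * E * y j + (E + 2 * κ) * G ≤ κ * E * y (suc j)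
    gain j j<k = *-cancelˡ-≤ N {{>-nonZero N>0}} (≤-by
        (κ * (N * (E * (y j + ȳ)) + E * (G * r)) + G * ((E + 10 * κ) * N) + N * (κ * E) * G)
        (κ * ((E + 8) * (G * N)) + G * (κ * E * r) + N * (κ * E) * (y (suc j) + ȳ))
        (+-mono-≤ (+-mono-≤ (*-monoʳ-≤ κ step) (*-monoʳ-≤ G R-dense))
          (≤-reflexive (cong (N * (κ * E) *_) (sym (♯-not G (S (suc j)))))))
        (eq κ E N G (y j) (y (suc j)) ȳ r))
      where
      c c<N Rc : _
      c = proj₁ R-elem
      c<N = proj₁ (proj₂ R-elem)
      Rc = proj₂ (proj₂ R-elem)
      Y : ℕ → Bool
      Y z = not (S (suc j) z)
      ȳ r : ℕ
      ȳ = ♯ G Y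
      r = ♯ N R
      open ≤-Reasoning
      eq : ∀ κ E N G a a′ b r → N * (κ * E * a + (E + 2 * κ) * G) + (κ * ((E + 8) * (G * N)) + G * (κ * E * r) + N * (κ * E) * (a′ + b))
        ≡ N * (κ * E * a′) + (κ * (N * (E * (a + b)) + E * (G * r)) + G * ((E + 10 * κ) * N) + N * (κ * E) * G)
      eq = solve-∀
      D s₁ s₂ : ℕ
      D = N + N
      s₁ = (k ∸ suc j) * c + (k ∸ l)
      s₂ = l * c
      k≤κ : k ≤ κ
      k≤κ = ≤-trans (n≤1+n k) (m≤m+n (suc k) (suc l))
      l≤κ : l ≤ κ
      l≤κ = ≤-trans (n≤1+n l) (m≤n+m (suc l) (suc k))
      κ≥1 : N ≤ κ * N
      κ≥1 = m≤n*m N κ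
      badX : ∀ q → 0 < q → q ≤ 2 * E → 4 * E * E * suc (2 * E) * bad (G + D) m q (S j) ≤ 2 * G
      badX q q>0 q≤ = few-bad _ (D + j * c) q (begin
          bad (G + D) m q (S j)                  ≤⟨ bad-shift (G + D) m q (j * c) A (S j) (S-from-A c Rc j) ⟩
          bad (G + D) m q A + j * c              ≤⟨ +-monoˡ-≤ (j * c) (bad-range G D m q A) ⟩
          bad G m q A + D + j * c                ≡⟨ +-assoc (bad G m q A) D (j * c) ⟩
          bad G m q A + (D + j * c)              ∎)
        (begin
          N + N + j * c                          ≤⟨ +-mono-≤ (+-mono-≤ κ≥1 κ≥1) (*-mono-≤ (≤-trans (<⇒≤ j<k) k≤κ) (<⇒≤ c<N)) ⟩
          κ * N + κ * N + κ * N                  ≤⟨ m≤m+n _ (2 * (κ * N)) ⟩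
          κ * N + κ * N + κ * N + 2 * (κ * N)    ≡⟨ e κ N ⟩
          5 * κ * N                              ∎) q>0 q≤
        where
        e : ∀ a b → a * b + a * b + a * b + 2 * (a * b) ≡ 5 * a * b
        e = solve-∀
      badY : 4 * E * E * suc (2 * E) * bad (G + D) m 1 Y ≤ 2 * G
      badY = few-bad _ (D + s₁ + s₂) 1 (begin
          bad (G + D) m 1 Y                          ≤⟨ bad-shift (G + D) m 1 s₂ (λ x → A (s₁ + x)) Y sub ⟩
          bad (G + D) m 1 (λ x → A (s₁ + x)) + s₂    ≤⟨ +-monoˡ-≤ s₂ unshift ⟩
          bad (G + D + s₁) m 1 A + s₂                ≤⟨ +-monoˡ-≤ s₂ (≤-trans (≤-reflexive (cong (λ z → bad z m 1 A) (+-assoc G D s₁)))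
                                                          (bad-range G (D + s₁) m 1 A)) ⟩
          bad G m 1 A + (D + s₁) + s₂                ≡⟨ +-assoc (bad G m 1 A) (D + s₁) s₂ ⟩
          bad G m 1 A + (D + s₁ + s₂)                ∎)
        (begin
          N + N + ((k ∸ suc j) * c + (k ∸ l)) + l * c
            ≤⟨ +-mono-≤ (+-mono-≤ (+-mono-≤ κ≥1 κ≥1) (+-mono-≤ (*-mono-≤ (≤-trans (m∸n≤m k (suc j)) k≤κ) (<⇒≤ c<N))
                 (≤-trans (≤-trans (m∸n≤m k l) k≤κ) (m≤m*n κ N {{>-nonZero N>0}})))) (*-mono-≤ l≤κ (<⇒≤ c<N)) ⟩
          κ * N + κ * N + (κ * N + κ * N) + κ * N    ≡⟨ e κ N ⟩
          5 * κ * N                                  ∎) z<s (≤-trans E>0 (m≤m+n E (E + 0)))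
        where
        e : ∀ a b → a * b + a * b + (a * b + a * b) + a * b ≡ 5 * a * b
        e = solve-∀
        sub : ∀ x → A (s₁ + x) ≡ true → Y (s₂ + x) ≡ true
        sub x Ax = complement-from-A c Rc j j<k (s₁ + x) (s₂ + x) (e₁ s₁ s₂ x) Ax
          where
          e₁ : ∀ a b x → b + x + a ≡ a + x + b
          e₁ = solve-∀
        unshift : bad (G + D) m 1 (λ x → A (s₁ + x)) ≤ bad (G + D + s₁) m 1 A
        unshift = ≤-trans (≤-reflexive (∑-cong′ (G + D) (λ u → cong χ₀ (∑-cong′ m (λ i → cong (λ z → χ (A z)) (sym (+-assoc s₁ u (i * 1))))))))
          (∑-shift-≤ (G + D) s₁ s₁ (λ x → χ₀ (hits m 1 A x)) ≤-refl)
      step : N * (E * (y j + ȳ)) + E * (G * r) ≤ (E + 8) * (G * N)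
      step = additive (S j) R Y R-supp N≤κr
        (λ x c′ Sx Rc′ → cong not (sumset-intro N R (S j) x c′ (R-supp c′ Rc′) Sx Rc′)) badX badY

    growth : ∀ j → j ≤ k → suc j * ((E + 2 * κ) * G) ≤ κ * E * y j
    growth zero _ = ≤-trans (≤-reflexive (+-identityʳ _)) (≤-trans (*-monoˡ-≤ G (+-monoʳ-≤ E (*-monoˡ-≤ κ (s≤s (s≤s (z≤n {7})))))) A-dense)
    growth (suc j) j<k = ≤-trans (+-monoʳ-≤ ((E + 2 * κ) * G) (growth j (<⇒≤ j<k)))
      (≤-trans (≤-reflexive (+-comm ((E + 2 * κ) * G) _)) (gain j j<k))

    both : y k + y l ≤ G + (k ∸ l)
    both = begin
      y k + y l
        ≤⟨ +-monoʳ-≤ (y k) (∑-shift-≥ G (k ∸ l) (λ z → χ (S l z)) (λ z → χ≤1 (S l z))) ⟩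
      y k + (∑ G (λ z → χ (S l (k ∸ l + z))) + (k ∸ l))
        ≡⟨ sym (+-assoc (y k) _ (k ∸ l)) ⟩
      y k + ∑ G (λ z → χ (S l (k ∸ l + z))) + (k ∸ l)
        ≡⟨ cong (_+ (k ∸ l)) (sym (∑-+ G _ _)) ⟩
      ∑ G (λ z → χ (S k z) + χ (S l (k ∸ l + z))) + (k ∸ l)
        ≤⟨ +-monoˡ-≤ (k ∸ l) (≤-trans (∑-bound G 1 (λ z _ → pt z)) (≤-reflexive (*-identityʳ G))) ⟩
      G + (k ∸ l) ∎
      where
      open ≤-Reasoning
      pt : ∀ z → χ (S k z) + χ (S l (k ∸ l + z)) ≤ 1
      pt z with bool-case (S k z) | bool-case (S l (k ∸ l + z))
      ... | inj₁ p | inj₁ q = ⊥-elim (disjoint z p q)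
      ... | inj₂ p | _ rewrite p = χ≤1 _
      ... | inj₁ p | inj₂ q rewrite p | q = ≤-refl

    -- `S k` and `S l` have densities at least (k+1)(1/κ + 2/E) and (l+1)(1/κ + 2/E), which sum to 1
    -- + 2κ/E. Being disjoint up to a shift by `k ∸ l`, they cannot exceed 1 by that much.
    contradiction : ⊥
    contradiction = <⇒≱ small (*-cancelˡ-≤ κ (≤-by (κ * ((E + 2 * κ) * G)) (κ * E * (G + (k ∸ l))) total (e κ E G (k ∸ l))))
      where
      open ≤-Reasoning
      total : κ * ((E + 2 * κ) * G) ≤ κ * E * (G + (k ∸ l))
      total = begin
        κ * ((E + 2 * κ) * G)
          ≡⟨ *-distribʳ-+ ((E + 2 * κ) * G) (suc k) (suc l) ⟩
        suc k * ((E + 2 * κ) * G) + suc l * ((E + 2 * κ) * G)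
          ≤⟨ +-mono-≤ (growth k ≤-refl) (growth l l≤k) ⟩
        κ * E * y k + κ * E * y l
          ≡⟨ sym (*-distribˡ-+ (κ * E) (y k) (y l)) ⟩
        κ * E * (y k + y l)
          ≤⟨ *-monoʳ-≤ (κ * E) both ⟩
        κ * E * (G + (k ∸ l)) ∎
      e : ∀ κ E G g → κ * (2 * κ * G) + κ * E * (G + g) ≡ κ * (E * g) + κ * ((E + 2 * κ) * G)
      e = solve-∀
      small : E * (k ∸ l) < 2 * κ * G
      small = begin-strict
        E * (k ∸ l)    ≤⟨ *-monoʳ-≤ E (≤-trans (m∸n≤m k l) (≤-trans (n≤1+n k) (m≤m+n (suc k) (suc l)))) ⟩
        E * κ          ≤⟨ m≤m*n (E * κ) N {{>-nonZero N>0}} ⟩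
        E * κ * N      ≤⟨ ≤-trans (m≤n*m (E * κ * N) (4 * E * suc (2 * E) * 5) {{>-nonZero
                            (*-mono-≤ {1} (*-mono-≤ {1} (*-mono-≤ {1} {4} (s≤s z≤n) E>0) (s≤s z≤n)) (s≤s (z≤n {4})))}})
                            (≤-trans (≤-reflexive (e′ E (suc (2 * E)) κ N)) G-large) ⟩
        G              <⟨ m<m+n G G>0 ⟩
        G + G          ≡⟨ cong (G +_) (sym (+-identityʳ G)) ⟩
        2 * G          ≤⟨ m≤n*m (2 * G) κ ⟩
        κ * (2 * G)    ≡⟨ e″ κ G ⟩
        2 * κ * G      ∎
        where
        e′ : ∀ E a κ N → 4 * E * a * 5 * (E * κ * N) ≡ 4 * E * E * a * (5 * κ * N)
        e′ = solve-∀
        e″ : ∀ a G → a * (2 * G) ≡ 2 * a * G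
        e″ = solve-∀
        G>0 : 0 < G
        G>0 = <-≤-trans (*-mono-≤ {1} (*-mono-≤ {1} (*-mono-≤ {1} (*-mono-≤ {1} {4} (s≤s z≤n) E>0) E>0) (s≤s z≤n)) (*-mono-≤ {1} {5 * κ} (s≤s z≤n) N>0)) G-large

-- The quantifier over `T`, `c₀` and `M` comes after the scales `N` and `G`, which are thus chosen
-- once for all dilates.
Level : (k l E m N G : ℕ) → Set
Level k l E m N G = let κ = suc k + suc l in ∀ (T : ℕ → Bool) → SumFreeᵇ (suc k) (suc l) T → ∀ c₀ M →
  (E + 10 * κ) * N ≤ κ * E * ♯ N (λ c → does (c <? N) ∧ T (M * suc c)) →
  (E + 9 * κ) * G ≤ κ * E * ♯ G (λ x → does (x <? G) ∧ T (c₀ + M * x)) →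
  (∀ q → 0 < q → q ≤ 2 * E → 4 * E * E * suc (2 * E) * bad G m q (λ x → does (x <? G) ∧ T (c₀ + M * x)) ≤ G) →
  ⊥

level : ∀ k l E m C → l ≤ k → 2 * (suc k + suc l) ≤ E → 0 < E → 0 < m →
  Σ ℕ λ N → Σ ℕ λ G → E * m < N × C ≤ G × Level k l E m N G
level k l E m C l≤k 2κ≤E E>0 m>0 =
  let N , Δ , Em<N , Δ>0 , additive = additive-step κ E m 2κ≤E E>0 m>0
      B₀ = 4 * E * N + (4 * E * E * suc (2 * E) * (5 * κ * N) + C)
      B₀≤G : B₀ ≤ Δ * B₀
      B₀≤G = m≤n*m B₀ Δ {{>-nonZero Δ>0}}
      N>0 : 0 < N
      N>0 = ≤-<-trans z≤n Em<N
      G-large : 4 * E * E * suc (2 * E) * (5 * κ * N) ≤ Δ * B₀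
      G-large = ≤-trans (≤-trans (m≤m+n _ C) (m≤n+m _ (4 * E * N))) B₀≤G
  in N , Δ * B₀ , Em<N , ≤-trans (≤-trans (m≤n+m C _) (m≤n+m _ (4 * E * N))) B₀≤G ,
     λ T free c₀ M dR dA bA → Chain.contradiction k l E m N (Δ * B₀) c₀ M l≤k T free E>0 N>0
       (additive B₀ (≤-trans (m≤m+n _ _) B₀≤G)) G-large dR dA bA
  where
  κ : ℕ
  κ = suc k + suc l

-- The density increment along the levels.

∑-hits-lower : ∀ G ℓ D (A : ℕ → Bool) → ℓ * ♯ G A ≤ ∑ G (hits ℓ D A) + ℓ * (ℓ * D)
∑-hits-lower G ℓ D A = begin
  ℓ * ♯ G A                                               ≡⟨ sym (∑-const ℓ _) ⟩
  ∑ ℓ (λ _ → ♯ G A)                                       ≤⟨ ∑-mono ℓ row ⟩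
  ∑ ℓ (λ j → ∑ G (λ x → χ (A (x + j * D))) + ℓ * D)       ≡⟨ trans (∑-+ ℓ _ _) (cong₂ _+_ (∑-swap ℓ G _) (∑-const ℓ _)) ⟩
  ∑ G (hits ℓ D A) + ℓ * (ℓ * D)                          ∎
  where
  open ≤-Reasoning
  row : ∀ j → j < ℓ → ♯ G A ≤ ∑ G (λ x → χ (A (x + j * D))) + ℓ * D
  row j j<ℓ = ≤-trans (∑-shift-≥ G (j * D) (λ x → χ (A x)) (λ x → χ≤1 (A x)))
    (+-mono-≤ (≤-reflexive (∑-cong′ G (λ x → cong (λ z → χ (A z)) (+-comm (j * D) x)))) (*-monoˡ-≤ D (<⇒≤ j<ℓ)))

-- A progression of difference D and length ℓ lies in one of difference q ∣ D and length ≥ ℓ D.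
bad-coarser : ∀ G m q ℓ D (A : ℕ → Bool) → q ∣ D → 0 < D → ℓ * D ≤ m → bad G m q A ≤ bad G ℓ D A
bad-coarser G m q ℓ D A q∣D D>0 ℓD≤m = ∑-mono′ G λ x → χ₀-anti λ pos →
  let j , j<ℓ , pos′ = ∑-pos-witness ℓ _ pos
      d = _∣_.quotient q∣D
      D≡ = _∣_.equality q∣D
      j*d : j * D ≡ j * d * q
      j*d = trans (cong (j *_) D≡) (sym (*-assoc j d q))
      d≤D : d ≤ D
      d≤D = ≤-trans (m≤m*n d q {{≢-nonZero λ q≡0 → <⇒≢ D>0 (sym (trans D≡ (trans (cong (d *_) q≡0) (*-zeroʳ d))))}}) (≤-reflexive (sym D≡))
      jd<m : j * d < m
      jd<m = ≤-<-trans (*-monoʳ-≤ j d≤D) (<-≤-trans (*-monoˡ-< D {{>-nonZero D>0}} j<ℓ) ℓD≤m)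
  in <-≤-trans (subst (λ z → 0 < χ (A (x + z))) j*d pos′) (∑-term m (λ i → χ (A (x + i * q))) (j * d) jd<m)

-- A sequence of scales, each allowing the additive argument at resolution F times the previous one.
record Tower (k l E F C : ℕ) : Set where
  field
    L N : ℕ → ℕ
    L>0 : ∀ r → 0 < L r
    N-large : ∀ r → E * (F * L r) < N r
    L-large : ∀ r → C * (F * L r) ≤ L (suc r)
    rung : ∀ r → Level k l E (F * L r) (N r) (L (suc r))

tower : ∀ k l E F C → l ≤ k → 2 * (suc k + suc l) ≤ E → 0 < E → 0 < F → 0 < C → Tower k l E F C
tower k l E F C l≤k 2κ≤E E>0 F>0 C>0 = record
  { L = λ r → proj₁ (len r)
  ; N = λ r → proj₁ (next (len r))
  ; L>0 = λ r → proj₂ (len r)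
  ; N-large = λ r → proj₁ (proj₂ (proj₂ (next (len r))))
  ; L-large = λ r → proj₁ (proj₂ (proj₂ (proj₂ (next (len r)))))
  ; rung = λ r → proj₂ (proj₂ (proj₂ (proj₂ (next (len r)))))
  }
  where
  m>0 : (L : Σ ℕ (0 <_)) → 0 < F * proj₁ L
  m>0 (L , L>0) = *-mono-≤ {1} F>0 L>0
  next : (L : Σ ℕ (0 <_)) → Σ ℕ λ N → Σ ℕ λ G →
    E * (F * proj₁ L) < N × C * (F * proj₁ L) ≤ G × Level k l E (F * proj₁ L) N G
  next L = level k l E (F * proj₁ L) (C * (F * proj₁ L)) l≤k 2κ≤E E>0 (m>0 L)
  len : ℕ → Σ ℕ (0 <_)
  len zero    = 1 , z<s
  len (suc r) = proj₁ (proj₂ (next (len r))) ,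
    <-≤-trans (*-mono-≤ {1} C>0 (m>0 (len r))) (proj₁ (proj₂ (proj₂ (proj₂ (next (len r))))))

module Levels (k l E I : ℕ) (E>0 : 0 < E) where

  -- `F` is divisible by every q ≤ 2E. Densities of blocks are measured in steps of 1/Kτ, starting
  -- from a₁/Kτ = 1/κ + 9/E. The size of `w` makes a block that cannot gain one step regular enough
  -- for `Level`.
  κ F w Kτ a₁ : ℕ
  κ = suc k + suc l
  F = (2 * E) !
  w = 8 * E * suc (2 * E)
  Kτ = κ * E * w
  a₁ = (E + 9 * κ) * w

  F>0 : 0 < F
  F>0 = >-nonZero⁻¹ F {{(2 * E) !≢0}}

  w>0 : 0 < w
  w>0 = *-mono-≤ {1} (*-mono-≤ {1} {8} (s≤s z≤n) E>0) (s≤s z≤n)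

  Kτ>0 : 0 < Kτ
  Kτ>0 = *-mono-≤ {1} (*-mono-≤ {1} {κ} (s≤s z≤n) E>0) w>0

  Ew≤a₁ : E * w ≤ a₁
  Ew≤a₁ = *-monoˡ-≤ w (m≤m+n E (9 * κ))

  M : ℕ → ℕ
  M r = F ^ (I ∸ r)

  M-step : ∀ s r → s < r → r ≤ I → M s ≡ F ^ (r ∸ s) * M r
  M-step s r s<r r≤I = trans (cong (F ^_) ix) (^-distribˡ-+-* F (r ∸ s) (I ∸ r))
    where
    ix : I ∸ s ≡ (r ∸ s) + (I ∸ r)
    ix = +-cancelˡ-≡ s _ _ (trans (m+[n∸m]≡n (≤-trans (<⇒≤ s<r) r≤I))
      (sym (trans (sym (+-assoc s (r ∸ s) (I ∸ r))) (trans (cong (_+ (I ∸ r)) (m+[n∸m]≡n (<⇒≤ s<r))) (m+[n∸m]≡n r≤I)))))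

  module _ (τ : Tower k l E F Kτ) (T : ℕ → Bool) (free : SumFreeᵇ (suc k) (suc l) T) where

    open Tower τ

    R : ℕ → ℕ → Bool
    R r c = does (c <? N r) ∧ T (M r * suc c)

    A : ℕ → ℕ → ℕ → Bool
    A r c₀ x = does (x <? L (suc r)) ∧ T (c₀ + M r * x)

    dense? : ∀ r → Dec ((E + 10 * κ) * N r ≤ κ * E * ♯ (N r) (R r))
    dense? r = (E + 10 * κ) * N r ≤? κ * E * ♯ (N r) (R r)

    dense : ℕ → Bool
    dense r = does (dense? r)

    #dense : ℕ → ℕ
    #dense s = ♯ s dense

    ratio : ℕ → ℕ → ℕ
    ratio s r = F ^ (r ∸ s)

    ratio>0 : ∀ s r → 0 < ratio s r
    ratio>0 s r = m^n>0 F {{>-nonZero F>0}} (r ∸ s)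

    L-chain : ∀ s n → L s * F ^ n ≤ L (n + s)
    L-chain s zero    = ≤-reflexive (*-identityʳ (L s))
    L-chain s (suc n) = begin
      L s * (F * F ^ n)        ≡⟨ e (L s) F (F ^ n) ⟩
      F * (L s * F ^ n)        ≤⟨ *-monoʳ-≤ F (L-chain s n) ⟩
      F * L (n + s)            ≤⟨ m≤n*m _ Kτ {{>-nonZero Kτ>0}} ⟩
      Kτ * (F * L (n + s))     ≤⟨ L-large (n + s) ⟩
      L (suc (n + s))          ∎
      where
      open ≤-Reasoning
      e : ∀ a b c → a * (b * c) ≡ b * (a * c)
      e = solve-∀

    -- The reason for the resolution `F * L r`: in the coordinates of level r, a block of level s <
    -- r fits into a progression of that length, so a missed progression contains a missed block.
    coarse-fits : ∀ s r → s < r → L (suc s) * ratio s r ≤ F * L r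
    coarse-fits s r s<r = begin
      L (suc s) * F ^ (r ∸ s)              ≡⟨ cong (λ z → L (suc s) * F ^ z) r∸s ⟩
      L (suc s) * (F * F ^ (r ∸ suc s))    ≡⟨ e (L (suc s)) F (F ^ (r ∸ suc s)) ⟩
      F * (L (suc s) * F ^ (r ∸ suc s))    ≤⟨ *-monoʳ-≤ F (L-chain (suc s) (r ∸ suc s)) ⟩
      F * L (r ∸ suc s + suc s)            ≡⟨ cong (λ z → F * L z) (m∸n+n≡m s<r) ⟩
      F * L r                              ∎
      where
      open ≤-Reasoning
      e : ∀ a b c → a * (b * c) ≡ b * (a * c)
      e = solve-∀
      r∸s : r ∸ s ≡ suc (r ∸ suc s)
      r∸s = +-cancelˡ-≡ s _ _ (trans (m+[n∸m]≡n (<⇒≤ s<r)) (sym (trans (+-suc s (r ∸ suc s)) (m+[n∸m]≡n s<r))))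

    q∣ratio : ∀ s r q → s < r → 0 < q → q ≤ 2 * E → q ∣ ratio s r
    q∣ratio s r (suc q) s<r _ q≤ = ∣-trans (∣-trans (m∣m*n (q !)) (m≤n⇒m!∣n! q≤))
      (subst (λ n → F ∣ F ^ n) (suc-pred (r ∸ s) {{>-nonZero (m<n⇒0<n∸m s<r)}}) (m∣m*n (F ^ pred (r ∸ s))))

    hits≤ : ∀ s r → s < r → r ≤ I → ∀ c₀ x (B : ℕ → Bool) → (∀ y → B y ≡ true → T (c₀ + M r * y) ≡ true) →
      hits (L (suc s)) (ratio s r) B x ≤ ♯ (L (suc s)) (A s (c₀ + M r * x))
    hits≤ s r s<r r≤I c₀ x B B⊆T = ∑-mono (L (suc s)) pt
      where
      pt : ∀ j → j < L (suc s) → χ (B (x + j * ratio s r)) ≤ χ (A s (c₀ + M r * x) j)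
      pt j j< with bool-case (B (x + j * ratio s r))
      ... | inj₂ f = ≤-trans (≤-reflexive (cong χ f)) z≤n
      ... | inj₁ t = ≤-trans (χ≤1 _) (≤-reflexive (sym (χ-true (∧-dec-intro (j <? L (suc s)) j<
              (trans (cong T ix) (B⊆T _ t))))))
        where
        ix : c₀ + M r * x + M s * j ≡ c₀ + M r * (x + j * ratio s r)
        ix = trans (cong (λ z → c₀ + M r * x + z * j) (M-step s r s<r r≤I)) (e c₀ (M r) x (ratio s r) j)
          where
          e : ∀ c M x d j → c + M * x + d * M * j ≡ c + M * (x + j * d)
          e = solve-∀

    -- A block that misses many progressions would be denser by 1/Kτ on one of those it meets.
    block-clash : ∀ s r → s < r → r ≤ I → dense r ≡ true → ∀ c₀ a → a₁ ≤ a →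
      a * L (suc r) ≤ Kτ * ♯ (L (suc r)) (A r c₀) →
      (∀ x → x < L (suc r) → ¬ suc a * L (suc s) ≤ Kτ * ♯ (L (suc s)) (A s (c₀ + M r * x))) → ⊥
    block-clash s r s<r r≤I dr c₀ a a₁≤a block none =
      rung r T free c₀ (M r) (does-true (dense? r) dr) A-dense A-bad
      where
      open ≤-Reasoning
      G ℓ D b : ℕ
      G = L (suc r)
      ℓ = L (suc s)
      D = ratio s r
      B : ℕ → Bool
      B = A r c₀
      b = bad G ℓ D B
      A-dense : (E + 9 * κ) * G ≤ κ * E * ♯ G B
      A-dense = *-cancelʳ-≤ _ _ w {{>-nonZero w>0}} (begin
        (E + 9 * κ) * G * w   ≡⟨ e (E + 9 * κ) G w ⟩
        a₁ * G                ≤⟨ *-monoˡ-≤ G a₁≤a ⟩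
        a * G                 ≤⟨ block ⟩
        Kτ * ♯ G B            ≡⟨ e (κ * E) w (♯ G B) ⟩
        κ * E * ♯ G B * w     ∎)
        where
        e : ∀ a b c → a * b * c ≡ a * c * b
        e = solve-∀
      pt : ∀ x → x < G → Kτ * hits ℓ D B x + suc a * ℓ * χ₀ (hits ℓ D B x) ≤ suc a * ℓ
      pt x x<G with hits ℓ D B x in eq
      ... | zero  = ≤-reflexive (trans (cong₂ _+_ (*-zeroʳ Kτ) (*-identityʳ (suc a * ℓ))) refl)
      ... | suc n = ≤-trans (≤-reflexive (trans (cong (Kτ * suc n +_) (*-zeroʳ (suc a * ℓ))) (+-identityʳ _)))
        (<⇒≤ (≤-<-trans (*-monoʳ-≤ Kτ (≤-trans (≤-reflexive (sym eq))
          (hits≤ s r s<r r≤I c₀ x B (λ y By → proj₂ (∧-dec-elim (y <? L (suc r)) By)))))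
          (≰⇒> (none x x<G))))
      summed : Kτ * ∑ G (hits ℓ D B) + suc a * ℓ * b ≤ G * (suc a * ℓ)
      summed = ≤-trans (≤-reflexive (sym (trans (∑-+ G _ _) (cong₂ _+_ (∑-*ˡ G Kτ _) (∑-*ˡ G (suc a * ℓ) _)))))
        (∑-bound G (suc a * ℓ) pt)
      -- The cap (a + 1)/Kτ on a block exceeds the average only by 1/Kτ, up to boundary, while every
      -- missed block falls short of it by all of (a + 1)/Kτ.
      b-small : suc a * b ≤ G + Kτ * (ℓ * D)
      b-small = *-cancelˡ-≤ ℓ {{>-nonZero (L>0 (suc s))}} (≤-by
        (Kτ * ∑ G (hits ℓ D B) + suc a * ℓ * b + Kτ * (ℓ * ♯ G B) + ℓ * (a * G))
        (G * (suc a * ℓ) + Kτ * (∑ G (hits ℓ D B) + ℓ * (ℓ * D)) + ℓ * (Kτ * ♯ G B))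
        (+-mono-≤ (+-mono-≤ summed (*-monoʳ-≤ Kτ (∑-hits-lower G ℓ D B))) (*-monoʳ-≤ ℓ block))
        (e a ℓ b G Kτ D (∑ G (hits ℓ D B)) (♯ G B)))
        where
        e : ∀ a ℓ b G K D h s → ℓ * ((1 + a) * b) + (G * ((1 + a) * ℓ) + K * (h + ℓ * (ℓ * D)) + ℓ * (K * s))
          ≡ ℓ * (G + K * (ℓ * D)) + (K * h + (1 + a) * ℓ * b + K * (ℓ * s) + ℓ * (a * G))
        e = solve-∀
      A-bad : ∀ q → 0 < q → q ≤ 2 * E → 4 * E * E * suc (2 * E) * bad G (F * L r) q B ≤ G
      A-bad q q>0 q≤ = *-cancelˡ-≤ 2 (begin
        2 * (4 * E * E * suc (2 * E) * bad G (F * L r) q B)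
          ≤⟨ *-monoʳ-≤ 2 (*-monoʳ-≤ (4 * E * E * suc (2 * E))
               (bad-coarser G (F * L r) q ℓ D B (q∣ratio s r q s<r q>0 q≤) (ratio>0 s r) (coarse-fits s r s<r))) ⟩
        2 * (4 * E * E * suc (2 * E) * b)
          ≡⟨ e E (suc (2 * E)) b ⟩
        E * w * b
          ≤⟨ *-monoˡ-≤ b (≤-trans Ew≤a₁ (≤-trans a₁≤a (n≤1+n a))) ⟩
        suc a * b
          ≤⟨ b-small ⟩
        G + Kτ * (ℓ * D)
          ≤⟨ +-monoʳ-≤ G (≤-trans (*-monoʳ-≤ Kτ (coarse-fits s r s<r)) (L-large r)) ⟩
        G + G
          ≡⟨ cong (G +_) (sym (+-identityʳ G)) ⟩
        2 * G ∎)
        where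
        e : ∀ E c b → 2 * (4 * E * E * c * b) ≡ E * (8 * E * c) * b
        e = solve-∀

    ♯-suc : ∀ s → #dense (suc s) ≡ #dense s + χ (dense s)
    ♯-suc s = ∑-last s (λ r → χ (dense r))

    -- On the way down, each dense level lets the block be replaced by one of that level denser by
    -- 1/Kτ, since `block-clash` excludes the alternative. No density exceeds 1, so `a` stays at
    -- most `Kτ`.
    climb : ∀ s r → s ≤ r → r ≤ I → dense r ≡ true → ∀ c₀ a → a₁ ≤ a →
      a * L (suc r) ≤ Kτ * ♯ (L (suc r)) (A r c₀) → #dense s + a ≤ Kτ
    climb zero r _ _ _ c₀ a _ block = *-cancelʳ-≤ a Kτ (L (suc r)) {{>-nonZero (L>0 (suc r))}}
      (≤-trans block (*-monoʳ-≤ Kτ (♯≤ (L (suc r)) (A r c₀))))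
    climb (suc s) r s<r r≤I dr c₀ a a₁≤a block with bool-case (dense s)
    ... | inj₂ ds = ≤-trans (≤-reflexive (cong (_+ a) (trans (♯-suc s) (trans (cong (λ z → #dense s + χ z) ds) (+-identityʳ _)))))
            (climb s r (<⇒≤ s<r) r≤I dr c₀ a a₁≤a block)
    ... | inj₁ ds with search (λ x → suc a * L (suc s) ≤? Kτ * ♯ (L (suc s)) (A s (c₀ + M r * x))) (L (suc r))
    ...   | inj₁ (x , _ , denser) = ≤-trans (≤-reflexive (trans (cong (_+ a) (trans (♯-suc s) (cong (λ z → #dense s + χ z) ds)))
              (+-assoc (#dense s) 1 a)))
            (climb s s ≤-refl (≤-trans (<⇒≤ s<r) r≤I) ds (c₀ + M r * x) (suc a) (m≤n⇒m≤1+n a₁≤a) denser)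
    ...   | inj₂ none = ⊥-elim (block-clash s r s<r r≤I dr c₀ a a₁≤a block none)

    -- Averaging over the blocks of level s along `R` at level r. `N-large` keeps the boundary below
    -- a 1/E part, hence the loss from 10/E to 9/E.
    first-block : ∀ s r → s < r → r ≤ I → dense r ≡ true →
      Σ ℕ λ c₀ → a₁ * L (suc s) ≤ Kτ * ♯ (L (suc s)) (A s c₀)
    first-block s r s<r r≤I dr
      with search (λ x → a₁ * L (suc s) ≤? Kτ * ♯ (L (suc s)) (A s (M r + M r * x))) (N r)
    ... | inj₁ (x , _ , ok) = M r + M r * x , ok
    ... | inj₂ none = ⊥-elim (<⇒≱ (N-large r) (*-cancelˡ-≤ (κ * w) {{>-nonZero (*-mono-≤ {1} {κ} (s≤s z≤n) w>0)}} N-small))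
      where
      ℓ D h : ℕ
      ℓ = L (suc s)
      D = ratio s r
      h = ∑ (N r) (hits ℓ D (R r))
      summed : Kτ * h ≤ N r * (a₁ * ℓ)
      summed = ≤-trans (≤-reflexive (sym (∑-*ˡ (N r) Kτ _))) (∑-bound (N r) (a₁ * ℓ) (λ x x< →
        ≤-trans (*-monoʳ-≤ Kτ (hits≤ s r s<r r≤I (M r) x (R r) (λ y Ry →
            trans (cong T (sym (*-suc (M r) y))) (proj₂ (∧-dec-elim (y <? N r) Ry)))))
          (<⇒≤ (≰⇒> (none x x<)))))
      N-small : κ * w * N r ≤ κ * w * (E * (F * L r))
      N-small = *-cancelˡ-≤ ℓ {{>-nonZero (L>0 (suc s))}} (≤-by
        (Kτ * h + Kτ * (ℓ * ♯ (N r) (R r)) + ℓ * w * ((E + 10 * κ) * N r) + Kτ * ℓ * (ℓ * D))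
        (N r * (a₁ * ℓ) + Kτ * (h + ℓ * (ℓ * D)) + ℓ * w * (κ * E * ♯ (N r) (R r)) + Kτ * ℓ * (F * L r))
        (+-mono-≤ (+-mono-≤ (+-mono-≤ summed (*-monoʳ-≤ Kτ (∑-hits-lower (N r) ℓ D (R r))))
          (*-monoʳ-≤ (ℓ * w) (does-true (dense? r) dr))) (*-monoʳ-≤ (Kτ * ℓ) (coarse-fits s r s<r)))
        (e κ w E ℓ (N r) h (♯ (N r) (R r)) (ℓ * D) (F * L r)))
        where
        e : ∀ κ w E ℓ N h r d m → ℓ * (κ * w * N) + (N * ((E + 9 * κ) * w * ℓ) + κ * E * w * (h + ℓ * d) + ℓ * w * (κ * E * r) + κ * E * w * ℓ * m)
          ≡ ℓ * (κ * w * (E * m)) + (κ * E * w * h + κ * E * w * (ℓ * r) + ℓ * w * ((E + 10 * κ) * N) + κ * E * w * ℓ * d)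
        e = solve-∀

    below-dense : ∀ s r → s ≤ r → r ≤ I → dense r ≡ true → #dense s ≤ suc Kτ
    below-dense zero r _ _ _ = z≤n
    below-dense (suc s) r s<r r≤I dr with bool-case (dense s)
    ... | inj₂ ds = ≤-trans (≤-reflexive (trans (♯-suc s) (trans (cong (λ z → #dense s + χ z) ds) (+-identityʳ _))))
            (below-dense s r (<⇒≤ s<r) r≤I dr)
    ... | inj₁ ds = let c₀ , block = first-block s r s<r r≤I dr in
            ≤-trans (≤-reflexive (trans (♯-suc s) (trans (cong (λ z → #dense s + χ z) ds) (+-comm _ 1))))
              (s≤s (≤-trans (m≤m+n _ a₁) (climb s s ≤-refl (≤-trans (<⇒≤ s<r) r≤I) ds c₀ a₁ ≤-refl block)))

    -- The highest dense level supplies `R` for `first-block`, and the next one the block from which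
    -- `climb` starts. These two account for the 2.
    few-dense : ∀ s → s ≤ I → #dense s ≤ 2 + Kτ
    few-dense zero    _   = z≤n
    few-dense (suc s) s<I with bool-case (dense s)
    ... | inj₂ ds = ≤-trans (≤-reflexive (trans (♯-suc s) (trans (cong (λ z → #dense s + χ z) ds) (+-identityʳ _))))
            (few-dense s (<⇒≤ s<I))
    ... | inj₁ ds = ≤-trans (≤-reflexive (trans (♯-suc s) (trans (cong (λ z → #dense s + χ z) ds) (+-comm _ 1))))
            (s≤s (below-dense s s ≤-refl (<⇒≤ s<I) ds))

-- Multiplicative Følner sets.

unique-⊆-length : ∀ {xs ys : List ℕ} → Unique xs → xs ⊆ ys → length xs ≤ length ys
unique-⊆-length {[]}     _          _   = z≤n
unique-⊆-length {x ∷ xs} (x∉ ∷ uxs) sub with ∈-∃++ (sub (here refl))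
... | ys , zs , refl = ≤-trans (s≤s (unique-⊆-length uxs rest)) (≤-reflexive (begin
    suc (length (ys ++ zs))           ≡⟨ cong suc (length-++ ys) ⟩
    suc (length ys + length zs)       ≡⟨ sym (+-suc (length ys) (length zs)) ⟩
    length ys + length (x ∷ zs)       ≡⟨ sym (length-++ ys) ⟩
    length (ys ++ x ∷ zs)             ∎))
  where
  open ≡-Reasoning
  rest : xs ⊆ ys ++ zs
  rest {y} y∈ with ∈-++⁻ ys (sub (there y∈))
  ... | inj₁ p          = ∈-++⁺ˡ p
  ... | inj₂ (here y≡x) = ⊥-elim (All.lookup x∉ y∈ (sym y≡x))
  ... | inj₂ (there p)  = ∈-++⁺ʳ ys p

∑ˡ : List ℕ → (ℕ → ℕ) → ℕ
∑ˡ []       f = 0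
∑ˡ (x ∷ xs) f = f x + ∑ˡ xs f

∑ˡ-mono : ∀ xs {f g : ℕ → ℕ} → (∀ x → f x ≤ g x) → ∑ˡ xs f ≤ ∑ˡ xs g
∑ˡ-mono []       h = z≤n
∑ˡ-mono (x ∷ xs) h = +-mono-≤ (h x) (∑ˡ-mono xs h)

∑ˡ-+ : ∀ xs (f g : ℕ → ℕ) → ∑ˡ xs (λ x → f x + g x) ≡ ∑ˡ xs f + ∑ˡ xs g
∑ˡ-+ []       f g = refl
∑ˡ-+ (x ∷ xs) f g = trans (cong (f x + g x +_) (∑ˡ-+ xs f g)) (e (f x) (g x) _ _)
  where
  e : ∀ a b c d → a + b + (c + d) ≡ a + c + (b + d)
  e = solve-∀

∑ˡ-*ˡ : ∀ xs c (f : ℕ → ℕ) → ∑ˡ xs (λ x → c * f x) ≡ c * ∑ˡ xs f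
∑ˡ-*ˡ []       c f = sym (*-zeroʳ c)
∑ˡ-*ˡ (x ∷ xs) c f = trans (cong (c * f x +_) (∑ˡ-*ˡ xs c f)) (sym (*-distribˡ-+ c (f x) _))

∑ˡ-const : ∀ xs c → ∑ˡ xs (λ _ → c) ≡ length xs * c
∑ˡ-const []       c = refl
∑ˡ-const (x ∷ xs) c = cong (c +_) (∑ˡ-const xs c)

∑-∑ˡ : ∀ n xs (f : ℕ → ℕ → ℕ) → ∑ n (λ i → ∑ˡ xs (f i)) ≡ ∑ˡ xs (λ x → ∑ n (λ i → f i x))
∑-∑ˡ n []       f = ∑-zero n
∑-∑ˡ n (x ∷ xs) f = trans (∑-+ n _ _) (cong (∑ n (λ i → f i x) +_) (∑-∑ˡ n xs f))

length-filter-¬ : ∀ {P : ℕ → Set} (P? : ∀ x → Dec (P x)) xs →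
  length (filter (λ x → ¬? (P? x)) xs) + ∑ˡ xs (λ x → χ (does (P? x))) ≡ length xs
length-filter-¬ P? [] = refl
length-filter-¬ P? (x ∷ xs) with P? x
... | yes _ = trans (+-suc _ _) (cong suc (length-filter-¬ P? xs))
... | no _  = cong suc (length-filter-¬ P? xs)

-- Inclusion and exclusion in `W`: the dilates by `n` of those elements of `X` that do not land in
-- `S` are disjoint from `S`.
dilate-count : ∀ n (S X W : List ℕ) → 0 < n → Unique S → Unique X → S ⊆ W → (∀ {x} → x ∈ X → n * x ∈ W) →
  length S + length X ≤ length W + ∑ˡ X (λ x → χ (does (n * x ∈? S)))
dilate-count n S X W n>0 uS uX S⊆W nX⊆W = begin
  length S + length X
    ≡⟨ cong (length S +_) (sym (length-filter-¬ P? X)) ⟩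
  length S + (length X′ + c)
    ≡⟨ sym (+-assoc (length S) (length X′) c) ⟩
  length S + length X′ + c
    ≡⟨ cong (_+ c) (trans (cong (length S +_) (sym (length-map (n *_) X′))) (sym (length-++ S))) ⟩
  length (S ++ map (n *_) X′) + c
    ≤⟨ +-monoˡ-≤ c (unique-⊆-length uniq sub) ⟩
  length W + c ∎
  where
  open ≤-Reasoning
  P? : ∀ x → Dec (n * x ∈ S)
  P? x = n * x ∈? S
  X′ : List ℕ
  X′ = filter (λ x → ¬? (P? x)) X
  c : ℕ
  c = ∑ˡ X (λ x → χ (does (P? x)))
  uniq : Unique (S ++ map (n *_) X′)
  uniq = Uniqueₚ.++⁺ uS (Uniqueₚ.map⁺ (λ {x} {y} → *-cancelˡ-≡ x y n {{>-nonZero n>0}}) (Uniqueₚ.filter⁺ (λ x → ¬? (P? x)) uX))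
    λ { (v∈S , v∈) → let x , x∈ , v≡ = ∈-map⁻ (n *_) v∈ in
        proj₂ (∈-filter⁻ (λ x → ¬? (P? x)) {xs = X} x∈) (subst (_∈ S) v≡ v∈S) }
  sub : S ++ map (n *_) X′ ⊆ W
  sub v∈ with ∈-++⁻ S v∈
  ... | inj₁ p = S⊆W p
  ... | inj₂ q = let x , x∈ , v≡ = ∈-map⁻ (n *_) q in
    subst (_∈ W) (sym v≡) (nX⊆W (proj₁ (∈-filter⁻ (λ x → ¬? (P? x)) {xs = X} x∈)))

-- Products of powers of 1, ..., Λ with exponents at most `e`. Dilation by n ≤ Λ raises one exponent
-- by one. Different exponents may give equal products, so `ball` removes duplicates; only the
-- polynomial bound on the size matters.
products : ℕ → ℕ → List ℕ
products zero    e = 1 ∷ []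
products (suc Λ) e = cartesianProductWith (λ a i → a * suc Λ ^ i) (products Λ e) (upTo (suc e))

length-product : ∀ (f : ℕ → ℕ → ℕ) xs ys → length (cartesianProductWith f xs ys) ≡ length xs * length ys
length-product f []       ys = refl
length-product f (x ∷ xs) ys = trans (length-++ (map (f x) ys)) (cong₂ _+_ (length-map (f x) ys) (length-product f xs ys))

length-products : ∀ Λ e → length (products Λ e) ≡ suc e ^ Λ
length-products zero    e = refl
length-products (suc Λ) e = trans (length-product _ (products Λ e) (upTo (suc e)))
  (trans (cong₂ _*_ (length-products Λ e) (length-upTo (suc e))) (*-comm (suc e ^ Λ) (suc e)))

products-mono : ∀ Λ e {x} → x ∈ products Λ e → x ∈ products Λ (suc e)
products-mono zero    e x∈ = x∈
products-mono (suc Λ) e x∈ with ∈-cartesianProductWith⁻ (λ a i → a * suc Λ ^ i) (products Λ e) (upTo (suc e)) x∈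
... | a , i , a∈ , i∈ , refl = ∈-cartesianProductWith⁺ (λ a i → a * suc Λ ^ i) (products-mono Λ e a∈)
  (∈-upTo⁺ (m≤n⇒m≤1+n (∈-upTo⁻ i∈)))

products-dilate : ∀ Λ e n → 0 < n → n ≤ Λ → ∀ {x} → x ∈ products Λ e → n * x ∈ products Λ (suc e)
products-dilate zero e (suc n) _ ()
products-dilate (suc Λ) e n n>0 n≤ x∈
  with ∈-cartesianProductWith⁻ (λ a i → a * suc Λ ^ i) (products Λ e) (upTo (suc e)) x∈ | m≤n⇒m<n∨m≡n n≤
... | a , i , a∈ , i∈ , refl | inj₁ n< = subst (_∈ products (suc Λ) (suc e)) (*-assoc n a (suc Λ ^ i))
  (∈-cartesianProductWith⁺ (λ a i → a * suc Λ ^ i) (products-dilate Λ e n n>0 (s≤s⁻¹ n<) a∈) (∈-upTo⁺ (m≤n⇒m≤1+n (∈-upTo⁻ i∈))))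
... | a , i , a∈ , i∈ , refl | inj₂ refl = subst (_∈ products (suc Λ) (suc e)) (eq a (suc Λ) (suc Λ ^ i))
  (∈-cartesianProductWith⁺ (λ a i → a * suc Λ ^ i) (products-mono Λ e a∈) (∈-upTo⁺ (s≤s (∈-upTo⁻ i∈))))
  where
  eq : ∀ a b c → a * (b * c) ≡ b * (a * c)
  eq = solve-∀

products-pos : ∀ Λ e {x} → x ∈ products Λ e → 0 < x
products-pos zero    e (here refl) = z<s
products-pos (suc Λ) e x∈ with ∈-cartesianProductWith⁻ (λ a i → a * suc Λ ^ i) (products Λ e) (upTo (suc e)) x∈
... | a , i , a∈ , _ , refl = *-mono-≤ {1} (products-pos Λ e a∈) (m^n>0 (suc Λ) i)

one∈products : ∀ Λ e → 1 ∈ products Λ e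
one∈products zero    e = here refl
one∈products (suc Λ) e = ∈-cartesianProductWith⁺ (λ a i → a * suc Λ ^ i) (one∈products Λ e) (∈-upTo⁺ {suc e} {0} z<s)

ball : ℕ → ℕ → List ℕ
ball Λ e = deduplicate _≟_ (products Λ e)

ball-unique : ∀ Λ e → Unique (ball Λ e)
ball-unique Λ e = deduplicate-! (products Λ e)

ball-∈⁻ : ∀ Λ e {x} → x ∈ ball Λ e → x ∈ products Λ e
ball-∈⁻ Λ e = ∈-deduplicate⁻ _≟_ (products Λ e)

ball-dilate : ∀ Λ e n → 0 < n → n ≤ Λ → ∀ {x} → x ∈ ball Λ e → n * x ∈ ball Λ (suc e)
ball-dilate Λ e n n>0 n≤ x∈ = ∈-deduplicate⁺ _≟_ (products-dilate Λ e n n>0 n≤ (ball-∈⁻ Λ e x∈))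

ball-size : ∀ Λ e → length (ball Λ e) ≤ suc e ^ Λ
ball-size Λ e = ≤-trans (unique-⊆-length (ball-unique Λ e) (ball-∈⁻ Λ e)) (≤-reflexive (length-products Λ e))

ball-nonempty : ∀ Λ e → 0 < length (ball Λ e)
ball-nonempty Λ e = nonempty (∈-deduplicate⁺ _≟_ (one∈products Λ e))
  where
  nonempty : ∀ {x} {xs : List ℕ} → x ∈ xs → 0 < length xs
  nonempty (here _)  = z<s
  nonempty (there _) = z<s

n<2^n : ∀ n → n < 2 ^ n
n<2^n zero    = z<s
n<2^n (suc n) = ≤-trans (s≤s (n<2^n n)) (≤-trans (+-monoˡ-≤ (2 ^ n) (m^n>0 2 n)) (≤-reflexive (cong (2 ^ n +_) (sym (+-identityʳ (2 ^ n))))))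

power-beats-linear : ∀ h Λ → Σ ℕ λ s → (h + s) * Λ < 2 ^ s
power-beats-linear h Λ = u + u , (begin-strict
  (h + (u + u)) * Λ      ≤⟨ *-monoˡ-≤ Λ (+-monoˡ-≤ (u + u) (m≤m+n h (3 * Λ))) ⟩
  (u + (u + u)) * Λ      ≡⟨ e₁ u Λ ⟩
  u * (3 * Λ)            ≤⟨ *-monoʳ-≤ u (m≤n+m (3 * Λ) h) ⟩
  u * u                  <⟨ *-mono-< (n<2^n u) (n<2^n u) ⟩
  2 ^ u * 2 ^ u          ≡⟨ sym (^-distribˡ-+-* 2 u u) ⟩
  2 ^ (u + u)            ∎)
  where
  open ≤-Reasoning
  u : ℕ
  u = h + 3 * Λ
  e₁ : ∀ u L → (u + (u + u)) * L ≡ u * (3 * L)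
  e₁ = solve-∀

-- Taking t to be a power `2 ^ s` makes both sides comparable to powers of two, with exponents that
-- `power-beats-linear` compares.
power-beats-polynomial : ∀ h Λ → Σ ℕ λ t → suc (h * t) ^ Λ < 2 ^ t
power-beats-polynomial h Λ = let s , lt = power-beats-linear h Λ in 2 ^ s , (begin-strict
  suc (h * 2 ^ s) ^ Λ      ≤⟨ ^-monoˡ-≤ Λ (≤-trans (+-monoˡ-≤ (h * 2 ^ s) (m^n>0 2 s)) (*-monoˡ-≤ (2 ^ s) (n<2^n h))) ⟩
  (2 ^ h * 2 ^ s) ^ Λ      ≡⟨ cong (_^ Λ) (sym (^-distribˡ-+-* 2 h s)) ⟩
  (2 ^ (h + s)) ^ Λ        ≡⟨ ^-*-assoc 2 (h + s) Λ ⟩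
  2 ^ ((h + s) * Λ)        <⟨ ^-monoʳ-< 2 (s≤s (s≤s z≤n)) lt ⟩
  2 ^ (2 ^ s)              ∎)
  where open ≤-Reasoning

exponential-beats-polynomial : ∀ δ .{{_ : NonZero δ}} Λ → Σ ℕ λ n → δ ^ n * suc n ^ Λ < suc δ ^ n
exponential-beats-polynomial δ Λ =
  let h , dbl = large-power 2 δ
      t , lt = power-beats-polynomial h Λ
  in h * t , (begin-strict
    δ ^ (h * t) * suc (h * t) ^ Λ   ≡⟨ cong (_* suc (h * t) ^ Λ) (sym (^-*-assoc δ h t)) ⟩
    (δ ^ h) ^ t * suc (h * t) ^ Λ   <⟨ *-monoʳ-< ((δ ^ h) ^ t) {{m^n≢0 (δ ^ h) t {{m^n≢0 δ h}}}} lt ⟩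
    (δ ^ h) ^ t * 2 ^ t             ≡⟨ trans (*-comm ((δ ^ h) ^ t) (2 ^ t)) (sym (pow-* 2 (δ ^ h) t)) ⟩
    (2 * δ ^ h) ^ t                 ≤⟨ ^-monoˡ-≤ t dbl ⟩
    (suc δ ^ h) ^ t                 ≡⟨ ^-*-assoc (suc δ) h t ⟩
    suc δ ^ (h * t)                 ∎)
  where open ≤-Reasoning

-- Growth by a factor above 1 + 1/δ at every step would be exponential, against the polynomial
-- bound.
slow-growth : ∀ δ .{{_ : NonZero δ}} Λ (f : ℕ → ℕ) → 0 < f 0 → (∀ e → f e ≤ suc e ^ Λ) →
  Σ ℕ λ e → δ * f (suc e) ≤ suc δ * f e
slow-growth δ Λ f f>0 poly with exponential-beats-polynomial δ Λ
... | n , lt with search (λ e → δ * f (suc e) ≤? suc δ * f e) n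
...   | inj₁ (e , _ , ok) = e , ok
...   | inj₂ none = ⊥-elim (<⇒≱ lt (≤-trans (grow n ≤-refl) (*-monoʳ-≤ (δ ^ n) (poly n))))
  where
  open ≤-Reasoning
  grow : ∀ e → e ≤ n → suc δ ^ e ≤ δ ^ e * f e
  grow zero    _   = ≤-trans f>0 (≤-reflexive (sym (+-identityʳ (f 0))))
  grow (suc e) e<n = begin
    suc δ * suc δ ^ e         ≤⟨ *-monoʳ-≤ (suc δ) (grow e (<⇒≤ e<n)) ⟩
    suc δ * (δ ^ e * f e)     ≡⟨ e₁ (suc δ) (δ ^ e) (f e) ⟩
    δ ^ e * (suc δ * f e)     ≤⟨ *-monoʳ-≤ (δ ^ e) (<⇒≤ (≰⇒> (none e e<n))) ⟩
    δ ^ e * (δ * f (suc e))   ≡⟨ e₂ (δ ^ e) δ (f (suc e)) ⟩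
    δ * δ ^ e * f (suc e)     ∎
    where
    e₁ : ∀ a b c → a * (b * c) ≡ b * (a * c)
    e₁ = solve-∀
    e₂ : ∀ a b c → a * (b * c) ≡ b * a * c
    e₂ = solve-∀

-- Averaging over dilates: a finite set with small sum-free subsets.

sumF-* : ∀ {n} (x : Fin n → ℕ) c → sumF (λ i → x i * c) ≡ sumF x * c
sumF-* {zero}  x c = refl
sumF-* {suc n} x c = trans (cong (x zero * c +_) (sumF-* (λ i → x (suc i)) c)) (sym (*-distribʳ-+ c (x zero) _))

dilation-free : ∀ {k l S} → SumFree k l S → ∀ c → SumFreeᵇ k l (λ n → does (n * c ∈? S))
dilation-free free c x y Tx Ty eq = free (λ i → x i * c) (λ j → y j * c)
  (λ i → does-true (x i * c ∈? _) (Tx i)) (λ j → does-true (y j * c ∈? _) (Ty j))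
  (trans (sumF-* x c) (trans (cong (_* c) eq) (sym (sumF-* y c))))

-- The excess 1/(2d) is shared by three errors of at most 1/(6d): the dense levels, J₀/I; the growth
-- of the ball; and 10/E = 1/(6dκ).
final-arithmetic : ∀ d κ J₀ s X W → 0 < d → 0 < κ → 0 < J₀ → let E = 60 * d * κ in
  6 * d * J₀ * (κ * E * (s + X)) ≤ 6 * d * J₀ * (κ * E * W + (E + 10 * κ) * X) + κ * E * (J₀ * X) →
  6 * d * W ≤ suc (6 * d) * X → X ≤ W → 2 * d * κ * s ≤ (2 * d + κ) * W
final-arithmetic d κ J₀ s X W d>0 κ>0 J₀>0 h₁ h₂ X≤W = ≤-trans
  (*-cancelˡ-≤ 3 (*-cancelˡ-≤ E {{>-nonZero E>0}} (≤-by
    (6 * d * (κ * E * (s + X)) + κ * E * (6 * d * W) + 60 * d * κ * X)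
    (6 * d * (κ * E * W + (E + 10 * κ) * X) + κ * E * X + κ * E * (suc (6 * d) * X) + E * κ * X)
    (+-mono-≤ (+-mono-≤ (*-cancelˡ-≤ J₀ {{>-nonZero J₀>0}} (≤-by _ _ h₁ (e₀ d κ J₀ s X W E))) (*-monoʳ-≤ (κ * E) h₂))
      (*-monoˡ-≤ X (m≤m*n (60 * d * κ) κ {{>-nonZero κ>0}})))
    (e d κ E s X W))))
  (*-monoʳ-≤ (2 * d + κ) X≤W)
  where
  E : ℕ
  E = 60 * d * κ
  E>0 : 0 < E
  E>0 = *-mono-≤ {1} (*-mono-≤ {1} {60} (s≤s z≤n) d>0) κ>0
  e₀ : ∀ d κ J₀ s X W E → J₀ * (6 * d * (κ * E * (s + X))) + (6 * d * J₀ * (κ * E * W + (E + 10 * κ) * X) + κ * E * (J₀ * X))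
    ≡ J₀ * (6 * d * (κ * E * W + (E + 10 * κ) * X) + κ * E * X) + 6 * d * J₀ * (κ * E * (s + X))
  e₀ = solve-∀
  e : ∀ d κ E s X W → E * (3 * (2 * d * κ * s)) + (6 * d * (κ * E * W + (E + 10 * κ) * X) + κ * E * X + κ * E * ((1 + 6 * d) * X) + E * κ * X)
    ≡ E * (3 * ((2 * d + κ) * X)) + (6 * d * (κ * E * (s + X)) + κ * E * (6 * d * W) + 60 * d * κ * X)
  e = solve-∀

module Finite (k l d : ℕ) (l≤k : l ≤ k) (d>0 : 0 < d) where

  κ E J₀ I : ℕ
  κ = suc k + suc l
  E = 60 * d * κ

  E>0 : 0 < E
  E>0 = *-mono-≤ {1} (*-mono-≤ {1} {60} (s≤s z≤n) d>0) (s≤s z≤n)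

  J₀ = 2 + κ * E * (8 * E * suc (2 * E))
  I = 6 * d * J₀

  open Levels k l E I E>0 using (F; Kτ; F>0; Kτ>0; M)

  2κ≤E : 2 * κ ≤ E
  2κ≤E = *-monoˡ-≤ κ (≤-trans (s≤s (s≤s z≤n)) (m≤m*n 60 d {{>-nonZero d>0}}))

  module _ (τ : Tower k l E F Kτ) where

    open Tower τ

    -- Large enough for every multiplier `M r * suc c` used at the levels below `I`, and positive,
    -- so that dilation by 1 embeds one ball in the next.
    Λ : ℕ
    Λ = suc (∑ I (λ r → M r * N r))

    instance
      6d≢0 : NonZero (6 * d)
      6d≢0 = >-nonZero (*-mono-≤ {1} {6} (s≤s z≤n) d>0)

    slow : Σ ℕ λ e → 6 * d * length (ball Λ (suc e)) ≤ suc (6 * d) * length (ball Λ e)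
    slow = slow-growth (6 * d) Λ (λ e → length (ball Λ e)) (ball-nonempty Λ 0) (ball-size Λ)

    N>0 : ∀ r → 0 < N r
    N>0 r = ≤-<-trans z≤n (N-large r)

    M>0 : ∀ r → 0 < M r
    M>0 r = m^n>0 F {{>-nonZero F>0}} (I ∸ r)

    multiplier≤Λ : ∀ r c → r < I → c < N r → M r * suc c ≤ Λ
    multiplier≤Λ r c r<I c<N = ≤-trans (*-monoʳ-≤ (M r) c<N)
      (≤-trans (∑-term I (λ r → M r * N r) r r<I) (n≤1+n _))

    module _ (e : ℕ) (S : List ℕ) (uS : Unique S) (S⊆W : S ⊆ ball Λ (suc e)) (free : SumFree (suc k) (suc l) S) where

      X : List ℕ
      X = ball Λ e

      s x W : ℕ
      s = length S
      x = length X
      W = length (ball Λ (suc e))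

      T : ℕ → ℕ → Bool
      T c n = does (n * c ∈? S)

      open Levels k l E I E>0 using (dense; dense?; #dense; R; few-dense)

      dense′ : ℕ → ℕ → Bool
      dense′ c = dense τ (T c) (dilation-free free c)

      -- `dilate-count` is averaged over the multipliers in the lattice of level r. For each c in
      -- `X`, the dilate `T c` either has density below 1/κ + 10/E there or is dense at r and is
      -- bounded trivially; `few-dense` limits the second case once the levels are summed.
      at-level : ∀ r → r < I → κ * E * (s + x) ≤ κ * E * W + (E + 10 * κ) * x + κ * E * ∑ˡ X (λ c → χ (dense′ c r))
      at-level r r<I = *-cancelˡ-≤ (N r) {{>-nonZero (N>0 r)}} (≤-by
          (κ * E * (N r * (s + x)) + κ * E * ∑ˡ X (λ c → ♯ (N r) (Rᶜ c)))
          (κ * E * (N r * W + ∑ˡ X (λ c → ♯ (N r) (Rᶜ c))) + ((E + 10 * κ) * N r * x + κ * E * N r * ∑ˡ X (λ c → χ (dense′ c r))))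
          (+-mono-≤ (*-monoʳ-≤ (κ * E) counted) densities)
          (eq (κ * E) (E + 10 * κ) (N r) s x W _ _))
        where
        open ≤-Reasoning
        Rᶜ : ℕ → ℕ → Bool
        Rᶜ c = R τ (T c) (dilation-free free c) r
        eq : ∀ K a N s x W h D → N * (K * (s + x)) + (K * (N * W + h) + (a * N * x + K * N * D))
          ≡ N * (K * W + a * x + K * D) + (K * (N * (s + x)) + K * h)
        eq = solve-∀
        counted : N r * (s + x) ≤ N r * W + ∑ˡ X (λ c → ♯ (N r) (Rᶜ c))
        counted = begin
          N r * (s + x)
            ≡⟨ sym (∑-const (N r) _) ⟩
          ∑ (N r) (λ _ → s + x)
            ≤⟨ ∑-mono (N r) (λ n n<N → dilate-count (M r * suc n) S X (ball Λ (suc e)) (*-mono-≤ {1} (M>0 r) (s≤s z≤n)) uS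
                 (ball-unique Λ e) S⊆W (ball-dilate Λ e (M r * suc n) (*-mono-≤ {1} (M>0 r) (s≤s z≤n)) (multiplier≤Λ r n r<I n<N))) ⟩
          ∑ (N r) (λ n → W + ∑ˡ X (λ c → χ (T c (M r * suc n))))
            ≡⟨ trans (∑-+ (N r) _ _) (cong₂ _+_ (∑-const (N r) W) (∑-∑ˡ (N r) X _)) ⟩
          N r * W + ∑ˡ X (λ c → ∑ (N r) (λ n → χ (T c (M r * suc n))))
            ≤⟨ +-monoʳ-≤ (N r * W) (∑ˡ-mono X (λ c → ≤-reflexive (∑-cong (N r) (λ n n<N →
                 cong (λ b → χ (b ∧ T c (M r * suc n))) (sym (dec-true (n <? N r) n<N)))))) ⟩
          N r * W + ∑ˡ X (λ c → ♯ (N r) (Rᶜ c)) ∎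
        one : ∀ c → κ * E * ♯ (N r) (Rᶜ c) ≤ (E + 10 * κ) * N r + κ * E * N r * χ (dense′ c r)
        one c with bool-case (dense′ c r)
        ... | inj₁ dt = ≤-trans (*-monoʳ-≤ (κ * E) (♯≤ (N r) (Rᶜ c))) (≤-trans (≤-reflexive (sym (trans
                (cong (λ z → κ * E * N r * χ z) dt) (*-identityʳ _)))) (m≤n+m _ ((E + 10 * κ) * N r)))
        ... | inj₂ df = ≤-trans (<⇒≤ (≰⇒> (does-false (dense? τ (T c) (dilation-free free c) r) df))) (m≤m+n _ _)
        densities : κ * E * ∑ˡ X (λ c → ♯ (N r) (Rᶜ c)) ≤ (E + 10 * κ) * N r * x + κ * E * N r * ∑ˡ X (λ c → χ (dense′ c r))
        densities = begin
          κ * E * ∑ˡ X (λ c → ♯ (N r) (Rᶜ c))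
            ≡⟨ sym (∑ˡ-*ˡ X (κ * E) _) ⟩
          ∑ˡ X (λ c → κ * E * ♯ (N r) (Rᶜ c))
            ≤⟨ ∑ˡ-mono X one ⟩
          ∑ˡ X (λ c → (E + 10 * κ) * N r + κ * E * N r * χ (dense′ c r))
            ≡⟨ trans (∑ˡ-+ X _ _) (cong₂ _+_ (trans (∑ˡ-const X _) (*-comm x _)) (∑ˡ-*ˡ X (κ * E * N r) _)) ⟩
          (E + 10 * κ) * N r * x + κ * E * N r * ∑ˡ X (λ c → χ (dense′ c r)) ∎

      all-levels : I * (κ * E * (s + x)) ≤ I * (κ * E * W + (E + 10 * κ) * x) + κ * E * (J₀ * x)
      all-levels = begin
        I * (κ * E * (s + x))
          ≡⟨ sym (∑-const I _) ⟩
        ∑ I (λ _ → κ * E * (s + x))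
          ≤⟨ ∑-mono I at-level ⟩
        ∑ I (λ r → κ * E * W + (E + 10 * κ) * x + κ * E * ∑ˡ X (λ c → χ (dense′ c r)))
          ≡⟨ trans (∑-+ I _ _) (cong₂ _+_ (∑-const I _) (trans (∑-*ˡ I (κ * E) _) (cong (κ * E *_) (∑-∑ˡ I X _)))) ⟩
        I * (κ * E * W + (E + 10 * κ) * x) + κ * E * ∑ˡ X (λ c → #dense τ (T c) (dilation-free free c) I)
          ≤⟨ +-monoʳ-≤ _ (*-monoʳ-≤ (κ * E) (≤-trans (∑ˡ-mono X (λ c → few-dense τ (T c) (dilation-free free c) I ≤-refl))
               (≤-reflexive (trans (∑ˡ-const X J₀) (*-comm x J₀))))) ⟩
        I * (κ * E * W + (E + 10 * κ) * x) + κ * E * (J₀ * x) ∎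
        where open ≤-Reasoning

      x≤W : x ≤ W
      x≤W = unique-⊆-length (ball-unique Λ e) (λ {y} y∈ → subst (_∈ ball Λ (suc e)) (*-identityˡ y)
        (ball-dilate Λ e 1 z<s (s≤s z≤n) y∈))

      bound : 6 * d * W ≤ suc (6 * d) * x → 2 * d * κ * s ≤ (2 * d + κ) * W
      bound slowly = final-arithmetic d κ J₀ s x W d>0 z<s z<s all-levels slowly x≤W

  result : Σ (List ℕ) λ W → PosSet W × 0 < length W ×
    (∀ S → SumFreeSubset (suc k) (suc l) W S → 2 * d * κ * length S ≤ (2 * d + κ) * length W)
  result =
    let τ = tower k l E F Kτ l≤k 2κ≤E E>0 F>0 Kτ>0
        e , slowly = slow τ
    in ball (Λ τ) (suc e) , (ball-unique (Λ τ) (suc e) , All.tabulate (λ x∈ → products-pos (Λ τ) (suc e) (ball-∈⁻ (Λ τ) (suc e) x∈))) ,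
       ball-nonempty (Λ τ) (suc e) ,
       λ { S (uS , S⊆W , free) → bound τ e S uS S⊆W free slowly }

-- The upper bound for all large N, by disjoint dilates.

tiles : ℕ → ℕ → (ℕ → List ℕ) → List ℕ
tiles b zero    W = []
tiles b (suc t) W = map (_* b ^ t) (W t) ++ tiles b t W

tiles-∈ : ∀ b t W {y} → y ∈ tiles b t W → Σ ℕ λ i → Σ ℕ λ a → i < t × a ∈ W i × y ≡ a * b ^ i
tiles-∈ b (suc t) W y∈ with ∈-++⁻ (map (_* b ^ t) (W t)) y∈
... | inj₁ p = let a , a∈ , eq = ∈-map⁻ (_* b ^ t) p in t , a , n<1+n t , a∈ , eq
... | inj₂ q = let i , a , i<t , rest = tiles-∈ b t W q in i , a , m<n⇒m<1+n i<t , rest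

tiles-∈⁺ : ∀ b t W {i a} → i < t → a ∈ W i → a * b ^ i ∈ tiles b t W
tiles-∈⁺ b (suc t) W {i} i<1+t a∈ with m≤n⇒m<n∨m≡n (s≤s⁻¹ i<1+t)
... | inj₁ i<t  = ∈-++⁺ʳ (map (_* b ^ t) (W t)) (tiles-∈⁺ b t W i<t a∈)
... | inj₂ refl = ∈-++⁺ˡ (∈-map⁺ (_* b ^ t) a∈)

tiles-length : ∀ b t W → length (tiles b t W) ≡ ∑ t (λ i → length (W i))
tiles-length b zero    W = refl
tiles-length b (suc t) W = trans (length-++ (map (_* b ^ t) (W t))) (trans
  (cong₂ _+_ (length-map (_* b ^ t) (W t)) (tiles-length b t W)) (trans (+-comm (length (W t)) _) (sym (∑-last t (λ i → length (W i))))))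

∑ˡ-term : ∀ xs {x} → x ∈ xs → x ≤ ∑ˡ xs (λ y → y)
∑ˡ-term (x ∷ xs) (here refl) = m≤m+n x _
∑ˡ-term (y ∷ xs) (there x∈)  = ≤-trans (∑ˡ-term xs x∈) (m≤n+m _ y)

module Tiling (k l d : ℕ) (W : List ℕ) (pos : PosSet W) (W>0 : 0 < length W)
  (extremal : ∀ S → SumFreeSubset k l W S → 2 * d * (k + l) * length S ≤ (2 * d + (k + l)) * length W)
  (N : ℕ) (N-large : 2 * d * length W ≤ N) where

  -- b exceeds every element of W, so the dilates b^i W are disjoint.
  n₀ b t r : ℕ
  n₀ = length W
  b = suc (∑ˡ W (λ y → y))

  instance
    n₀≢0 : NonZero n₀
    n₀≢0 = >-nonZero W>0

  t = N / n₀
  r = N % n₀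

  A₀ extra A : List ℕ
  A₀ = tiles b t (λ _ → W)
  -- The remainder of N modulo |W| is filled with numbers beyond all tiles. There are fewer than |W|
  -- ≤ N/(2d) of them, so counting them all uses up the other half of 1/d.
  extra = applyUpTo (λ j → b ^ t + j) r
  A = extra ++ A₀

  tile-< : ∀ n {y} → y ∈ tiles b n (λ _ → W) → y < b ^ n
  tile-< n y∈ = let i , a , i<n , a∈ , eq = tiles-∈ b n (λ _ → W) y∈ in
    <-≤-trans (subst (_< b * b ^ i) (sym eq) (*-monoˡ-< (b ^ i) {{m^n≢0 b i}} (s≤s (∑ˡ-term W a∈)))) (^-monoʳ-≤ b i<n)

  tiles-unique : ∀ n → Unique (tiles b n (λ _ → W))
  tiles-unique zero    = []
  tiles-unique (suc n) = Uniqueₚ.++⁺ (Uniqueₚ.map⁺ (λ {x} {y} → *-cancelʳ-≡ x y (b ^ n) {{m^n≢0 b n}}) (proj₁ pos)) (tiles-unique n)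
    λ { (p , q) → let a , a∈ , eq = ∈-map⁻ (_* b ^ n) p in
        <⇒≱ (tile-< n q) (subst (b ^ n ≤_) (sym eq) (m≤n*m (b ^ n) a {{>-nonZero (All.lookup (proj₂ pos) a∈)}})) }

  extra-∈ : ∀ {y} → y ∈ extra → b ^ t ≤ y
  extra-∈ y∈ = let j , _ , eq = ∈-applyUpTo⁻ (λ j → b ^ t + j) y∈ in subst (b ^ t ≤_) (sym eq) (m≤m+n (b ^ t) j)

  A-pos : PosSet A
  A-pos = Uniqueₚ.++⁺ (Uniqueₚ.applyUpTo⁺₁ (λ j → b ^ t + j) r (λ i<j _ eq → <⇒≢ i<j (+-cancelˡ-≡ (b ^ t) _ _ eq)))
      (tiles-unique t) (λ { (p , q) → <⇒≱ (tile-< t q) (extra-∈ p) })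
    , All.tabulate λ y∈ → positive (∈-++⁻ extra y∈)
    where
    positive : ∀ {y} → y ∈ extra ⊎ y ∈ A₀ → 0 < y
    positive (inj₁ p) = <-≤-trans (m^n>0 b t) (extra-∈ p)
    positive (inj₂ q) = let i , a , _ , a∈ , eq = tiles-∈ b t (λ _ → W) q in
      subst (0 <_) (sym eq) (*-mono-≤ {1} (All.lookup (proj₂ pos) a∈) (m^n>0 b i))

  A-length : length A ≡ N
  A-length = trans (length-++ extra) (trans (cong₂ _+_ (length-applyUpTo _ r)
    (trans (tiles-length b t (λ _ → W)) (∑-const t n₀))) (sym (m≡m%n+[m/n]*n N n₀)))

  module _ (S : List ℕ) (uS : Unique S) (S⊆A : S ⊆ A) (free : SumFree k l S) where

    part : ℕ → List ℕ
    part i = filter (λ a → a * b ^ i ∈? S) W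

    part-bound : ∀ i → 2 * d * (k + l) * length (part i) ≤ (2 * d + (k + l)) * n₀
    part-bound i = extremal (part i)
      ( Uniqueₚ.filter⁺ (λ a → a * b ^ i ∈? S) (proj₁ pos)
      , (λ a∈ → proj₁ (∈-filter⁻ (λ a → a * b ^ i ∈? S) {xs = W} a∈))
      , λ x y x∈ y∈ eq → free (λ j → x j * b ^ i) (λ j → y j * b ^ i)
          (λ j → proj₂ (∈-filter⁻ (λ a → a * b ^ i ∈? S) {xs = W} (x∈ j)))
          (λ j → proj₂ (∈-filter⁻ (λ a → a * b ^ i ∈? S) {xs = W} (y∈ j)))
          (trans (sumF-* x (b ^ i)) (trans (cong (_* b ^ i) eq) (sym (sumF-* y (b ^ i))))))

    S-covered : S ⊆ extra ++ tiles b t part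
    S-covered y∈ with ∈-++⁻ extra (S⊆A y∈)
    ... | inj₁ p = ∈-++⁺ˡ p
    ... | inj₂ q = let i , a , i<t , a∈ , eq = tiles-∈ b t (λ _ → W) q in
      ∈-++⁺ʳ extra (subst (_∈ tiles b t part) (sym eq) (tiles-∈⁺ b t part i<t
        (∈-filter⁺ (λ a → a * b ^ i ∈? S) a∈ (subst (_∈ S) eq y∈))))

    bound : d * (k + l) * length S ≤ d * N + (k + l) * N
    bound = *-cancelˡ-≤ 2 (begin
      2 * (d * κ * length S)
        ≤⟨ *-monoʳ-≤ 2 (*-monoʳ-≤ (d * κ) S≤) ⟩
      2 * (d * κ * (r + ∑ t (λ i → length (part i))))
        ≡⟨ e₁ d κ r _ ⟩
      2 * d * κ * r + 2 * d * κ * ∑ t (λ i → length (part i))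
        ≤⟨ +-mono-≤ (*-monoʳ-≤ (2 * d * κ) (<⇒≤ (m%n<n N n₀))) (≤-trans (≤-reflexive (sym (∑-*ˡ t (2 * d * κ) _)))
             (∑-bound t ((2 * d + κ) * n₀) (λ i _ → part-bound i))) ⟩
      2 * d * κ * n₀ + t * ((2 * d + κ) * n₀)
        ≡⟨ e₂ d κ n₀ t ⟩
      κ * (2 * d * n₀) + (2 * d + κ) * (t * n₀)
        ≤⟨ +-mono-≤ (*-monoʳ-≤ κ N-large) (*-monoʳ-≤ (2 * d + κ) tn₀≤N) ⟩
      κ * N + (2 * d + κ) * N
        ≡⟨ e₃ d κ N ⟩
      2 * (d * N + κ * N) ∎)
      where
      open ≤-Reasoning
      κ : ℕ
      κ = k + l
      tn₀≤N : t * n₀ ≤ N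
      tn₀≤N = ≤-trans (m≤n+m (t * n₀) r) (≤-reflexive (sym (m≡m%n+[m/n]*n N n₀)))
      S≤ : length S ≤ r + ∑ t (λ i → length (part i))
      S≤ = ≤-trans (unique-⊆-length uS S-covered) (≤-reflexive (trans (length-++ extra)
        (cong₂ _+_ (length-applyUpTo _ r) (tiles-length b t part))))
      e₁ : ∀ d κ r s → 2 * (d * κ * (r + s)) ≡ 2 * d * κ * r + 2 * d * κ * s
      e₁ = solve-∀
      e₂ : ∀ d κ n t → 2 * d * κ * n + t * ((2 * d + κ) * n) ≡ κ * (2 * d * n) + (2 * d + κ) * (t * n)
      e₂ = solve-∀
      e₃ : ∀ d κ N → κ * N + (2 * d + κ) * N ≡ 2 * (d * N + κ * N)
      e₃ = solve-∀

  upper : UpperBound k l d N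
  upper = A , A-pos , A-length , λ { S (uS , S⊆A , free) → bound S uS S⊆A free }

-- The lower bound, by dilation modulo n.

sumF-mono : ∀ {n} (f g : Fin n → ℕ) → (∀ i → f i ≤ g i) → sumF f ≤ sumF g
sumF-mono {zero}  f g h = z≤n
sumF-mono {suc n} f g h = +-mono-≤ (h zero) (sumF-mono (λ i → f (suc i)) (λ i → g (suc i)) (λ i → h (suc i)))

sumF-const : ∀ n c → sumF {n} (λ _ → c) ≡ n * c
sumF-const zero    c = refl
sumF-const (suc n) c = cong (c +_) (sumF-const n c)

sumF-cong : ∀ {n} (f g : Fin n → ℕ) → (∀ i → f i ≡ g i) → sumF f ≡ sumF g
sumF-cong {zero}  f g h = refl
sumF-cong {suc n} f g h = cong₂ _+_ (h zero) (sumF-cong _ _ (λ i → h (suc i)))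

sumF-+ : ∀ {n} (f g : Fin n → ℕ) → sumF (λ i → f i + g i) ≡ sumF f + sumF g
sumF-+ {zero}  f g = refl
sumF-+ {suc n} f g = trans (cong (f zero + g zero +_) (sumF-+ (λ i → f (suc i)) (λ i → g (suc i)))) (e (f zero) (g zero) _ _)
  where
  e : ∀ a b c d → a + b + (c + d) ≡ a + c + (b + d)
  e = solve-∀

∑-delta : ∀ n s (f : ℕ → ℕ) → s < n → f s ≡ ∑ n (λ t → χ (does (s ≟ t)) * f t)
∑-delta (suc n) zero f _ = trans (sym (+-identityʳ (f 0))) (cong₂ _+_ (sym (+-identityʳ (f 0)))
  (sym (trans (∑-cong′ n (λ t → refl)) (∑-zero n))))
∑-delta (suc n) (suc s) f (s≤s s<n) = ∑-delta n s (λ t → f (suc t)) s<n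

∑-injection : ∀ n (σ f : ℕ → ℕ) → (∀ r → r < n → σ r < n) →
  (∀ i j → i < n → j < n → σ i ≡ σ j → i ≡ j) → ∑ n (λ r → f (σ r)) ≤ ∑ n f
∑-injection n σ f σ< inj = begin
  ∑ n (λ r → f (σ r))                                   ≡⟨ ∑-cong n (λ r r<n → ∑-delta n (σ r) f (σ< r r<n)) ⟩
  ∑ n (λ r → ∑ n (λ t → χ (does (σ r ≟ t)) * f t))      ≡⟨ ∑-swap n n _ ⟩
  ∑ n (λ t → ∑ n (λ r → χ (does (σ r ≟ t)) * f t))      ≡⟨ ∑-cong′ n (λ t → ∑-*ʳ n (f t) _) ⟩
  ∑ n (λ t → ∑ n (λ r → χ (does (σ r ≟ t))) * f t)      ≤⟨ ∑-mono′ n (λ t → ≤-trans (*-monoˡ-≤ (f t) (once t)) (≤-reflexive (*-identityˡ (f t)))) ⟩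
  ∑ n f                                                 ∎
  where
  open ≤-Reasoning
  once : ∀ t → ∑ n (λ r → χ (does (σ r ≟ t))) ≤ 1
  once t = ≮⇒≥ λ gt → let i , j , i<j , j<n , p , q = two-witnesses n (λ r → does (σ r ≟ t)) gt in
    <⇒≢ i<j (inj i j (<-trans i<j j<n) j<n (trans (does-true (σ i ≟ t) p) (sym (does-true (σ j ≟ t) q))))

∑-≤-witness : ∀ n (f g : ℕ → ℕ) → 0 < n → ∑ n f ≤ ∑ n g → Σ ℕ λ x → x < n × f x ≤ g x
∑-≤-witness n f g n>0 le =
  let x , x<n , lt = ∑-<-witness n f (λ y → suc (g y)) (≤-<-trans le (<-≤-trans (m<n+m (∑ n g) n>0)
        (≤-reflexive (sym (trans (∑-+ n (λ _ → 1) g) (cong (_+ ∑ n g) (trans (∑-const n 1) (*-identityʳ n))))))))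
  in x , x<n , s≤s⁻¹ lt

∑ˡ-mono-∈ : ∀ xs {f g : ℕ → ℕ} → (∀ {x} → x ∈ xs → f x ≤ g x) → ∑ˡ xs f ≤ ∑ˡ xs g
∑ˡ-mono-∈ []       h = z≤n
∑ˡ-mono-∈ (x ∷ xs) h = +-mono-≤ (h (here refl)) (∑ˡ-mono-∈ xs (λ x∈ → h (there x∈)))

length-filter-∑ˡ : ∀ {P : ℕ → Set} (P? : ∀ x → Dec (P x)) xs → length (filter P? xs) ≡ ∑ˡ xs (λ x → χ (does (P? x)))
length-filter-∑ˡ P? [] = refl
length-filter-∑ˡ P? (x ∷ xs) with P? x
... | yes _ = cong suc (length-filter-∑ˡ P? xs)
... | no _  = length-filter-∑ˡ P? xs

-- Modulo n = g κ q + 1, the interval (l q, k q] is (k,l)-sum-free and contains g q residues.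

module Lower (l g : ℕ) (g>0 : 0 < g) (A : List ℕ) (pos : PosSet A) where

  -- `q` is a multiple of each a in `A`, so n ≡ 1 modulo a and a is invertible modulo `n`. It also
  -- exceeds `N`, which makes the rounding in `size` free of loss.
  k κ N q n : ℕ
  k = l + g
  κ = k + l
  N = length A
  q = suc N * product A
  n = suc (g * κ * q)

  ∏>0 : 0 < product A
  ∏>0 = >-nonZero⁻¹ (product A) {{product≢0 (All.map (λ x>0 → >-nonZero x>0) (proj₂ pos))}}

  N<q : N < q
  N<q = m≤m*n (suc N) (product A) {{>-nonZero ∏>0}}

  inside? : ∀ x → Dec (l * q < x × x ≤ k * q)
  inside? x = (l * q <? x) ×-dec (x ≤? k * q)

  member? : ∀ t a → Dec (l * q < t * a % n × t * a % n ≤ k * q)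
  member? t a = inside? (t * a % n)

  S : ℕ → List ℕ
  S t = filter (member? t) A

  many-inside : g * q ≤ ∑ n (λ x → χ (does (inside? x)))
  many-inside = begin
    g * q                                                              ≡⟨ sym (trans (∑-const (g * q) 1) (*-identityʳ (g * q))) ⟩
    ∑ (g * q) (λ _ → 1)                                                ≤⟨ ∑-mono (g * q) (λ j j< → ≤-reflexive (sym (χ-true (dec-true (inside? (suc (l * q) + j)) (ins j j<))))) ⟩
    ∑ (g * q) (λ j → χ (does (inside? (suc (l * q) + j))))             ≤⟨ m≤n+m _ (∑ (suc (l * q)) f) ⟩
    ∑ (suc (l * q)) f + ∑ (g * q) (λ j → f (suc (l * q) + j))          ≡⟨ sym (∑-split (suc (l * q)) (g * q) f) ⟩
    ∑ (suc (l * q) + g * q) f                                          ≤⟨ ∑-mono-range f (s≤s fits) ⟩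
    ∑ n f                                                              ∎
    where
    open ≤-Reasoning
    f : ℕ → ℕ
    f x = χ (does (inside? x))
    ins : ∀ j → j < g * q → l * q < suc (l * q) + j × suc (l * q) + j ≤ k * q
    ins j j< = m≤m+n (suc (l * q)) j , ≤-trans (≤-reflexive (sym (+-suc (l * q) j)))
      (≤-trans (+-monoʳ-≤ (l * q) j<) (≤-reflexive (sym (*-distribʳ-+ q l g))))
    fits : l * q + g * q ≤ g * κ * q
    fits = ≤-trans (≤-reflexive (sym (*-distribʳ-+ q l g))) (*-monoˡ-≤ q (≤-trans (m≤m+n k l) (m≤n*m κ g {{>-nonZero g>0}})))

  -- If n = 1 + a c, then (n - c) r is the residue t with t a ≡ r.
  uniform : ∀ {a} → a ∈ A → g * q ≤ ∑ n (λ t → χ (does (member? t a)))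
  uniform {a} a∈ = ≤-trans many-inside (≤-trans (≤-reflexive (∑-cong n (λ r r<n →
      cong (λ z → χ (does (inside? z))) (sym (σa r r<n)))))
    (∑-injection n σ (λ t → χ (does (member? t a))) (λ r _ → m%n<n (u * r) n)
      (λ i j i<n j<n eq → trans (sym (σa i i<n)) (trans (cong (λ z → z * a % n) eq) (σa j j<n)))))
    where
    a∣q : a ∣ g * κ * q
    a∣q = ∣-trans (∣-trans (∈⇒∣product a∈) (n∣m*n (suc N))) (n∣m*n (g * κ))
    c u : ℕ
    c = _∣_.quotient a∣q
    u = n ∸ c
    a>0 : 0 < a
    a>0 = All.lookup (proj₂ pos) a∈
    n≡ : n ≡ suc (c * a)
    n≡ = cong suc (_∣_.equality a∣q)
    c≤n : c ≤ n
    c≤n = ≤-trans (m≤m*n c a {{>-nonZero a>0}}) (≤-trans (n≤1+n _) (≤-reflexive (sym n≡)))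
    ua : u * a ≡ 1 + pred a * n
    ua = +-cancelʳ-≡ (c * a) (u * a) (1 + pred a * n) (begin
      u * a + c * a              ≡⟨ sym (*-distribʳ-+ a u c) ⟩
      (u + c) * a                ≡⟨ cong (_* a) (m∸n+n≡m c≤n) ⟩
      n * a                      ≡⟨ cong (n *_) (sym (suc-pred a {{>-nonZero a>0}})) ⟩
      n * suc (pred a)           ≡⟨ e n (pred a) ⟩
      pred a * n + n             ≡⟨ cong (pred a * n +_) n≡ ⟩
      pred a * n + suc (c * a)   ≡⟨ +-suc (pred a * n) (c * a) ⟩
      1 + pred a * n + c * a     ∎)
      where
      open ≡-Reasoning
      e : ∀ n p → n * (1 + p) ≡ p * n + n
      e = solve-∀
    σ : ℕ → ℕ
    σ r = u * r % n
    σa : ∀ r → r < n → σ r * a % n ≡ r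
    σa r r<n = begin
      (u * r % n) * a % n                   ≡⟨ %-distribˡ-* (u * r % n) a n ⟩
      (u * r % n % n) * (a % n) % n         ≡⟨ cong (λ z → z * (a % n) % n) (m%n%n≡m%n (u * r) n) ⟩
      (u * r % n) * (a % n) % n             ≡⟨ sym (%-distribˡ-* (u * r) a n) ⟩
      u * r * a % n                         ≡⟨ cong (_% n) (trans (e₁ u r a) (cong (_* r) ua)) ⟩
      (1 + pred a * n) * r % n              ≡⟨ cong (_% n) (e₂ (pred a) n r) ⟩
      (r + pred a * r * n) % n              ≡⟨ [m+kn]%n≡m%n r (pred a * r) n ⟩
      r % n                                 ≡⟨ m<n⇒m%n≡m r<n ⟩
      r                                     ∎
      where
      open ≡-Reasoning
      e₁ : ∀ u r a → u * r * a ≡ u * a * r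
      e₁ = solve-∀
      e₂ : ∀ p n r → (1 + p * n) * r ≡ r + p * r * n
      e₂ = solve-∀

  large : Σ ℕ λ t → N * (g * q) ≤ n * length (S t)
  large = let t , _ , le = ∑-≤-witness n (λ _ → N * (g * q)) (λ t → n * length (S t)) z<s total in t , le
    where
    open ≤-Reasoning
    total : ∑ n (λ _ → N * (g * q)) ≤ ∑ n (λ t → n * length (S t))
    total = begin
      ∑ n (λ _ → N * (g * q))                                       ≡⟨ ∑-const n _ ⟩
      n * (N * (g * q))                                             ≡⟨ cong (n *_) (sym (∑ˡ-const A (g * q))) ⟩
      n * ∑ˡ A (λ _ → g * q)                                        ≤⟨ *-monoʳ-≤ n (∑ˡ-mono-∈ A uniform) ⟩
      n * ∑ˡ A (λ a → ∑ n (λ t → χ (does (member? t a))))           ≡⟨ cong (n *_) (sym (∑-∑ˡ n A (λ t a → χ (does (member? t a))))) ⟩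
      n * ∑ n (λ t → ∑ˡ A (λ a → χ (does (member? t a))))           ≡⟨ cong (n *_) (∑-cong′ n (λ t → sym (length-filter-∑ˡ (member? t) A))) ⟩
      n * ∑ n (λ t → length (S t))                                  ≡⟨ sym (∑-*ˡ n n (λ t → length (S t))) ⟩
      ∑ n (λ t → n * length (S t))                                  ∎

  -- `n` exceeds `κ * (g * q)` only by 1. If κ|S| were at most N - 1, the hypothesis would leave g q
  -- ≤ |S| ≤ N < q.
  size : ∀ t → N * (g * q) ≤ n * length (S t) → N ≤ κ * length (S t)
  size t le = ≮⇒≥ λ lt → <⇒≱ (<-≤-trans N<q (m≤n*m q g {{>-nonZero g>0}})) (≤-trans
    (≤-by (N * (g * q) + g * q * suc (κ * s)) (n * s + g * q * N) (+-mono-≤ le (*-monoʳ-≤ (g * q) lt)) (e g q κ s N))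
    (length-filter (member? t) A))
    where
    s : ℕ
    s = length (S t)
    e : ∀ g q κ s N → g * q + ((1 + g * κ * q) * s + g * q * N) ≡ s + (N * (g * q) + g * q * (1 + κ * s))
    e = solve-∀

  residue-sum : ∀ t {j} (x : Fin j → ℕ) → t * sumF x ≡ sumF (λ i → t * x i % n) + sumF (λ i → t * x i / n) * n
  residue-sum t x = begin
    t * sumF x                                               ≡⟨ *-comm t (sumF x) ⟩
    sumF x * t                                               ≡⟨ sym (sumF-* x t) ⟩
    sumF (λ i → x i * t)                                     ≡⟨ sumF-cong _ _ (λ i → trans (*-comm (x i) t) (m≡m%n+[m/n]*n (t * x i) n)) ⟩
    sumF (λ i → t * x i % n + t * x i / n * n)               ≡⟨ sumF-+ (λ i → t * x i % n) (λ i → t * x i / n * n) ⟩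
    sumF (λ i → t * x i % n) + sumF (λ i → t * x i / n * n)  ≡⟨ cong (sumF (λ i → t * x i % n) +_) (sumF-* (λ i → t * x i / n) n) ⟩
    sumF (λ i → t * x i % n) + sumF (λ i → t * x i / n) * n  ∎
    where open ≡-Reasoning

  no-wrap : ∀ X Y C D → Y < X → X < Y + n → X + C * n ≢ Y + D * n
  no-wrap X Y C D Y<X X<Y+n eq = <⇒≱ X<Y+n (+-cancelʳ-≤ (C * n) (Y + n) X (≤-trans (≤-reflexive (+-assoc Y n (C * n)))
    (≤-trans (+-monoʳ-≤ Y (*-monoˡ-≤ n C<D)) (≤-reflexive (sym eq)))))
    where
    C<D : C < D
    C<D = *-cancelʳ-< n C D (+-cancelˡ-< Y _ _ (<-≤-trans (+-monoˡ-< (C * n) Y<X) (≤-reflexive eq)))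

  -- Residues in (lq, kq] make the sum of k of them exceed the sum of l of them by more than 0 and
  -- less than `n`, so the two sums are not congruent modulo `n`.
  free : ∀ t → SumFree k l (S t)
  free t x y x∈ y∈ eq = no-wrap X Y C D Y<X X<Y+n (trans (sym (residue-sum t x)) (trans (cong (t *_) eq) (residue-sum t y)))
    where
    open ≤-Reasoning
    X Y C D : ℕ
    X = sumF (λ i → t * x i % n)
    Y = sumF (λ i → t * y i % n)
    C = sumF (λ i → t * x i / n)
    D = sumF (λ i → t * y i / n)
    ins : ∀ {a} → a ∈ S t → l * q < t * a % n × t * a % n ≤ k * q
    ins a∈ = proj₂ (∈-filter⁻ (member? t) {xs = A} a∈)
    lower : ∀ {j} (z : Fin j → ℕ) → (∀ i → z i ∈ S t) → j * suc (l * q) ≤ sumF (λ i → t * z i % n)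
    lower {j} z z∈ = ≤-trans (≤-reflexive (sym (sumF-const j _))) (sumF-mono _ _ (λ i → proj₁ (ins (z∈ i))))
    upper : ∀ {j} (z : Fin j → ℕ) → (∀ i → z i ∈ S t) → sumF (λ i → t * z i % n) ≤ j * (k * q)
    upper {j} z z∈ = ≤-trans (sumF-mono _ _ (λ i → proj₂ (ins (z∈ i)))) (≤-reflexive (sumF-const j _))
    Y<X : Y < X
    Y<X = begin-strict
      Y                          ≤⟨ upper y y∈ ⟩
      l * (k * q)                <⟨ m<m+n (l * (k * q)) (<-≤-trans g>0 (m≤n+m g l)) ⟩
      l * (k * q) + k            ≡⟨ e l k q ⟩
      k * suc (l * q)            ≤⟨ lower x x∈ ⟩
      X                          ∎
      where
      e : ∀ l k q → l * (k * q) + k ≡ k * (1 + l * q)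
      e = solve-∀
    X<Y+n : X < Y + n
    X<Y+n = begin-strict
      X                          ≤⟨ upper x x∈ ⟩
      k * (k * q)                <⟨ m<m+n (k * (k * q)) {suc l} z<s ⟩
      k * (k * q) + suc l        ≡⟨ e l g q ⟩
      l * suc (l * q) + n        ≤⟨ +-monoˡ-≤ n (lower y y∈) ⟩
      Y + n                      ∎
      where
      e : ∀ l g q → (l + g) * ((l + g) * q) + (1 + l) ≡ l * (1 + l * q) + (1 + g * (l + g + l) * q)
      e = solve-∀

lower-bound : ∀ k l d N → l < k → LowerBound k l d N
lower-bound k l d N l<k = subst (λ j → LowerBound j l d N) (m+[n∸m]≡n (<⇒≤ l<k)) λ A pos eq →
  let module L = Lower l (k ∸ l) (m<n⇒0<n∸m l<k) A pos
      t , le = L.large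
  in L.S t , (Uniqueₚ.filter⁺ (L.member? t) (proj₁ pos) , (λ a∈ → proj₁ (∈-filter⁻ (L.member? t) {xs = A} a∈)) , L.free t) ,
     ≤-trans (≤-trans (*-monoʳ-≤ d (subst (_≤ L.κ * length (L.S t)) eq (L.size t le)))
       (≤-reflexive (sym (*-assoc d L.κ (length (L.S t)))))) (m≤m+n _ (L.κ * N))

theorem1p1 : (k l : ℕ) → 0 < l → l < k →
    (d : ℕ) → 0 < d →
    Σ ℕ λ N₀ → (N : ℕ) → N₀ ≤ N →
    LowerBound k l d N × UpperBound k l d N
theorem1p1 (suc k) (suc l) _ (s≤s l<k) d d>0 =
  let W , pos , W>0 , extremal = Finite.result k l d (<⇒≤ l<k) d>0
  in 2 * d * length W , λ N N≥ →
     lower-bound (suc k) (suc l) d N (s≤s l<k) ,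
     Tiling.upper (suc k) (suc l) d W pos W>0 extremal N N≥
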